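{- Let $w$ be a vexillary permutation with shape $\mu=\mu(w)$ and supershape $\lambda=\lambda(w)$. Then $\mathfrak{S}_w(1,1,\ldots,1)=|\mathcal{E}(\lambda/\mu)|$.
   Context: $\mathfrak{S}_w$ is the (single) Schubert polynomial of $w$. A permutation is vexillary if it avoids the pattern $2143$. The Rothe diagram of $w\in S_n$ is $D(w)=\{(i,w_j): i<j,\ w_i>w_j\}\subseteq[n]\times[n]$. For vexillary $w$, $\mu(w)$ is the partition obtained by sorting the row lengths of $D(w)$ in decreasing order (up to permuting rows and columns $D(w)$ is the Young diagram of $\mu(w)$), and $\lambda(w)$ is the smallest partition whose Young diagram contains $D(w)$. Excited diagrams $\mathcal{E}(\lambda/\mu)$: subsets of $[\lambda]$ obtained from $[\mu]$ by repeatedly replacing a cell $(i,j)\in D$ by $(i+1,j+1)$ whenever $(i+1,j),(i,j+1),(i+1,j+1)$ all lie in $[\lambda]\setminus D$. -}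

module Defs where

open import Data.Nat using (ℕ; zero; suc; _+_; _*_; _∸_; _≤_; _<_; _<?_; _<ᵇ_; _≥_)
open import Data.Nat.Properties using (≤-decTotalOrder)
open import Data.Bool using (Bool; true; false; if_then_else_)
open import Data.Integer as ℤ using (ℤ; +_)
open import Data.Fin as Fin using (Fin; toℕ; inject₁)
open import Data.Fin.Permutation using (Permutation′; _⟨$⟩ʳ_)
open import Data.Vec as Vec using (Vec; _[_]≔_; tabulate)
open import Data.List as List using (List; []; _∷_; map; concatMap; upTo; filter; length; reverse; allFin)
open import Data.List.Relation.Unary.All using (All)
open import Data.List.Relation.Unary.Linked using (Linked)
open import Data.List.Relation.Unary.Unique.Propositional using (Unique)
open import Data.List.Membership.Propositional using (_∈_)
open import Data.Product using (Σ; ∃; ∃-syntax; _×_; _,_)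
open import Data.Maybe using (Maybe; just; nothing)
open import Relation.Nullary using (¬_; yes; no)
open import Relation.Nullary.Decidable using (⌊_⌋)
open import Relation.Binary.PropositionalEquality using (_≡_)
open import Relation.Binary.Construct.Closure.ReflexiveTransitive using (Star)
open import Function using (_∘_; _⇔_)
import Data.List.Sort

-- Polynomials in x₁,…,xₙ with integer coefficients, as formal sums of
-- monomials (exponent vector, coefficient).  Not normalised; all the
-- operations below are linear, so this is harmless.

Monomial : ℕ → Set
Monomial n = Vec ℕ n

Poly : ℕ → Set
Poly n = List (Monomial n × ℤ)

evalOne : ∀ {n} → Poly n → ℤ
evalOne [] = + 0
evalOne ((_ , c) ∷ p) = c ℤ.+ evalOne p

-- Divided difference ∂ᵢ f = (f − sᵢ f)/(xᵢ − xᵢ₊₁), where (0-indexed)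
-- the two variables are at positions inject₁ i and suc i.  On a monomial
-- with exponents a at xᵢ and b at xᵢ₊₁ this is written out explicitly:
--   a > b : Σ_{k<a−b} x^(.. xᵢ^(a−1−k) xᵢ₊₁^(b+k) ..)
--   a < b : − Σ_{k<b−a} x^(.. xᵢ^(a+k) xᵢ₊₁^(b−1−k) ..)
--   a = b : 0
ddMono : ∀ {m} → Fin m → Monomial (suc m) → ℤ → Poly (suc m)
ddMono {m} i e c = go (Vec.lookup e (inject₁ i)) (Vec.lookup e (Fin.suc i))
  where
  set : ℕ → ℕ → Monomial (suc m)
  set x y = (e [ inject₁ i ]≔ x) [ Fin.suc i ]≔ y
  go : ℕ → ℕ → Poly (suc m)
  go a b with b <? a
  ... | yes _ = map (λ k → set (a ∸ 1 ∸ k) (b + k) , c) (upTo (a ∸ b))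
  ... | no _  = map (λ k → set (a + k) (b ∸ 1 ∸ k) , ℤ.- c) (upTo (b ∸ a))

dd : ∀ {m} → Fin m → Poly (suc m) → Poly (suc m)
dd i = concatMap (λ { (e , c) → ddMono i e c })

firstAscent : ∀ {m} → (Fin (suc m) → Fin (suc m)) → Maybe (Fin m)
firstAscent {m} f = go (allFin m)
  where
  go : List (Fin m) → Maybe (Fin m)
  go [] = nothing
  go (i ∷ is) with toℕ (f (inject₁ i)) <? toℕ (f (Fin.suc i))
  ... | yes _ = just i
  ... | no _  = go is

simple : ∀ {m} → Fin m → Fin (suc m) → Fin (suc m)
simple i x with x Fin.≟ inject₁ i | x Fin.≟ Fin.suc i
... | yes _ | _     = Fin.suc i
... | no _  | yes _ = inject₁ i
... | no _  | no _  = x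

staircase : ∀ n → Monomial n
staircase n = tabulate (λ i → n ∸ 1 ∸ toℕ i)

-- 𝔖_w : if w = w₀ (no ascent) then x^δ, otherwise for an ascent i,
-- 𝔖_w = ∂ᵢ 𝔖_{w sᵢ} (ℓ(w sᵢ) = ℓ(w)+1).  The fuel bounds the number of
-- steps (at most n(n−1)/2 are ever needed).
schubertAux : ∀ {m} → ℕ → (Fin (suc m) → Fin (suc m)) → Poly (suc m)
schubertAux zero f = []
schubertAux {m} (suc fuel) f with firstAscent f
... | nothing = (staircase (suc m) , + 1) ∷ []
... | just i  = dd i (schubertAux fuel (f ∘ simple i))

schubert : ∀ {n} → Permutation′ n → Poly n
schubert {zero} w = (Vec.[] , + 1) ∷ []
schubert {suc m} w = schubertAux (suc m * suc m) (w ⟨$⟩ʳ_)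

Vexillary : ∀ {n} → Permutation′ n → Set
Vexillary {n} w = ¬ (∃[ a ] ∃[ b ] ∃[ c ] ∃[ d ]
  (a Fin.< b × b Fin.< c × c Fin.< d ×
   W b Fin.< W a × W a Fin.< W d × W d Fin.< W c))
  where W = w ⟨$⟩ʳ_

InRothe : ∀ {n} → Permutation′ n → ℕ → ℕ → Set
InRothe {n} w r c = ∃[ i ] ∃[ j ]
  (i Fin.< j × (w ⟨$⟩ʳ j) Fin.< (w ⟨$⟩ʳ i) × toℕ i ≡ r × toℕ (w ⟨$⟩ʳ j) ≡ c)

rowLength : ∀ {n} → Permutation′ n → Fin n → ℕ
rowLength {n} w i = length (filter (λ j → i Fin.<? j Relation.Nullary.×-dec
                                     (w ⟨$⟩ʳ j) Fin.<? (w ⟨$⟩ʳ i)) (allFin n))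
  where import Relation.Nullary

IsPartition : List ℕ → Set
IsPartition l = Linked _≥_ l × All (λ k → 1 ≤ k) l

part : List ℕ → ℕ → ℕ
part [] _ = 0
part (x ∷ _) zero = x
part (_ ∷ l) (suc r) = part l r

InYoung : List ℕ → ℕ → ℕ → Set
InYoung λ′ r c = c < part λ′ r

shape : ∀ {n} → Permutation′ n → List ℕ
shape {n} w = reverse (sort (filter (λ k → 1 Data.Nat.≤? k) (List.tabulate (rowLength w))))
  where open Data.List.Sort ≤-decTotalOrder using (sort)
        import Data.Nat

ContainsRothe : ∀ {n} → Permutation′ n → List ℕ → Set
ContainsRothe w λ′ = ∀ r c → InRothe w r c → InYoung λ′ r c

IsSupershape : ∀ {n} → Permutation′ n → List ℕ → Set
IsSupershape w λ′ = IsPartition λ′ × ContainsRothe w λ′ ×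
  (∀ ν → IsPartition ν → ContainsRothe w ν → ∀ r c → InYoung λ′ r c → InYoung ν r c)

-- Excited diagrams.  A diagram is a subset of the n×n grid (0-indexed),
-- encoded as an n×n Boolean matrix (decidable equality, canonical).

Diagram : ℕ → Set
Diagram n = Vec (Vec Bool n) n

cell : ∀ {n} → Diagram n → Fin n → Fin n → Bool
cell D i j = Vec.lookup (Vec.lookup D i) j

setCell : ∀ {n} → Diagram n → Fin n → Fin n → Bool → Diagram n
setCell D i j b = D [ i ]≔ (Vec.lookup D i [ j ]≔ b)

youngDiagram : ∀ n → List ℕ → Diagram n
youngDiagram n λ′ = tabulate (λ i → tabulate (λ j → toℕ j <ᵇ part λ′ (toℕ i)))

Excite : ∀ {n} → List ℕ → Diagram n → Diagram n → Set
Excite {n} λ′ D D′ = ∃[ i ] ∃[ j ] ∃[ i′ ] ∃[ j′ ]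
  ( toℕ i′ ≡ suc (toℕ i) × toℕ j′ ≡ suc (toℕ j)
  × cell D i j ≡ true
  × InYoung λ′ (toℕ i′) (toℕ j) × cell D i′ j ≡ false
  × InYoung λ′ (toℕ i) (toℕ j′) × cell D i j′ ≡ false
  × InYoung λ′ (toℕ i′) (toℕ j′) × cell D i′ j′ ≡ false
  × D′ ≡ setCell (setCell D i j false) i′ j′ true )

Excited : ∀ n → List ℕ → List ℕ → Diagram n → Set
Excited n λ′ μ D = Star (Excite λ′) (youngDiagram n μ) D

HasCard : ∀ n → List ℕ → List ℕ → ℕ → Set
HasCard n λ′ μ k = ∃[ L ] (Unique L × (∀ D → (D ∈ L) ⇔ Excited n λ′ μ D) × length L ≡ k)

{-# OPTIONS --safe #-}
-- A Schubert polynomial at (1,…,1) is read off from the linear functionals φ ↦ Σ c·φ(e), on which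
-- divided differences act by transposition.  The transposed operators satisfy the braid relations
-- (every functional is a multiple of the Vandermonde product, on which both sides of the relation become
-- the alternating sum), so 𝔖_w = ∂ᵢ 𝔖_{w sᵢ} for every ascent i of w, not only for the first one.
--
-- For vexillary w the claim is that 𝔖_w is the generating function of the semistandard tableaux of
-- shape μ(w) whose rows of length k have entries at most e(k), the last row of the diagram with at
-- least k cells.  Among the ascents i with the largest code entry at i + 1 take the leftmost one:
-- then w sᵢ is again vexillary, and passing from w to w sᵢ one row of length m and flag i + 1
-- becomes a row of length m + 1 and flag i.  In a Gelfand–Tsetlin pattern the layers i and i + 1
-- are linked through independent intervals, one for each row; reflecting the intervals
-- (Bender–Knuth) and telescoping the remaining row shows that ∂ᵢ undoes this change.
--
-- Finally the entry t of the cell (s , c) records that an excited diagram has moved this cell along its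
-- diagonal to row t, and for vexillary w the end of that diagonal in λ(w) is given by the flag.
module Submission where

-- The definition unwinds 𝔖_w along the first ascent, whereas the combinatorics controls only
-- particular ascents; this is why independence of the ascent, by local confluence and induction on
-- the colength, has to precede any tableau. Working with functionals also removes the question when
-- two unnormalised lists of monomials represent the same polynomial.
--
-- Maximality of the code entry prevents the swapped pair from becoming the 21 of a pattern 2143,
-- and the leftmost choice prevents it from becoming the 43. The obstacle in comparing w with w sᵢ
-- is that rows of equal length share one flag, so that changing one row may alter the flags of
-- several, while the two-layer argument allows only one row to differ. The flags are therefore
-- first replaced by adjusted ones that differ in this row alone; the sum over tableaux is
-- unchanged, because by column strictness a later row of the same length already forces the smaller
-- bound. The induction ends at the longest permutation, where a single tableau remains and gives
-- the staircase monomial.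

open import Defs

-- Formal sums, linear functionals and the transposed divided difference.

module FormalSums where
  open import Data.Nat as ℕ using (ℕ; zero; suc; _∸_; _<?_; s≤s)
  open import Data.Integer using (ℤ; +_; _+_; _-_; -_; _*_; 0ℤ; 1ℤ)
  import Data.Integer.Properties as ℤₚ
  open import Data.Integer.Tactic.RingSolver using (solve-∀)
  open import Data.Fin as Fin using (Fin; toℕ; inject₁)
  open import Data.Vec as Vec using (Vec; []; _∷_; _[_]≔_)
  open import Data.List using ([]; _∷_; map; applyUpTo; _++_)
  open import Data.Product using (_,_)
  open import Relation.Nullary using (yes; no)
  open import Relation.Binary.PropositionalEquality
  open import Data.Nat.Properties using (+-comm; +-identityʳ; +-suc; +-∸-assoc; <⇒≤; [m+n]∸[m+o]≡n∸o; m+[n∸m]≡n; m+n∸m≡n; m+n∸n≡m; m<n⇒m<1+n; m≤m+n; m≤n+m; ∸-+-assoc; ≤-refl; ≮⇒≥)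
  open ≡-Reasoning

  Σ< : ℕ → (ℕ → ℤ) → ℤ
  Σ< zero f = 0ℤ
  Σ< (suc n) f = Σ< n f + f n

  Σ<-cong : ∀ n {f g : ℕ → ℤ} → (∀ k → k ℕ.< n → f k ≡ g k) → Σ< n f ≡ Σ< n g
  Σ<-cong zero e = refl
  Σ<-cong (suc n) e = cong₂ _+_ (Σ<-cong n (λ k k<n → e k (m<n⇒m<1+n k<n))) (e n ≤-refl)

  Σ<-- : ∀ n (f g : ℕ → ℤ) → Σ< n (λ k → f k - g k) ≡ Σ< n f - Σ< n g
  Σ<-- zero f g = refl
  Σ<-- (suc n) f g = trans (cong (_+ (f n - g n)) (Σ<-- n f g)) (lem (Σ< n f) (Σ< n g) (f n) (g n))
    where lem : ∀ a b c d → (a - b) + (c - d) ≡ (a + c) - (b + d)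
          lem = solve-∀

  Σ<-+ : ∀ n (f g : ℕ → ℤ) → Σ< n (λ k → f k + g k) ≡ Σ< n f + Σ< n g
  Σ<-+ zero f g = refl
  Σ<-+ (suc n) f g = trans (cong (_+ (f n + g n)) (Σ<-+ n f g)) (lem (Σ< n f) (Σ< n g) (f n) (g n))
    where lem : ∀ a b c d → (a + b) + (c + d) ≡ (a + c) + (b + d)
          lem = solve-∀

  Σ<-0 : ∀ n → Σ< n (λ _ → 0ℤ) ≡ 0ℤ
  Σ<-0 zero = refl
  Σ<-0 (suc n) = trans (ℤₚ.+-identityʳ _) (Σ<-0 n)

  Σ<-swap : ∀ a b (f : ℕ → ℕ → ℤ) → Σ< a (λ x → Σ< b (f x)) ≡ Σ< b (λ y → Σ< a (λ x → f x y))
  Σ<-swap zero b f = sym (Σ<-0 b)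
  Σ<-swap (suc a) b f = trans (cong (_+ Σ< b (f a)) (Σ<-swap a b f)) (sym (Σ<-+ b (λ y → Σ< a (λ x → f x y)) (f a)))

  Σ<-split : ∀ b d (f : ℕ → ℤ) → Σ< (b ℕ.+ d) f ≡ Σ< b f + Σ< d (λ k → f (b ℕ.+ k))
  Σ<-split b zero f = trans (cong (λ x → Σ< x f) (+-identityʳ b)) (sym (ℤₚ.+-identityʳ _))
  Σ<-split b (suc d) f = trans (cong (λ x → Σ< x f) (+-suc b d))
    (trans (cong (_+ f (b ℕ.+ d)) (Σ<-split b d f)) (ℤₚ.+-assoc (Σ< b f) _ _))

  Σ<-head : ∀ n (f : ℕ → ℤ) → Σ< (suc n) f ≡ f 0 + Σ< n (λ k → f (suc k))
  Σ<-head zero f = ℤₚ.+-comm 0ℤ (f 0)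
  Σ<-head (suc n) f = trans (cong (_+ f (suc n)) (Σ<-head n f)) (ℤₚ.+-assoc (f 0) _ _)

  -- ∫ g (a + b) a is a discrete antiderivative: it solves ψ (a+1) b − ψ a (b+1) = g a b.
  ∫ : (ℕ → ℕ → ℤ) → ℕ → ℕ → ℤ
  ∫ g N j = Σ< j (λ t → g t (N ∸ suc t))

  -- The transpose of the divided difference in two variables.
  δ : (ℕ → ℕ → ℤ) → ℕ → ℕ → ℤ
  δ g a b = ∫ g (a ℕ.+ b) a - ∫ g (a ℕ.+ b) b

  prim : (ℕ → ℕ → ℤ) → ℕ → ℕ → ℤ
  prim g a b = ∫ g (a ℕ.+ b) a

  prim-diff : ∀ g a b → prim g (suc a) b - prim g a (suc b) ≡ g a b
  prim-diff g a b rewrite +-suc a b | m+n∸m≡n a b = lem (∫ g (suc (a ℕ.+ b)) a) (g a b)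
    where lem : ∀ x y → (x + y) - x ≡ y
          lem = solve-∀

  ∫-cong : ∀ {g h} N j → (∀ a b → g a b ≡ h a b) → ∫ g N j ≡ ∫ h N j
  ∫-cong N j e = Σ<-cong j (λ k _ → e k (N ∸ suc k))

  δ-cong : ∀ {g h} a b → (∀ a b → g a b ≡ h a b) → δ g a b ≡ δ h a b
  δ-cong a b e = cong₂ _-_ (∫-cong (a ℕ.+ b) a e) (∫-cong (a ℕ.+ b) b e)

  δ-- : ∀ g h a b → δ (λ x y → g x y - h x y) a b ≡ δ g a b - δ h a b
  δ-- g h a b = trans (cong₂ _-_ (Σ<-- a (λ t → g t (a ℕ.+ b ∸ suc t)) (λ t → h t (a ℕ.+ b ∸ suc t)))
                                (Σ<-- b (λ t → g t (a ℕ.+ b ∸ suc t)) (λ t → h t (a ℕ.+ b ∸ suc t))))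
                     (lem (∫ g (a ℕ.+ b) a) (∫ h (a ℕ.+ b) a) (∫ g (a ℕ.+ b) b) (∫ h (a ℕ.+ b) b))
    where lem : ∀ p q r s → (p - q) - (r - s) ≡ (p - r) - (q - s)
          lem = solve-∀

  -- Transpose of multiplication by x - y, the denominator of the divided difference in two
  -- variables.
  diff : (ℕ → ℕ → ℤ) → ℕ → ℕ → ℤ
  diff ψ a b = ψ (suc a) b - ψ a (suc b)

  ∫-diff : ∀ ψ N a → a ℕ.≤ N → ∫ (diff ψ) N a ≡ ψ a (N ∸ a) - ψ 0 N
  ∫-diff ψ N zero a≤N = sym (ℤₚ.+-inverseʳ (ψ 0 N))
  ∫-diff ψ N (suc a) a<N = begin
    ∫ (diff ψ) N a + (ψ (suc a) (N ∸ suc a) - ψ a (suc (N ∸ suc a)))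
      ≡⟨ cong₂ (λ x y → x + (ψ (suc a) (N ∸ suc a) - ψ a y)) (∫-diff ψ N a (<⇒≤ a<N)) (sym (+-∸-assoc 1 a<N)) ⟩
    (ψ a (N ∸ a) - ψ 0 N) + (ψ (suc a) (N ∸ suc a) - ψ a (N ∸ a))
      ≡⟨ lem (ψ a (N ∸ a)) (ψ 0 N) (ψ (suc a) (N ∸ suc a)) ⟩
    ψ (suc a) (N ∸ suc a) - ψ 0 N ∎
    where lem : ∀ x y z → (x - y) + (z - x) ≡ z - y
          lem = solve-∀

  -- Transposed form of (x - y) · ∂f = f - s f; both antiderivatives telescope along the
  -- antidiagonal of constant a + b.
  δ-diff : ∀ ψ a b → δ (diff ψ) a b ≡ ψ a b - ψ b a
  δ-diff ψ a b = begin
    ∫ (diff ψ) (a ℕ.+ b) a - ∫ (diff ψ) (a ℕ.+ b) b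
      ≡⟨ cong₂ _-_ (∫-diff ψ (a ℕ.+ b) a (m≤m+n a b)) (∫-diff ψ (a ℕ.+ b) b (m≤n+m b a)) ⟩
    (ψ a (a ℕ.+ b ∸ a) - ψ 0 (a ℕ.+ b)) - (ψ b (a ℕ.+ b ∸ b) - ψ 0 (a ℕ.+ b))
      ≡⟨ cong₂ (λ x y → (ψ a x - ψ 0 (a ℕ.+ b)) - (ψ b y - ψ 0 (a ℕ.+ b))) (m+n∸m≡n a b) (m+n∸n≡m a b) ⟩
    (ψ a b - ψ 0 (a ℕ.+ b)) - (ψ b a - ψ 0 (a ℕ.+ b))
      ≡⟨ lem (ψ a b) (ψ 0 (a ℕ.+ b)) (ψ b a) ⟩
    ψ a b - ψ b a ∎
    where lem : ∀ x y z → (x - y) - (z - y) ≡ x - z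
          lem = solve-∀

  -- Transposed form of the symmetry of ∂f. Writing g as the difference of its primitive reduces
  -- both sides to `δ-diff`.
  δ-flip : ∀ g a b → δ (λ x y → g y x) a b ≡ δ g a b
  δ-flip g a b = begin
    δ (λ x y → g y x) a b
      ≡⟨ δ-cong a b (λ x y → trans (sym (prim-diff g y x)) (neg (prim g (suc y) x) (prim g y (suc x)))) ⟩
    δ (diff (λ x y → - prim g y x)) a b
      ≡⟨ δ-diff (λ x y → - prim g y x) a b ⟩
    - prim g b a - - prim g a b
      ≡⟨ lem (prim g b a) (prim g a b) ⟩
    prim g a b - prim g b a
      ≡⟨ sym (δ-diff (prim g) a b) ⟩
    δ (diff (prim g)) a b
      ≡⟨ δ-cong a b (prim-diff g) ⟩
    δ g a b ∎
    where lem : ∀ x y → - x - - y ≡ y - x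
          lem = solve-∀
          neg : ∀ x y → x - y ≡ - y - - x
          neg = solve-∀

  δ-antisym : ∀ g a b → δ g a b ≡ - δ g b a
  δ-antisym g a b rewrite +-comm a b = lem (∫ g (b ℕ.+ a) a) (∫ g (b ℕ.+ a) b)
    where lem : ∀ x y → x - y ≡ - (y - x)
          lem = solve-∀

  -- The common initial part of the two antiderivatives cancels and leaves the sum in the `no`
  -- branch of `ddMono`.
  δ-≤ : ∀ g a b → a ℕ.≤ b → δ g a b ≡ - Σ< (b ∸ a) (λ k → g (a ℕ.+ k) (b ∸ 1 ∸ k))
  δ-≤ g a b a≤b with b ∸ a | m+[n∸m]≡n a≤b
  ... | d | refl = begin
    ∫ g N a - Σ< (a ℕ.+ d) F ≡⟨ cong (λ x → ∫ g N a - x) (Σ<-split a d F) ⟩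
    ∫ g N a - (∫ g N a + Σ< d (λ k → F (a ℕ.+ k))) ≡⟨ lem (∫ g N a) _ ⟩
    - Σ< d (λ k → F (a ℕ.+ k)) ≡⟨ cong -_ (Σ<-cong d (λ k _ → cong (g (a ℕ.+ k)) (idx k))) ⟩
    - Σ< d (λ k → g (a ℕ.+ k) (a ℕ.+ d ∸ 1 ∸ k)) ∎
    where
    N = a ℕ.+ (a ℕ.+ d)
    F : ℕ → ℤ
    F t = g t (N ∸ suc t)
    idx : ∀ k → N ∸ suc (a ℕ.+ k) ≡ a ℕ.+ d ∸ 1 ∸ k
    idx k = trans (cong (N ∸_) (sym (+-suc a k)))
      (trans ([m+n]∸[m+o]≡n∸o a (a ℕ.+ d) (suc k)) (sym (∸-+-assoc (a ℕ.+ d) 1 k)))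
    lem : ∀ x y → x - (x + y) ≡ - y
    lem = solve-∀

  -- Obtained from `δ-≤` by exchanging the variables, which yields the summation order of the `yes`
  -- branch of `ddMono`.
  δ-> : ∀ g a b → b ℕ.≤ a → δ g a b ≡ Σ< (a ∸ b) (λ k → g (a ∸ 1 ∸ k) (b ℕ.+ k))
  δ-> g a b b≤a = begin
    δ g a b ≡⟨ sym (δ-flip g a b) ⟩
    δ (λ x y → g y x) a b ≡⟨ δ-antisym (λ x y → g y x) a b ⟩
    - δ (λ x y → g y x) b a ≡⟨ cong -_ (δ-≤ (λ x y → g y x) b a b≤a) ⟩
    - - Σ< (a ∸ b) (λ k → g (a ∸ 1 ∸ k) (b ℕ.+ k)) ≡⟨ ℤₚ.neg-involutive _ ⟩
    Σ< (a ∸ b) (λ k → g (a ∸ 1 ∸ k) (b ℕ.+ k)) ∎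

  Functional : ℕ → Set
  Functional n = Monomial n → ℤ

  ⟪_⟫ : ∀ {n} → Poly n → Functional n → ℤ
  ⟪ [] ⟫ φ = 0ℤ
  ⟪ (e , c) ∷ p ⟫ φ = c * φ e + ⟪ p ⟫ φ

  -- Recursion on the position freezes the earlier exponents, so that commutation and braid
  -- relations reduce to the head of the vector; `∂*-lookup` reconciles this with the updates in
  -- `ddMono`.
  ∂* : ∀ {m} → Fin m → Functional (suc m) → Functional (suc m)
  ∂* Fin.zero φ (a ∷ b ∷ v) = δ (λ x y → φ (x ∷ y ∷ v)) a b
  ∂* (Fin.suc i) φ (a ∷ v) = ∂* i (λ v → φ (a ∷ v)) v

  ⟪⟫-cong : ∀ {n} (p : Poly n) {φ ψ} → (∀ e → φ e ≡ ψ e) → ⟪ p ⟫ φ ≡ ⟪ p ⟫ ψ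
  ⟪⟫-cong [] e = refl
  ⟪⟫-cong ((v , c) ∷ p) e = cong₂ (λ x y → c * x + y) (e v) (⟪⟫-cong p e)

  ⟪⟫-++ : ∀ {n} (p q : Poly n) φ → ⟪ p ++ q ⟫ φ ≡ ⟪ p ⟫ φ + ⟪ q ⟫ φ
  ⟪⟫-++ [] q φ = sym (ℤₚ.+-identityˡ _)
  ⟪⟫-++ ((e , c) ∷ p) q φ = trans (cong (_+_ (c * φ e)) (⟪⟫-++ p q φ)) (sym (ℤₚ.+-assoc (c * φ e) _ _))

  evalOne-⟪⟫ : ∀ {n} (p : Poly n) → evalOne p ≡ ⟪ p ⟫ (λ _ → 1ℤ)
  evalOne-⟪⟫ [] = refl
  evalOne-⟪⟫ ((_ , c) ∷ p) = cong₂ _+_ (sym (ℤₚ.*-identityʳ c)) (evalOne-⟪⟫ p)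

  ∂*-- : ∀ {m} (i : Fin m) (φ ψ : Functional (suc m)) → ∀ e → ∂* i (λ e → φ e - ψ e) e ≡ ∂* i φ e - ∂* i ψ e
  ∂*-- Fin.zero φ ψ (a ∷ b ∷ v) = δ-- (λ x y → φ (x ∷ y ∷ v)) (λ x y → ψ (x ∷ y ∷ v)) a b
  ∂*-- (Fin.suc i) φ ψ (a ∷ v) = ∂*-- i _ _ v

  ∂*-0 : ∀ {m} (i : Fin m) e → ∂* i (λ _ → 0ℤ) e ≡ 0ℤ
  ∂*-0 Fin.zero (a ∷ b ∷ v) = cong₂ _-_ (Σ<-0 a) (Σ<-0 b)
  ∂*-0 (Fin.suc i) (a ∷ v) = ∂*-0 i v

  ∂*-+ : ∀ {m} (i : Fin m) (φ ψ : Functional (suc m)) → ∀ e → ∂* i (λ e → φ e + ψ e) e ≡ ∂* i φ e + ∂* i ψ e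
  ∂*-+ Fin.zero φ ψ (a ∷ b ∷ v) = trans (cong₂ _-_ (Σ<-+ a _ _) (Σ<-+ b _ _)) (lem (∫ f (a ℕ.+ b) a) (∫ g (a ℕ.+ b) a) (∫ f (a ℕ.+ b) b) (∫ g (a ℕ.+ b) b))
    where f g : ℕ → ℕ → ℤ
          f x y = φ (x ∷ y ∷ v)
          g x y = ψ (x ∷ y ∷ v)
          lem : ∀ p q r s → (p + q) - (r + s) ≡ (p - r) + (q - s)
          lem = solve-∀
  ∂*-+ (Fin.suc i) φ ψ (a ∷ v) = ∂*-+ i _ _ v

  ∂*-Σ : ∀ {m} (i : Fin m) n (φ : ℕ → Functional (suc m)) e →
         ∂* i (λ e → Σ< n (λ k → φ k e)) e ≡ Σ< n (λ k → ∂* i (φ k) e)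
  ∂*-Σ i zero φ e = ∂*-0 i e
  ∂*-Σ i (suc n) φ e = trans (∂*-+ i (λ e → Σ< n (λ k → φ k e)) (φ n) e) (cong (_+ ∂* i (φ n) e) (∂*-Σ i n φ e))

  ∂*-lookup : ∀ {m} (i : Fin m) φ (e : Monomial (suc m)) →
    ∂* i φ e ≡ δ (λ x y → φ ((e [ inject₁ i ]≔ x) [ Fin.suc i ]≔ y)) (Vec.lookup e (inject₁ i)) (Vec.lookup e (Fin.suc i))
  ∂*-lookup Fin.zero φ (a ∷ b ∷ v) = refl
  ∂*-lookup (Fin.suc i) φ (a ∷ v) = ∂*-lookup i (λ v → φ (a ∷ v)) v

  -- The function h is kept general because unfolding `upTo` composes it with `suc`.
  ⟪⟫-upTo : ∀ {n} (E : ℕ → Monomial n) c φ (h : ℕ → ℕ) d →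
    ⟪ map (λ k → E k , c) (applyUpTo h d) ⟫ φ ≡ c * Σ< d (λ k → φ (E (h k)))
  ⟪⟫-upTo E c φ h zero = sym (ℤₚ.*-zeroʳ c)
  ⟪⟫-upTo E c φ h (suc d) = begin
    c * φ (E (h 0)) + ⟪ map (λ k → E k , c) (applyUpTo (λ x → h (suc x)) d) ⟫ φ
      ≡⟨ cong (_+_ (c * φ (E (h 0)))) (⟪⟫-upTo E c φ (λ x → h (suc x)) d) ⟩
    c * φ (E (h 0)) + c * Σ< d (λ k → φ (E (h (suc k)))) ≡⟨ sym (ℤₚ.*-distribˡ-+ c (φ (E (h 0))) _) ⟩
    c * (φ (E (h 0)) + Σ< d (λ k → φ (E (h (suc k))))) ≡⟨ cong (c *_) (sym (Σ<-head d (λ k → φ (E (h k))))) ⟩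
    c * Σ< (suc d) (λ k → φ (E (h k))) ∎

  ⟪ddMono⟫ : ∀ {m} (i : Fin m) e c φ → ⟪ ddMono i e c ⟫ φ ≡ c * ∂* i φ e
  ⟪ddMono⟫ i e c φ with Vec.lookup e (Fin.suc i) <? Vec.lookup e (inject₁ i)
  ... | yes b<a = trans (⟪⟫-upTo _ c φ (λ x → x) (Vec.lookup e (inject₁ i) ∸ Vec.lookup e (Fin.suc i)))
    (cong (c *_) (trans (sym (δ-> (λ x y → φ ((e [ inject₁ i ]≔ x) [ Fin.suc i ]≔ y)) _ _ (<⇒≤ b<a))) (sym (∂*-lookup i φ e))))
  ... | no b≮a = trans (⟪⟫-upTo _ (- c) φ (λ x → x) (Vec.lookup e (Fin.suc i) ∸ Vec.lookup e (inject₁ i)))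
    (trans (lem c _) (cong (c *_) (trans (sym (δ-≤ (λ x y → φ ((e [ inject₁ i ]≔ x) [ Fin.suc i ]≔ y)) _ _ (≮⇒≥ b≮a))) (sym (∂*-lookup i φ e)))))
    where lem : ∀ x y → - x * y ≡ x * - y
          lem = solve-∀

  ⟪dd⟫ : ∀ {m} (i : Fin m) p φ → ⟪ dd i p ⟫ φ ≡ ⟪ p ⟫ (∂* i φ)
  ⟪dd⟫ i [] φ = refl
  ⟪dd⟫ i ((e , c) ∷ p) φ = trans (⟪⟫-++ (ddMono i e c) (dd i p) φ) (cong₂ _+_ (⟪ddMono⟫ i e c φ) (⟪dd⟫ i p φ))

  -- For i at the head the operator is a finite signed sum over slices of φ, and `∂* j`, which acts
  -- on the remaining exponents only, commutes with it by linearity.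
  ∂*-comm : ∀ {m} (i j : Fin m) → suc (toℕ i) ℕ.< toℕ j → ∀ (φ : Functional (suc m)) e → ∂* i (∂* j φ) e ≡ ∂* j (∂* i φ) e
  ∂*-comm Fin.zero (Fin.suc (Fin.suc j)) _ φ (a ∷ b ∷ v) = sym (trans
    (∂*-- j (λ v → ∫ (λ x y → φ (x ∷ y ∷ v)) (a ℕ.+ b) a) (λ v → ∫ (λ x y → φ (x ∷ y ∷ v)) (a ℕ.+ b) b) v)
    (cong₂ _-_ (∂*-Σ j a _ v) (∂*-Σ j b _ v)))
  ∂*-comm (Fin.suc i) (Fin.suc j) (s≤s lt) φ (a ∷ v) = ∂*-comm i j lt (λ v → φ (a ∷ v)) v
  ∂*-comm Fin.zero Fin.zero ()
  ∂*-comm Fin.zero (Fin.suc Fin.zero) (s≤s ())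

open FormalSums

-- The braid relation for transposed divided differences.

module BraidRelation where
  open import Data.Nat as ℕ using (ℕ; suc)
  open import Data.Integer using (ℤ; +_; _+_; _-_; -_)
  open import Data.Integer.Tactic.RingSolver using (solve-∀)
  open import Data.Fin as Fin using (Fin; inject₁)
  open import Data.Vec using (_∷_)
  open import Relation.Binary.PropositionalEquality
  open ≡-Reasoning

  Ternary : Set
  Ternary = ℕ → ℕ → ℕ → ℤ

  _≗₃_ : Ternary → Ternary → Set
  F ≗₃ G = ∀ a b c → F a b c ≡ G a b c

  δ₁₂ δ₂₃ : Ternary → Ternary
  δ₁₂ G a b c = δ (λ x y → G x y c) a b
  δ₂₃ G a b c = δ (λ y z → G a y z) b c

  δ₁₂-cong : ∀ {F G} → F ≗₃ G → δ₁₂ F ≗₃ δ₁₂ G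
  δ₁₂-cong e a b c = δ-cong a b (λ x y → e x y c)

  δ₂₃-cong : ∀ {F G} → F ≗₃ G → δ₂₃ F ≗₃ δ₂₃ G
  δ₂₃-cong e a b c = δ-cong b c (e a)

  δ₁₂-- : ∀ F G → δ₁₂ (λ a b c → F a b c - G a b c) ≗₃ λ a b c → δ₁₂ F a b c - δ₁₂ G a b c
  δ₁₂-- F G a b c = δ-- (λ x y → F x y c) (λ x y → G x y c) a b

  δ₂₃-- : ∀ F G → δ₂₃ (λ a b c → F a b c - G a b c) ≗₃ λ a b c → δ₂₃ F a b c - δ₂₃ G a b c
  δ₂₃-- F G a b c = δ-- (F a) (G a) b c

  -- Multiplication by the Vandermonde product of three variables, transposed.
  vandermonde : Ternary → Ternary
  vandermonde ψ a b c =
    (ψ (2 ℕ.+ a) (suc b) c - ψ (2 ℕ.+ a) b (suc c) - (ψ (suc a) (suc b) (suc c) - ψ (suc a) b (2 ℕ.+ c)))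
    - (ψ (suc a) (2 ℕ.+ b) c - ψ (suc a) (suc b) (suc c) - (ψ a (2 ℕ.+ b) (suc c) - ψ a (suc b) (2 ℕ.+ c)))

  alternating : Ternary → Ternary
  alternating ψ a b c = ψ a b c - ψ b a c - ψ a c b + ψ b c a + ψ c a b - ψ c b a

  -- Each δ removes one linear factor of the Vandermonde product by `δ-diff`: first x - y, then y -
  -- z. The remaining x - z becomes x - y either by the exchange of y and z just made or through
  -- `δ-flip`.
  δ₁₂δ₂₃δ₁₂ : ∀ ψ → δ₁₂ (δ₂₃ (δ₁₂ (vandermonde ψ))) ≗₃ alternating ψ
  δ₁₂δ₂₃δ₁₂ ψ a b c = begin
    δ₁₂ (δ₂₃ (δ₁₂ (vandermonde ψ))) a b c ≡⟨ δ₁₂-cong (δ₂₃-cong step₁) a b c ⟩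
    δ₁₂ (δ₂₃ X) a b c ≡⟨ δ₁₂-cong step₂ a b c ⟩
    δ₁₂ Z a b c ≡⟨ δ₁₂-- (λ a b c → P a b c - V b a c) Y a b c ⟩
    δ₁₂ (λ a b c → P a b c - V b a c) a b c - δ₁₂ Y a b c
      -- By `δ-flip` the exchanged V may be replaced by V itself, and P - V is again a difference in
      -- the first two arguments.
      ≡⟨ cong₂ _-_ (trans (δ₁₂-- P (λ a b c → V b a c) a b c) (cong (λ x → δ₁₂ P a b c - x) (δ-flip (λ x y → V x y c) a b))) (δ-diff (λ x y → χ x c y) a b) ⟩
    (δ₁₂ P a b c - δ₁₂ V a b c) - (χ a c b - χ b c a)
      ≡⟨ cong (_- (χ a c b - χ b c a)) (trans (sym (δ₁₂-- P V a b c)) (trans (δ-cong a b (λ x y → l₃ (ψ (suc x) y c) (ψ x y (suc c)) (ψ x (suc y) c))) (δ-diff (λ x y → ψ x y c) a b))) ⟩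
    (ψ a b c - ψ b a c) - (χ a c b - χ b c a)
      ≡⟨ l₄ (ψ a b c) (ψ b a c) (ψ a c b) (ψ c a b) (ψ b c a) (ψ c b a) ⟩
    alternating ψ a b c ∎
    where
    χ X Y P V Z : Ternary
    χ a b c = ψ a b c - ψ b a c
    X a b c = (χ (suc a) (suc b) c - χ a (suc b) (suc c)) - (χ (suc a) b (suc c) - χ a b (2 ℕ.+ c))
    P a b c = ψ (suc a) b c - ψ a b (suc c)
    V a b c = ψ a (suc b) c - ψ a b (suc c)
    Y a b c = χ (suc a) c b - χ a c (suc b)
    Z a b c = (P a b c - V b a c) - Y a b c
    l₁ : ∀ p q r s p' q' r' s' → (p - q - (r - s)) - (p' - q' - (r' - s')) ≡ ((p - p') - (r - q')) - ((q - r') - (s - s'))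
    l₁ = solve-∀
    step₁ : δ₁₂ (vandermonde ψ) ≗₃ X
    step₁ a b c = trans (δ-diff (λ x y → ψ (suc x) (suc y) c - ψ (suc x) y (suc c) - (ψ x (suc y) (suc c) - ψ x y (2 ℕ.+ c))) a b)
      (l₁ (ψ (suc a) (suc b) c) (ψ (suc a) b (suc c)) (ψ a (suc b) (suc c)) (ψ a b (2 ℕ.+ c))
          (ψ (suc b) (suc a) c) (ψ (suc b) a (suc c)) (ψ b (suc a) (suc c)) (ψ b a (2 ℕ.+ c)))
    l₂ : ∀ p q r s t u v w → ((p - q) - (r - s)) - ((t - u) - (v - w)) ≡ ((p - r) - (q - s)) - ((t - u) - (v - w))
    l₂ = solve-∀
    step₂ : δ₂₃ X ≗₃ Z
    step₂ a b c = trans (δ-diff (λ y z → χ (suc a) y z - χ a y (suc z)) b c)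
      (l₂ (ψ (suc a) b c) (ψ b (suc a) c) (ψ a b (suc c)) (ψ b a (suc c))
          (ψ (suc a) c b) (ψ c (suc a) b) (ψ a c (suc b)) (ψ c a (suc b)))
    l₃ : ∀ x y z → (x - y) - (z - y) ≡ x - z
    l₃ = solve-∀
    l₄ : ∀ p q r s t u → (p - q) - ((r - s) - (t - u)) ≡ p - q - r + t + s - u
    l₄ = solve-∀

  δ₂₃δ₁₂δ₂₃ : ∀ ψ → δ₂₃ (δ₁₂ (δ₂₃ (vandermonde ψ))) ≗₃ alternating ψ
  δ₂₃δ₁₂δ₂₃ ψ a b c = begin
    δ₂₃ (δ₁₂ (δ₂₃ (vandermonde ψ))) a b c ≡⟨ δ₂₃-cong (δ₁₂-cong step₁) a b c ⟩
    δ₂₃ (δ₁₂ X) a b c ≡⟨ δ₂₃-cong step₂ a b c ⟩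
    δ₂₃ Z a b c ≡⟨ δ₂₃-- (λ a b c → P a b c - V a c b) Y a b c ⟩
    δ₂₃ (λ a b c → P a b c - V a c b) a b c - δ₂₃ Y a b c
      ≡⟨ cong₂ _-_ (trans (δ₂₃-- P (λ a b c → V a c b) a b c) (cong (λ x → δ₂₃ P a b c - x) (δ-flip (λ y z → V a y z) b c))) (δ-diff (λ y z → χ y a z) b c) ⟩
    (δ₂₃ P a b c - δ₂₃ V a b c) - (χ b a c - χ c a b)
      ≡⟨ cong (_- (χ b a c - χ c a b)) (trans (sym (δ₂₃-- P V a b c)) (trans (δ-cong b c (λ y z → l₃ (ψ (suc a) y z) (ψ a y (suc z)) (ψ a (suc y) z))) (δ-diff (λ y z → ψ a y z) b c))) ⟩
    (ψ a b c - ψ a c b) - (χ b a c - χ c a b)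
      ≡⟨ l₄ (ψ a b c) (ψ a c b) (ψ b a c) (ψ b c a) (ψ c a b) (ψ c b a) ⟩
    alternating ψ a b c ∎
    where
    χ X Y P V Z : Ternary
    χ a b c = ψ a b c - ψ a c b
    X a b c = (χ (2 ℕ.+ a) b c - χ (suc a) b (suc c)) - (χ (suc a) (suc b) c - χ a (suc b) (suc c))
    P a b c = ψ (suc a) b c - ψ a b (suc c)
    V a b c = ψ (suc a) b c - ψ a (suc b) c
    Y a b c = χ (suc b) a c - χ b a (suc c)
    Z a b c = (P a b c - V a c b) - Y a b c
    rearrange : ∀ a b c d e g h → (a - b - (c - d)) - (e - c - (g - h)) ≡ (a - c - (e - g)) - (b - d - (c - h))
    rearrange = solve-∀
    l₁ : ∀ p q r s p' q' r' s' → (p - q - (r - s)) - (p' - q' - (r' - s')) ≡ ((p - p') - (q - r')) - ((r - q') - (s - s'))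
    l₁ = solve-∀
    step₁ : δ₂₃ (vandermonde ψ) ≗₃ X
    -- `vandermonde` is regrouped so that y - z becomes the outermost factor.
    step₁ a b c = trans (δ-cong b c (λ b c → rearrange (ψ (2 ℕ.+ a) (suc b) c) (ψ (2 ℕ.+ a) b (suc c)) (ψ (suc a) (suc b) (suc c)) (ψ (suc a) b (2 ℕ.+ c)) (ψ (suc a) (2 ℕ.+ b) c) (ψ a (2 ℕ.+ b) (suc c)) (ψ a (suc b) (2 ℕ.+ c))))
      (trans (δ-diff (λ y z → ψ (2 ℕ.+ a) y z - ψ (suc a) y (suc z) - (ψ (suc a) (suc y) z - ψ a (suc y) (suc z))) b c)
      (l₁ (ψ (2 ℕ.+ a) b c) (ψ (suc a) b (suc c)) (ψ (suc a) (suc b) c) (ψ a (suc b) (suc c))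
          (ψ (2 ℕ.+ a) c b) (ψ (suc a) c (suc b)) (ψ (suc a) (suc c) b) (ψ a (suc c) (suc b))))
    l₂ : ∀ p q r s t u v w → ((p - q) - (r - s)) - ((t - u) - (v - w)) ≡ ((p - r) - (q - s)) - ((t - u) - (v - w))
    l₂ = solve-∀
    step₂ : δ₁₂ X ≗₃ Z
    step₂ a b c = trans (δ-diff (λ x y → χ (suc x) y c - χ x y (suc c)) a b)
      (l₂ (ψ (suc a) b c) (ψ (suc a) c b) (ψ a b (suc c)) (ψ a (suc c) b)
          (ψ (suc b) a c) (ψ (suc b) c a) (ψ b a (suc c)) (ψ b (suc c) a))
    l₃ : ∀ x y z → (x - y) - (x - z) ≡ z - y
    l₃ = solve-∀
    l₄ : ∀ p q r s t u → (p - q) - ((r - s) - (t - u)) ≡ p - r - q + s + t - u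
    l₄ = solve-∀

  -- One discrete antiderivative for each of the factors x - y, x - z and y - z, in this order.
  vandermonde⁻¹ : Ternary → Ternary
  vandermonde⁻¹ G a b c = prim (B a) b c
    where
    A B : Ternary
    A a b c = prim (λ x y → G x y c) a b
    B a b c = prim (λ x z → A x b z) a c

  vandermonde-surjective : ∀ G → vandermonde (vandermonde⁻¹ G) ≗₃ G
  vandermonde-surjective G a b c = trans (cong₂ _-_ (inner (suc a) b c) (inner a (suc b) c)) (prim-diff (λ x y → G x y c) a b)
    where
    A B : Ternary
    A a b c = prim (λ x y → G x y c) a b
    B a b c = prim (λ x z → A x b z) a c
    ψ = vandermonde⁻¹ G
    inner : ∀ a b c → (ψ (suc a) (suc b) c - ψ (suc a) b (suc c)) - (ψ a (suc b) (suc c) - ψ a b (2 ℕ.+ c)) ≡ A a b c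
    inner a b c = trans (cong₂ _-_ (prim-diff (B (suc a)) b c) (prim-diff (B a) b (suc c))) (prim-diff (λ x z → A x b z) a c)

  δ-braid : ∀ G → δ₁₂ (δ₂₃ (δ₁₂ G)) ≗₃ δ₂₃ (δ₁₂ (δ₂₃ G))
  δ-braid G a b c = begin
    δ₁₂ (δ₂₃ (δ₁₂ G)) a b c ≡⟨ δ₁₂-cong (δ₂₃-cong (δ₁₂-cong G≗)) a b c ⟩
    δ₁₂ (δ₂₃ (δ₁₂ (vandermonde ψ))) a b c ≡⟨ δ₁₂δ₂₃δ₁₂ ψ a b c ⟩
    alternating ψ a b c ≡⟨ sym (δ₂₃δ₁₂δ₂₃ ψ a b c) ⟩
    δ₂₃ (δ₁₂ (δ₂₃ (vandermonde ψ))) a b c ≡⟨ sym (δ₂₃-cong (δ₁₂-cong (δ₂₃-cong G≗)) a b c) ⟩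
    δ₂₃ (δ₁₂ (δ₂₃ G)) a b c ∎
    where
    ψ = vandermonde⁻¹ G
    G≗ : G ≗₃ vandermonde ψ
    G≗ a b c = sym (vandermonde-surjective G a b c)

  ∂*-braid : ∀ {m} (i : Fin m) (φ : Functional (2 ℕ.+ m)) e →
    ∂* (inject₁ i) (∂* (Fin.suc i) (∂* (inject₁ i) φ)) e ≡ ∂* (Fin.suc i) (∂* (inject₁ i) (∂* (Fin.suc i) φ)) e
  ∂*-braid Fin.zero φ (a ∷ b ∷ c ∷ v) = δ-braid (λ x y z → φ (x ∷ y ∷ z ∷ v)) a b c
  ∂*-braid (Fin.suc i) φ (a ∷ v) = ∂*-braid i (λ v → φ (a ∷ v)) v

open BraidRelation

-- Counting, inversions, Lehmer codes and simple transpositions.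

module Codes where
  open import Data.Nat as ℕ using (ℕ; zero; suc; _+_; _≤_; _<_; s≤s; z≤n)
  open import Data.Fin as Fin using (Fin; toℕ; inject₁)
  import Data.Fin.Properties as Finₚ
  open import Data.Product using (∃-syntax; _×_; _,_)
  open import Data.Sum using (_⊎_; inj₁; inj₂)
  open import Data.Empty using (⊥-elim)
  open import Data.Unit using (tt)
  open import Function using (_∘_)
  open import Relation.Nullary using (¬_; Dec; yes; no)
  open import Relation.Nullary.Decidable using (_×-dec_; ¬?; _⊎-dec_)
  open import Relation.Binary.PropositionalEquality hiding (J)
  open import Data.Nat.Properties using (*-identityʳ; +-assoc; +-comm; +-mono-≤; +-suc; <-asym; <-irrefl; <-trans; <-≤-trans; <⇒≱; ≤-antisym; ≤-refl; ≤-reflexive; ≤∧≢⇒<)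

  sumF : ∀ {n} → (Fin n → ℕ) → ℕ
  sumF {zero} g = 0
  sumF {suc n} g = g Fin.zero + sumF (g ∘ Fin.suc)

  sumF-cong : ∀ {n} {g h : Fin n → ℕ} → (∀ k → g k ≡ h k) → sumF g ≡ sumF h
  sumF-cong {zero} e = refl
  sumF-cong {suc n} e = cong₂ _+_ (e Fin.zero) (sumF-cong (e ∘ Fin.suc))

  sumF-mono : ∀ {n} {g h : Fin n → ℕ} → (∀ k → g k ≤ h k) → sumF g ≤ sumF h
  sumF-mono {zero} e = z≤n
  sumF-mono {suc n} e = +-mono-≤ (e Fin.zero) (sumF-mono (e ∘ Fin.suc))

  sumF-const : ∀ n x → sumF {n} (λ _ → x) ≡ n ℕ.* x
  sumF-const zero x = refl
  sumF-const (suc n) x = cong (x +_) (sumF-const n x)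

  sumF-bump : ∀ {n} (g h : Fin n → ℕ) d → (∀ k → k ≢ d → h k ≡ g k) → h d ≡ suc (g d) → sumF h ≡ suc (sumF g)
  sumF-bump g h Fin.zero e e₀ = cong₂ _+_ e₀ (sumF-cong (λ k → e (Fin.suc k) λ ()))
  sumF-bump g h (Fin.suc d) e e₀ = trans
    (cong₂ _+_ (e Fin.zero λ ()) (sumF-bump (g ∘ Fin.suc) (h ∘ Fin.suc) d (λ k k≢d → e (Fin.suc k) (k≢d ∘ Finₚ.suc-injective)) e₀))
    (+-suc _ _)

  simple-suc : ∀ {m} (i : Fin m) x → simple (Fin.suc i) (Fin.suc x) ≡ Fin.suc (simple i x)
  simple-suc i x with x Fin.≟ inject₁ i | x Fin.≟ Fin.suc i
  ... | yes _ | _ = refl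
  ... | no _ | yes _ = refl
  ... | no _ | no _ = refl

  simple-inject₁ : ∀ {m} (i : Fin m) → simple i (inject₁ i) ≡ Fin.suc i
  simple-inject₁ Fin.zero = refl
  simple-inject₁ (Fin.suc i) = trans (simple-suc i (inject₁ i)) (cong Fin.suc (simple-inject₁ i))

  simple-fsuc : ∀ {m} (i : Fin m) → simple i (Fin.suc i) ≡ inject₁ i
  simple-fsuc Fin.zero = refl
  simple-fsuc (Fin.suc i) = trans (simple-suc i (Fin.suc i)) (cong Fin.suc (simple-fsuc i))

  simple-other : ∀ {m} (i : Fin m) x → x ≢ inject₁ i → x ≢ Fin.suc i → simple i x ≡ x
  simple-other i x p q with x Fin.≟ inject₁ i | x Fin.≟ Fin.suc i
  ... | yes e | _ = ⊥-elim (p e)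
  ... | no _ | yes e = ⊥-elim (q e)
  ... | no _ | no _ = refl

  data Cases {m} (i : Fin m) : Fin (suc m) → Set where
    is-left : Cases i (inject₁ i)
    is-right : Cases i (Fin.suc i)
    is-other : ∀ {x} → x ≢ inject₁ i → x ≢ Fin.suc i → simple i x ≡ x → Cases i x

  cases : ∀ {m} (i : Fin m) x → Cases i x
  cases i x with x Fin.≟ inject₁ i | x Fin.≟ Fin.suc i
  ... | yes refl | _ = is-left
  ... | no _ | yes refl = is-right
  ... | no p | no q = is-other p q (simple-other i x p q)

  simple-involutive : ∀ {m} (i : Fin m) x → simple i (simple i x) ≡ x
  simple-involutive i x with cases i x
  ... | is-left = trans (cong (simple i) (simple-inject₁ i)) (simple-fsuc i)
  ... | is-right = trans (cong (simple i) (simple-fsuc i)) (simple-inject₁ i)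
  ... | is-other _ _ e = trans (cong (simple i) e) e

  simple-injective : ∀ {m} (i : Fin m) {x y} → simple i x ≡ simple i y → x ≡ y
  simple-injective i {x} {y} e = trans (sym (simple-involutive i x)) (trans (cong (simple i) e) (simple-involutive i y))

  simple-mono : ∀ {m} (i : Fin m) x y → x Fin.< y → (x ≡ inject₁ i × y ≡ Fin.suc i) ⊎ (simple i x Fin.< simple i y)
  simple-mono Fin.zero Fin.zero (Fin.suc Fin.zero) lt = inj₁ (refl , refl)
  simple-mono Fin.zero Fin.zero (Fin.suc (Fin.suc y)) lt = inj₂ (s≤s (s≤s z≤n))
  simple-mono Fin.zero (Fin.suc Fin.zero) (Fin.suc Fin.zero) (s≤s ())
  simple-mono Fin.zero (Fin.suc Fin.zero) (Fin.suc (Fin.suc y)) lt = inj₂ (s≤s z≤n)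
  simple-mono Fin.zero (Fin.suc (Fin.suc x)) (Fin.suc Fin.zero) (s≤s ())
  simple-mono Fin.zero (Fin.suc (Fin.suc x)) (Fin.suc (Fin.suc y)) lt = inj₂ lt
  simple-mono (Fin.suc i) Fin.zero (Fin.suc y) lt rewrite simple-suc i y = inj₂ (s≤s z≤n)
  simple-mono (Fin.suc i) (Fin.suc x) (Fin.suc y) (s≤s lt) with simple-mono i x y lt
  ... | inj₁ (e , e') = inj₁ (cong Fin.suc e , cong Fin.suc e')
  ... | inj₂ lt' rewrite simple-suc i x | simple-suc i y = inj₂ (s≤s lt')

  simple-comm : ∀ {m} (i j : Fin m) → suc (toℕ i) < toℕ j → ∀ x → simple i (simple j x) ≡ simple j (simple i x)
  simple-comm Fin.zero Fin.zero ()
  simple-comm Fin.zero (Fin.suc Fin.zero) (s≤s ())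
  simple-comm Fin.zero (Fin.suc (Fin.suc j)) lt Fin.zero = sym (trans (simple-suc (Fin.suc j) Fin.zero) refl)
  simple-comm Fin.zero (Fin.suc (Fin.suc j)) lt (Fin.suc Fin.zero) = cong (simple Fin.zero) (simple-suc (Fin.suc j) Fin.zero)
  simple-comm Fin.zero (Fin.suc (Fin.suc j)) lt (Fin.suc (Fin.suc x))
    rewrite simple-suc (Fin.suc j) (Fin.suc x) | simple-suc j x = refl
  simple-comm (Fin.suc i) (Fin.suc j) (s≤s lt) Fin.zero = refl
  simple-comm (Fin.suc i) (Fin.suc j) (s≤s lt) (Fin.suc x)
    rewrite simple-suc j x | simple-suc i x | simple-suc i (simple j x) | simple-suc j (simple i x) = cong Fin.suc (simple-comm i j lt x)

  simple-braid : ∀ {m} (i : Fin m) x →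
    simple (inject₁ i) (simple (Fin.suc i) (simple (inject₁ i) x)) ≡ simple (Fin.suc i) (simple (inject₁ i) (simple (Fin.suc i) x))
  simple-braid Fin.zero Fin.zero = refl
  simple-braid Fin.zero (Fin.suc Fin.zero) = refl
  simple-braid Fin.zero (Fin.suc (Fin.suc Fin.zero)) = refl
  simple-braid Fin.zero (Fin.suc (Fin.suc (Fin.suc x))) = refl
  simple-braid (Fin.suc i) Fin.zero = refl
  simple-braid (Fin.suc i) (Fin.suc x)
    rewrite simple-suc (inject₁ i) x | simple-suc (Fin.suc i) (simple (inject₁ i) x)
          | simple-suc (inject₁ i) (simple (Fin.suc i) (simple (inject₁ i) x))
          | simple-suc (Fin.suc i) x | simple-suc (inject₁ i) (simple (Fin.suc i) x)
          | simple-suc (Fin.suc i) (simple (inject₁ i) (simple (Fin.suc i) x)) = cong Fin.suc (simple-braid i x)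

  sumF-simple : ∀ {m} (i : Fin m) (g : Fin (suc m) → ℕ) → sumF (g ∘ simple i) ≡ sumF g
  sumF-simple Fin.zero g = trans (sym (+-assoc (g (Fin.suc Fin.zero)) (g Fin.zero) _))
    (trans (cong (_+ sumF (λ k → g (Fin.suc (Fin.suc k)))) (+-comm (g (Fin.suc Fin.zero)) (g Fin.zero))) (+-assoc (g Fin.zero) _ _))
  sumF-simple (Fin.suc i) g = cong (g Fin.zero +_)
    (trans (sumF-cong (λ x → cong g (simple-suc i x))) (sumF-simple i (g ∘ Fin.suc)))

  private variable
    n : ℕ
    P Q : Fin n → Set

  ind : ∀ {A : Set} → Dec A → ℕ
  ind (yes _) = 1
  ind (no _) = 0

  ind-mono : ∀ {A B : Set} (a? : Dec A) (b? : Dec B) → (A → B) → ind a? ≤ ind b?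
  ind-mono (yes a) (yes b) f = ≤-refl
  ind-mono (yes a) (no ¬b) f = ⊥-elim (¬b (f a))
  ind-mono (no _) _ f = z≤n

  ind-cong : ∀ {A B : Set} (a? : Dec A) (b? : Dec B) → (A → B) → (B → A) → ind a? ≡ ind b?
  ind-cong a? b? f g = ≤-antisym (ind-mono a? b? f) (ind-mono b? a? g)

  cnt : (∀ k → Dec (P k)) → ℕ
  cnt P? = sumF (ind ∘ P?)

  cnt-mono : (P? : ∀ k → Dec (P k)) (Q? : ∀ k → Dec (Q k)) → (∀ k → P k → Q k) → cnt P? ≤ cnt Q?
  cnt-mono P? Q? f = sumF-mono (λ k → ind-mono (P? k) (Q? k) (f k))

  cnt-cong : (P? : ∀ k → Dec (P k)) (Q? : ∀ k → Dec (Q k)) → (∀ k → P k → Q k) → (∀ k → Q k → P k) → cnt P? ≡ cnt Q?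
  cnt-cong P? Q? f g = ≤-antisym (cnt-mono P? Q? f) (cnt-mono Q? P? g)

  cnt-insert : (P? : ∀ k → Dec (P k)) (Q? : ∀ k → Dec (Q k)) (d : Fin n) → ¬ P d → Q d →
    (∀ k → P k → Q k) → (∀ k → Q k → k ≡ d ⊎ P k) → cnt Q? ≡ suc (cnt P?)
  cnt-insert P? Q? d ¬Pd Qd f g = sumF-bump (ind ∘ P?) (ind ∘ Q?) d
    (λ k k≢d → ind-cong (Q? k) (P? k) (λ q → [_,_]-elim k≢d (g k q)) (f k)) (at-d (P? d) (Q? d))
    where
    [_,_]-elim : ∀ {k} → k ≢ d → k ≡ d ⊎ _ → _
    [_,_]-elim k≢d (inj₁ e) = ⊥-elim (k≢d e)
    [_,_]-elim k≢d (inj₂ p) = p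
    at-d : ∀ p? q? → ind q? ≡ suc (ind p?)
    at-d (yes p) _ = ⊥-elim (¬Pd p)
    at-d (no _) (yes _) = refl
    at-d (no _) (no ¬q) = ⊥-elim (¬q Qd)

  cnt-strict : (P? : ∀ k → Dec (P k)) (Q? : ∀ k → Dec (Q k)) (d : Fin n) → (∀ k → P k → Q k) → ¬ P d → Q d → cnt P? < cnt Q?
  cnt-strict {P = P} P? Q? d f ¬Pd Qd = subst (_≤ cnt Q?) (cnt-insert P? P⁺? d ¬Pd (inj₁ refl) (λ _ → inj₂) (λ _ x → x))
    (cnt-mono P⁺? Q? λ { k (inj₁ refl) → Qd ; k (inj₂ p) → f k p })
    where
    P⁺? : ∀ k → Dec (k ≡ d ⊎ P k)
    P⁺? k = (k Fin.≟ d) ⊎-dec P? k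

  -- Otherwise Q would be contained in P and omit d, hence be strictly smaller. With codes as
  -- counts, an inversion lost on one side must be compensated on the other.
  cnt-missing : (P? : ∀ k → Dec (P k)) (Q? : ∀ k → Dec (Q k)) (d : Fin n) → cnt P? ≤ cnt Q? → P d → ¬ Q d → ∃[ k ] (Q k × ¬ P k)
  cnt-missing P? Q? d le Pd ¬Qd with Finₚ.any? (λ k → Q? k ×-dec ¬? (P? k))
  ... | yes r = r
  ... | no none = ⊥-elim (<⇒≱ (cnt-strict Q? P? d Q⊆P ¬Qd Pd) le)
    where
    Q⊆P : ∀ k → _
    Q⊆P k q with P? k
    ... | yes p = p
    ... | no ¬p = ⊥-elim (none (k , q , ¬p))

  cnt-surplus : (P? : ∀ k → Dec (P k)) (Q? : ∀ k → Dec (Q k)) → cnt P? < cnt Q? → ∃[ k ] (Q k × ¬ P k)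
  cnt-surplus P? Q? lt with Finₚ.any? (λ k → Q? k ×-dec ¬? (P? k))
  ... | yes r = r
  ... | no none = ⊥-elim (<⇒≱ lt (cnt-mono Q? P? Q⊆P))
    where
    Q⊆P : ∀ k → _
    Q⊆P k q with P? k
    ... | yes p = p
    ... | no ¬p = ⊥-elim (none (k , q , ¬p))

  cnt-simple : ∀ {m} {P : Fin (suc m) → Set} (i : Fin m) (P? : ∀ k → Dec (P k)) → cnt (P? ∘ simple i) ≡ cnt P?
  cnt-simple i P? = sumF-simple i (ind ∘ P?)

  cnt-all : ∀ n → sumF {n} (λ _ → 1) ≡ n
  cnt-all n = trans (sumF-const n 1) (*-identityʳ n)

  ind≤1 : ∀ {A : Set} (a? : Dec A) → ind a? ≤ 1
  ind≤1 (yes _) = ≤-refl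
  ind≤1 (no _) = z≤n

  cnt≤n : (P? : ∀ (k : Fin n) → Dec (P k)) → cnt P? ≤ n
  cnt≤n {n = n} P? = subst (cnt P? ≤_) (cnt-all n) (sumF-mono (λ k → ind≤1 (P? k)))

  cnt<n : (P? : ∀ (k : Fin n) → Dec (P k)) (d : Fin n) → ¬ P d → cnt P? < n
  cnt<n {n = n} {P = P} P? d ¬Pd = <-≤-trans (cnt-strict P? (λ k → yes refl) d (λ _ _ → refl {x = tt}) ¬Pd refl) (cnt≤n (λ k → yes (refl {x = tt})))

  Inv : (Fin n → ℕ) → Fin n → Fin n → Set
  Inv f j k = j Fin.< k × f k < f j

  Inv? : (f : Fin n → ℕ) (j k : Fin n) → Dec (Inv f j k)
  Inv? f j k = (j Fin.<? k) ×-dec (f k ℕ.<? f j)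

  -- The Lehmer code; its entry at j is the length of row j of the Rothe diagram.
  code : (Fin n → ℕ) → Fin n → ℕ
  code f j = cnt (Inv? f j)

  code< : (f : Fin n → ℕ) (j : Fin n) → code f j < n
  code< f j = cnt<n (Inv? f j) j (λ { (lt , _) → <-irrefl refl lt })

  code-cong : {f g : Fin n → ℕ} → (∀ k → f k ≡ g k) → ∀ j → code f j ≡ code g j
  code-cong {f = f} {g} e j = cnt-cong (Inv? f j) (Inv? g j)
    (λ k (lt , v) → lt , subst₂ _<_ (e k) (e j) v) (λ k (lt , v) → lt , subst₂ _<_ (sym (e k)) (sym (e j)) v)

  module Swap {m} (f : Fin (suc m) → ℕ) (i : Fin m) (asc : f (inject₁ i) < f (Fin.suc i)) where
    I J : Fin (suc m)
    I = inject₁ i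
    J = Fin.suc i

    u : Fin (suc m) → ℕ
    u = f ∘ simple i

    I<J : I Fin.< J
    I<J = s≤s (≤-reflexive (Finₚ.toℕ-inject₁ i))

    beyond : ∀ {k} → I Fin.< k → k ≢ J → J Fin.< k
    beyond {k} lt ne = ≤∧≢⇒< (subst (λ x → suc x ≤ toℕ k) (Finₚ.toℕ-inject₁ i) lt) (λ e → ne (sym (Finₚ.toℕ-injective e)))

    -- The inversions of u at j pulled back along the transposition, so that the codes of u and f
    -- are compared through the same values `f k`.
    Rev : Fin (suc m) → Fin (suc m) → Set
    Rev j k = j Fin.< simple i k × f k < f (simple i j)

    Rev? : ∀ j k → Dec (Rev j k)
    Rev? j k = (j Fin.<? simple i k) ×-dec (f k ℕ.<? f (simple i j))

    code-u : ∀ j → code u j ≡ cnt (Rev? j)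
    code-u j = trans (sym (cnt-simple i (Inv? u j)))
      (cnt-cong (Inv? u j ∘ simple i) (Rev? j)
        (λ k (a , b) → a , subst (_< u j) (cong f (simple-involutive i k)) b)
        (λ k (a , b) → a , subst (_< u j) (sym (cong f (simple-involutive i k))) b))

    -- The additional inversion is the pair of swapped values: `f I` now stands at J, to the right
    -- of the larger `f J`.
    code-left : code u I ≡ suc (code f J)
    code-left = trans (code-u I) (cnt-insert (Inv? f J) (Rev? I) I
      (λ (lt , _) → <-asym lt I<J)
      (subst (I Fin.<_) (sym (simple-inject₁ i)) I<J , subst (f I <_) (sym (cong f (simple-inject₁ i))) asc)
      to from)
      where
      to : ∀ k → Inv f J k → Rev I k
      to k (lt , v) with cases i k
      ... | is-left = ⊥-elim (<-asym lt I<J)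
      ... | is-right = ⊥-elim (<-irrefl refl lt)
      ... | is-other _ _ e = subst (I Fin.<_) (sym e) (<-trans I<J lt) , subst (f k <_) (sym (cong f (simple-inject₁ i))) v
      from : ∀ k → Rev I k → k ≡ I ⊎ Inv f J k
      from k (lt , v) with cases i k
      ... | is-left = inj₁ refl
      ... | is-right = ⊥-elim (<-irrefl refl (subst (I Fin.<_) (simple-fsuc i) lt))
      ... | is-other _ ne e = inj₂ (beyond (subst (I Fin.<_) e lt) ne , subst (f k <_) (cong f (simple-inject₁ i)) v)

    code-right : code u J ≡ code f I
    code-right = trans (code-u J) (cnt-cong (Rev? J) (Inv? f I) to from)
      where
      to : ∀ k → Rev J k → Inv f I k
      to k (lt , v) with cases i k
      ... | is-left = ⊥-elim (<-irrefl refl (subst (J Fin.<_) (simple-inject₁ i) lt))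
      ... | is-right = ⊥-elim (<-asym I<J (subst (J Fin.<_) (simple-fsuc i) lt))
      ... | is-other _ ne e = <-trans I<J (subst (J Fin.<_) e lt) , subst (f k <_) (cong f (simple-fsuc i)) v
      from : ∀ k → Inv f I k → Rev J k
      from k (lt , v) with cases i k
      ... | is-left = ⊥-elim (<-irrefl refl lt)
      ... | is-right = ⊥-elim (<-asym v asc)
      ... | is-other _ ne e = subst (J Fin.<_) (sym e) (beyond lt ne) , subst (f k <_) (sym (cong f (simple-fsuc i))) v

    code-other : ∀ j → j ≢ I → j ≢ J → code u j ≡ code f j
    code-other j j≢I j≢J = trans (code-u j) (cnt-cong (Rev? j) (Inv? f j) to from)
      where
      sj = simple-other i j j≢I j≢J
      to : ∀ k → Rev j k → Inv f j k
      to k (lt , v) with simple-mono i j (simple i k) lt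
      ... | inj₁ (e , _) = ⊥-elim (j≢I e)
      ... | inj₂ lt' = subst₂ Fin._<_ sj (simple-involutive i k) lt' , subst (f k <_) (cong f sj) v
      from : ∀ k → Inv f j k → Rev j k
      from k (lt , v) with simple-mono i j k lt
      ... | inj₁ (e , _) = ⊥-elim (j≢I e)
      ... | inj₂ lt' = subst (Fin._< simple i k) sj lt' , subst (f k <_) (sym (cong f sj)) v

    code-simple-J : code u (simple i J) ≡ suc (code f J)
    code-simple-J = trans (cong (code u) (simple-fsuc i)) code-left

    code-simple : ∀ j → j ≢ J → code u (simple i j) ≡ code f j
    code-simple j j≢J with cases i j
    ... | is-left = trans (cong (code u) (simple-inject₁ i)) code-right
    ... | is-right = ⊥-elim (j≢J refl)
    ... | is-other p q e = trans (cong (code u) e) (code-other j p q)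

    sum-code : sumF (code u) ≡ suc (sumF (code f))
    sum-code = trans (sym (sumF-simple i (code u))) (sumF-bump (code f) (code u ∘ simple i) J code-simple code-simple-J)

open Codes

-- Independence of the Schubert functional from the chosen ascent.

module SchubertFunctional where
  open import Data.Nat as ℕ using (ℕ; zero; suc; _∸_; _≤_; _<_; s≤s; z≤n)
  open import Data.Integer using (ℤ; 1ℤ)
  import Data.Integer.Properties as ℤₚ
  open import Data.Fin as Fin using (Fin; toℕ; inject₁)
  import Data.Fin.Properties as Finₚ
  open import Data.List using (List; []; _∷_; allFin)
  open import Data.List.Relation.Unary.All as All using (All; []; _∷_)
  open import Data.List.Membership.Propositional.Properties using (∈-allFin)
  open import Data.Maybe using (Maybe; just; nothing)
  open import Data.Empty using (⊥-elim)
  open import Data.Sum using (_⊎_; inj₁; inj₂)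
  open import Data.Product using (∃-syntax; _×_; _,_)
  open import Function using (_∘_)
  open import Relation.Nullary using (¬_; Dec; yes; no)
  open import Relation.Binary using (tri<; tri≈; tri>)
  open import Relation.Binary.PropositionalEquality hiding (J)
  open import Data.Nat.Properties using (+-∸-assoc; <-cmp; <-irrefl; <-trans; <⇒≱; m≤n⇒m<n∨m≡n; n≤1+n; suc-injective; ≤-pred; ≤-refl; ≤-reflexive; ≤-trans)
  open ≡-Reasoning

  Asc : ∀ {m} → (Fin (suc m) → ℕ) → Fin m → Set
  Asc f i = f (inject₁ i) < f (Fin.suc i)

  Asc? : ∀ {m} (f : Fin (suc m) → ℕ) (i : Fin m) → Dec (Asc f i)
  Asc? f i = f (inject₁ i) ℕ.<? f (Fin.suc i)

  -- The local function of firstAscent, recovered by unification.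
  mutual
    ascentIn : ∀ {m} → (Fin (suc m) → Fin (suc m)) → List (Fin m) → Maybe (Fin m)
    ascentIn = _

    firstAscent≡ascentIn : ∀ {m} (f : Fin (suc m) → Fin (suc m)) → firstAscent f ≡ ascentIn f (allFin m)
    firstAscent≡ascentIn {m} f with allFin m
    ... | is = refl

  ascentIn-spec : ∀ {m} (f : Fin (suc m) → Fin (suc m)) is →
    (∃[ i ] (Asc (toℕ ∘ f) i × ascentIn f is ≡ just i)) ⊎ (All (λ i → ¬ Asc (toℕ ∘ f) i) is × ascentIn f is ≡ nothing)
  ascentIn-spec f [] = inj₂ ([] , refl)
  ascentIn-spec f (i ∷ is) with toℕ (f (inject₁ i)) ℕ.<? toℕ (f (Fin.suc i))
  ... | yes a = inj₁ (i , a , refl)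
  ... | no ¬a with ascentIn-spec f is
  ...   | inj₁ r = inj₁ r
  ...   | inj₂ (as , e) = inj₂ (¬a ∷ as , e)

  ascentIn-cong : ∀ {m} {f g : Fin (suc m) → Fin (suc m)} → (∀ k → f k ≡ g k) → ∀ is → ascentIn f is ≡ ascentIn g is
  ascentIn-cong e [] = refl
  ascentIn-cong {f = f} {g} e (i ∷ is)
    with toℕ (f (inject₁ i)) ℕ.<? toℕ (f (Fin.suc i)) | toℕ (g (inject₁ i)) ℕ.<? toℕ (g (Fin.suc i))
  ... | yes _ | yes _ = refl
  ... | no _ | no _ = ascentIn-cong e is
  ... | yes a | no ¬b = ⊥-elim (¬b (subst₂ (λ x y → toℕ x < toℕ y) (e (inject₁ i)) (e (Fin.suc i)) a))
  ... | no ¬a | yes b = ⊥-elim (¬a (subst₂ (λ x y → toℕ x < toℕ y) (sym (e (inject₁ i))) (sym (e (Fin.suc i))) b))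

  firstAscent-spec : ∀ {m} (f : Fin (suc m) → Fin (suc m)) →
    (∃[ i ] (Asc (toℕ ∘ f) i × firstAscent f ≡ just i)) ⊎ ((∀ i → ¬ Asc (toℕ ∘ f) i) × firstAscent f ≡ nothing)
  firstAscent-spec {m} f with ascentIn-spec f (allFin m)
  ... | inj₁ (i , a , e) = inj₁ (i , a , trans (firstAscent≡ascentIn f) e)
  ... | inj₂ (as , e) = inj₂ ((λ i → All.lookup as (∈-allFin i)) , trans (firstAscent≡ascentIn f) e)

  firstAscent-cong : ∀ {m} {f g : Fin (suc m) → Fin (suc m)} → (∀ k → f k ≡ g k) → firstAscent f ≡ firstAscent g
  firstAscent-cong {m} {f} {g} e = trans (firstAscent≡ascentIn f) (trans (ascentIn-cong e (allFin m)) (sym (firstAscent≡ascentIn g)))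

  schubertAux-just : ∀ {m} fuel (f : Fin (suc m) → Fin (suc m)) {i} → firstAscent f ≡ just i →
    schubertAux (suc fuel) f ≡ dd i (schubertAux fuel (f ∘ simple i))
  schubertAux-just fuel f e with firstAscent f
  schubertAux-just fuel f refl | just i = refl

  schubertAux-nothing : ∀ {m} fuel (f : Fin (suc m) → Fin (suc m)) → firstAscent f ≡ nothing →
    schubertAux (suc fuel) f ≡ (staircase (suc m) , 1ℤ) ∷ []
  schubertAux-nothing fuel f e with firstAscent f
  schubertAux-nothing fuel f refl | nothing = refl

  schubertAux-cong : ∀ {m} fuel {f g : Fin (suc m) → Fin (suc m)} → (∀ k → f k ≡ g k) → schubertAux fuel f ≡ schubertAux fuel g
  schubertAux-cong zero e = refl
  schubertAux-cong (suc fuel) {f} {g} e with firstAscent f | firstAscent g | firstAscent-cong e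
  ... | nothing | _ | refl = refl
  ... | just i | _ | refl = cong (dd i) (schubertAux-cong fuel (e ∘ simple i))

  -- The minuend is twice the maximal length, a bound for the length that follows at once from
  -- `code<`. What matters is that the difference drops by exactly one at every swap of an ascent.
  deficit : ∀ {m} → (Fin (suc m) → ℕ) → ℕ
  deficit {m} f = suc m ℕ.* m ∸ sumF (code f)

  sum-code≤ : ∀ {m} (f : Fin (suc m) → ℕ) → sumF (code f) ≤ suc m ℕ.* m
  sum-code≤ {m} f = subst (sumF (code f) ≤_) (sumF-const (suc m) m) (sumF-mono (λ k → ≤-pred (code< f k)))

  deficit-swap : ∀ {m} (f : Fin (suc m) → ℕ) (i : Fin m) → Asc f i → deficit f ≡ suc (deficit (f ∘ simple i))
  deficit-swap {m} f i a rewrite Swap.sum-code f i a =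
    +-∸-assoc 1 (subst (_≤ suc m ℕ.* m) (Swap.sum-code f i a) (sum-code≤ (f ∘ simple i)))

  deficit-cong : ∀ {m} {f g : Fin (suc m) → ℕ} → (∀ k → f k ≡ g k) → deficit f ≡ deficit g
  deficit-cong {m} e = cong (suc m ℕ.* m ∸_) (sumF-cong (code-cong e))

  -- The fuel is normalised to one more than the deficit; the additional unit serves for the final
  -- call that returns the staircase monomial.
  Sch : ∀ {m} → (Fin (suc m) → Fin (suc m)) → Functional (suc m) → ℤ
  Sch f = ⟪ schubertAux (suc (deficit (toℕ ∘ f))) f ⟫

  Sch-congˡ : ∀ {m} {f g : Fin (suc m) → Fin (suc m)} → (∀ k → f k ≡ g k) → ∀ φ → Sch f φ ≡ Sch g φ
  Sch-congˡ {f = f} {g} e φ rewrite deficit-cong (cong toℕ ∘ e) = cong (λ p → ⟪ p ⟫ φ) (schubertAux-cong (suc (deficit (toℕ ∘ g))) e)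

  Sch-congʳ : ∀ {m} (f : Fin (suc m) → Fin (suc m)) {φ ψ} → (∀ e → φ e ≡ ψ e) → Sch f φ ≡ Sch f ψ
  Sch-congʳ f = ⟪⟫-cong (schubertAux (suc (deficit (toℕ ∘ f))) f)

  -- Each step of the recursion consumes one unit of fuel and lowers the deficit by one, so any fuel
  -- above the deficit yields the same functional.
  schubertAux-fuel : ∀ {m} fuel (f : Fin (suc m) → Fin (suc m)) φ → deficit (toℕ ∘ f) < fuel → ⟪ schubertAux fuel f ⟫ φ ≡ Sch f φ
  schubertAux-fuel (suc fuel) f φ lt with firstAscent-spec f
  ... | inj₂ (_ , e) = cong (λ p → ⟪ p ⟫ φ) (trans (schubertAux-nothing fuel f e) (sym (schubertAux-nothing _ f e)))
  ... | inj₁ (i , a , e) = begin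
    ⟪ schubertAux (suc fuel) f ⟫ φ ≡⟨ cong (λ p → ⟪ p ⟫ φ) (schubertAux-just fuel f e) ⟩
    ⟪ dd i (schubertAux fuel (f ∘ simple i)) ⟫ φ ≡⟨ ⟪dd⟫ i (schubertAux fuel (f ∘ simple i)) φ ⟩
    ⟪ schubertAux fuel (f ∘ simple i) ⟫ (∂* i φ)
      ≡⟨ schubertAux-fuel fuel (f ∘ simple i) (∂* i φ) (≤-pred (subst (_< suc fuel) (deficit-swap (toℕ ∘ f) i a) lt)) ⟩
    ⟪ schubertAux (suc (deficit (toℕ ∘ f ∘ simple i))) (f ∘ simple i) ⟫ (∂* i φ)
      ≡⟨ cong (λ d → ⟪ schubertAux d (f ∘ simple i) ⟫ (∂* i φ)) (sym (deficit-swap (toℕ ∘ f) i a)) ⟩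
    ⟪ schubertAux (deficit (toℕ ∘ f)) (f ∘ simple i) ⟫ (∂* i φ)
      ≡⟨ sym (⟪dd⟫ i (schubertAux (deficit (toℕ ∘ f)) (f ∘ simple i)) φ) ⟩
    ⟪ dd i (schubertAux (deficit (toℕ ∘ f)) (f ∘ simple i)) ⟫ φ ≡⟨ cong (λ p → ⟪ p ⟫ φ) (sym (schubertAux-just _ f e)) ⟩
    Sch f φ ∎

  Sch-first : ∀ {m} (f : Fin (suc m) → Fin (suc m)) {i} → Asc (toℕ ∘ f) i → firstAscent f ≡ just i → ∀ φ → Sch f φ ≡ Sch (f ∘ simple i) (∂* i φ)
  Sch-first f {i} a e φ = begin
    Sch f φ ≡⟨ cong (λ p → ⟪ p ⟫ φ) (schubertAux-just _ f e) ⟩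
    ⟪ dd i (schubertAux (deficit (toℕ ∘ f)) (f ∘ simple i)) ⟫ φ ≡⟨ ⟪dd⟫ i (schubertAux (deficit (toℕ ∘ f)) (f ∘ simple i)) φ ⟩
    ⟪ schubertAux (deficit (toℕ ∘ f)) (f ∘ simple i) ⟫ (∂* i φ)
      ≡⟨ cong (λ d → ⟪ schubertAux d (f ∘ simple i) ⟫ (∂* i φ)) (deficit-swap (toℕ ∘ f) i a) ⟩
    Sch (f ∘ simple i) (∂* i φ) ∎

  Sch-none : ∀ {m} (f : Fin (suc m) → Fin (suc m)) → (∀ i → ¬ Asc (toℕ ∘ f) i) → ∀ φ → Sch f φ ≡ φ (staircase (suc m))
  Sch-none f none φ with firstAscent-spec f
  ... | inj₁ (i , a , _) = ⊥-elim (none i a)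
  ... | inj₂ (_ , e) = trans (cong (λ p → ⟪ p ⟫ φ) (schubertAux-nothing _ f e))
                            (trans (ℤₚ.+-identityʳ _) (ℤₚ.*-identityˡ _))

  asc-far : ∀ {m} (f : Fin (suc m) → ℕ) (i j : Fin m) → suc (toℕ i) < toℕ j ⊎ suc (toℕ j) < toℕ i → Asc f j → Asc (f ∘ simple i) j
  asc-far f i j far = subst₂ (λ x y → f x < f y) (sym (simple-other i (inject₁ j) n₁ n₂)) (sym (simple-other i (Fin.suc j) n₃ n₄))
    where
    absurd : ∀ {A : Set} {x y : ℕ} → x ≡ y → suc x < y ⊎ suc y < x → A
    absurd refl (inj₁ lt) = ⊥-elim (<⇒≱ lt (n≤1+n _))
    absurd refl (inj₂ lt) = ⊥-elim (<⇒≱ lt (n≤1+n _))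
    n₁ : inject₁ j ≢ inject₁ i
    n₁ e = absurd (cong toℕ (sym (Finₚ.inject₁-injective e))) far
    beside : ∀ {A : Set} {x y : ℕ} → x ≡ suc y → suc x < y ⊎ suc y < x → A
    beside refl (inj₁ lt) = ⊥-elim (<⇒≱ lt (≤-trans (n≤1+n _) (n≤1+n _)))
    beside refl (inj₂ lt) = ⊥-elim (<-irrefl refl lt)
    n₂ : inject₁ j ≢ Fin.suc i
    n₂ e = beside (trans (sym (Finₚ.toℕ-inject₁ j)) (cong toℕ e)) (Data.Sum.swap far)
    n₃ : Fin.suc j ≢ inject₁ i
    n₃ e = beside (sym (trans (cong toℕ e) (Finₚ.toℕ-inject₁ i))) far
    n₄ : Fin.suc j ≢ Fin.suc i
    n₄ e = absurd (cong toℕ (sym (Finₚ.suc-injective e))) far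

  -- Local confluence: two ascents i ≠ j of f are joined by the commutation or the braid relation.
  Joined : ∀ {m} → (Fin (suc m) → Fin (suc m)) → Fin m → Fin m → Set
  Joined f i j = ∀ φ → Sch (f ∘ simple i) (∂* i φ) ≡ Sch (f ∘ simple j) (∂* j φ)

  Swappable : ∀ {m} → (Fin (suc m) → Fin (suc m)) → Set
  Swappable f = ∀ i → Asc (toℕ ∘ f) i → ∀ φ → Sch f φ ≡ Sch (f ∘ simple i) (∂* i φ)

  joined-far : ∀ {m} (f : Fin (suc m) → Fin (suc m)) (i j : Fin m) → suc (toℕ i) < toℕ j → Asc (toℕ ∘ f) i → Asc (toℕ ∘ f) j →
    Swappable (f ∘ simple i) → Swappable (f ∘ simple j) → Joined f i j
  joined-far f i j far ai aj si sj φ = begin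
    Sch (f ∘ simple i) (∂* i φ) ≡⟨ si j (asc-far (toℕ ∘ f) i j (inj₁ far) aj) (∂* i φ) ⟩
    Sch (f ∘ simple i ∘ simple j) (∂* j (∂* i φ)) ≡⟨ Sch-congˡ (λ k → cong f (simple-comm i j far k)) _ ⟩
    Sch (f ∘ simple j ∘ simple i) (∂* j (∂* i φ)) ≡⟨ Sch-congʳ (f ∘ simple j ∘ simple i) (λ e → sym (∂*-comm i j far φ e)) ⟩
    Sch (f ∘ simple j ∘ simple i) (∂* i (∂* j φ)) ≡⟨ sym (sj i (asc-far (toℕ ∘ f) j i (inj₂ far) ai) (∂* j φ)) ⟩
    Sch (f ∘ simple j) (∂* j φ) ∎

  -- Three increasing values can be reversed along the two paths a b a and b a b. Every swap on the
  -- way is made at an ascent, and the braid relations for `simple` and `∂*` identify the ends.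
  joined-near : ∀ {m} (f : Fin (2 ℕ.+ m) → Fin (2 ℕ.+ m)) (i : Fin m) → Asc (toℕ ∘ f) (inject₁ i) → Asc (toℕ ∘ f) (Fin.suc i) →
    (∀ k → Asc (toℕ ∘ f) k → Swappable (f ∘ simple k)) →
    (∀ k l → Asc (toℕ ∘ f) k → Asc (toℕ ∘ f ∘ simple k) l → Swappable (f ∘ simple k ∘ simple l)) → Joined f (inject₁ i) (Fin.suc i)
  joined-near {m} f i aa ab s₁ s₂ φ = begin
    Sch (f ∘ sa) (∂* a φ) ≡⟨ s₁ a aa b a₁ (∂* a φ) ⟩
    Sch (f ∘ sa ∘ sb) (∂* b (∂* a φ)) ≡⟨ s₂ a b aa a₁ a a₂ (∂* b (∂* a φ)) ⟩
    Sch (f ∘ sa ∘ sb ∘ sa) (∂* a (∂* b (∂* a φ))) ≡⟨ Sch-congˡ (λ k → cong f (simple-braid i k)) _ ⟩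
    Sch (f ∘ sb ∘ sa ∘ sb) (∂* a (∂* b (∂* a φ))) ≡⟨ Sch-congʳ (f ∘ sb ∘ sa ∘ sb) (∂*-braid i φ) ⟩
    Sch (f ∘ sb ∘ sa ∘ sb) (∂* b (∂* a (∂* b φ))) ≡⟨ sym (s₂ b a ab b₁ b b₂ (∂* a (∂* b φ))) ⟩
    Sch (f ∘ sb ∘ sa) (∂* a (∂* b φ)) ≡⟨ sym (s₁ b ab a b₁ (∂* b φ)) ⟩
    Sch (f ∘ sb) (∂* b φ) ∎
    where
    a b : Fin (suc m)
    a = inject₁ i
    b = Fin.suc i
    sa sb : Fin (2 ℕ.+ m) → Fin (2 ℕ.+ m)
    sa = simple a
    sb = simple b
    x y z : Fin (2 ℕ.+ m)
    x = inject₁ a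
    y = Fin.suc a
    z = Fin.suc b
    ax : sa x ≡ y
    ax = simple-inject₁ a
    ay : sa y ≡ x
    ay = simple-fsuc a
    toℕx : toℕ x ≡ toℕ i
    toℕx = trans (Finₚ.toℕ-inject₁ a) (Finₚ.toℕ-inject₁ i)
    toℕy : toℕ y ≡ suc (toℕ i)
    toℕy = cong suc (Finₚ.toℕ-inject₁ i)
    ne : ∀ {p q : Fin (2 ℕ.+ m)} → toℕ p < toℕ q → p ≢ q
    ne lt refl = <-irrefl refl lt
    y<z : toℕ y < toℕ z
    y<z = subst (_< toℕ z) (sym toℕy) ≤-refl
    x<y : toℕ x < toℕ y
    x<y = subst₂ _<_ (sym toℕx) (sym toℕy) ≤-refl
    x<z : toℕ x < toℕ z
    x<z = <-trans x<y y<z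
    az : sa z ≡ z
    az = simple-other a z (λ e → ne x<z (sym e)) (λ e → ne y<z (sym e))
    by : sb y ≡ z
    by = simple-inject₁ b
    bz : sb z ≡ y
    bz = simple-fsuc b
    bx : sb x ≡ x
    bx = simple-other b x (ne x<y) (ne x<z)
    xy : toℕ (f x) < toℕ (f y)
    xy = aa
    yz : toℕ (f y) < toℕ (f z)
    yz = ab
    cast : ∀ {p p' q q' : Fin (2 ℕ.+ m)} → p ≡ p' → q ≡ q' → toℕ (f p') < toℕ (f q') → toℕ (f p) < toℕ (f q)
    cast refl refl lt = lt
    a₁ : Asc (toℕ ∘ f ∘ sa) b
    a₁ = cast ay az (<-trans xy yz)
    a₂ : Asc (toℕ ∘ f ∘ sa ∘ sb) a
    a₂ = cast (trans (cong sa bx) ax) (trans (cong sa by) az) yz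
    b₁ : Asc (toℕ ∘ f ∘ sb) a
    b₁ = cast bx by (<-trans xy yz)
    b₂ : Asc (toℕ ∘ f ∘ sb ∘ sa) b
    b₂ = cast (trans (cong sb ay) bx) (trans (cong sb az) bz) xy

  joined-next : ∀ {m} (f : Fin (suc m) → Fin (suc m)) (i j : Fin m) → suc (toℕ i) ≡ toℕ j → Asc (toℕ ∘ f) i → Asc (toℕ ∘ f) j →
    (∀ k → Asc (toℕ ∘ f) k → Swappable (f ∘ simple k)) →
    (∀ k l → Asc (toℕ ∘ f) k → Asc (toℕ ∘ f ∘ simple k) l → Swappable (f ∘ simple k ∘ simple l)) → Joined f i j
  joined-next {suc m} f i (Fin.suc j) e with Finₚ.toℕ-injective {i = i} {j = inject₁ j} (trans (suc-injective e) (sym (Finₚ.toℕ-inject₁ j)))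
  ... | refl = joined-near f j

  -- A Newman-style induction on the deficit. `Sch f` is defined through the first ascent j; the
  -- given ascent i is joined with j by the induction hypothesis one and two swaps further on.
  swappable : ∀ {m} d (f : Fin (suc m) → Fin (suc m)) → deficit (toℕ ∘ f) ≤ d → Swappable f
  swappable {m} d f le i a φ with firstAscent-spec f
  ... | inj₂ (none , _) = ⊥-elim (none i a)
  ... | inj₁ (j , b , e) = trans (Sch-first f b e φ) (joined d le)
    where
    lower : ∀ {d} (g : Fin (suc m) → Fin (suc m)) k → Asc (toℕ ∘ g) k → deficit (toℕ ∘ g) ≤ suc d → deficit (toℕ ∘ g ∘ simple k) ≤ d
    lower {d} g k a le = ≤-pred (subst (_≤ suc d) (deficit-swap (toℕ ∘ g) k a) le)
    joined : ∀ d → deficit (toℕ ∘ f) ≤ d → Sch (f ∘ simple j) (∂* j φ) ≡ Sch (f ∘ simple i) (∂* i φ)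
    joined zero le = ⊥-elim (<⇒≱ (s≤s z≤n) (subst (_≤ 0) (deficit-swap (toℕ ∘ f) j b) le))
    joined (suc d) le = split (<-cmp (toℕ i) (toℕ j))
      where
      s₁ : ∀ k → Asc (toℕ ∘ f) k → Swappable (f ∘ simple k)
      s₁ k ak = swappable d (f ∘ simple k) (lower f k ak le)
      s₂ : ∀ k l → Asc (toℕ ∘ f) k → Asc (toℕ ∘ f ∘ simple k) l → Swappable (f ∘ simple k ∘ simple l)
      s₂ k l ak al = swappable d (f ∘ simple k ∘ simple l)
        (≤-trans (≤-trans (n≤1+n _) (≤-reflexive (sym (deficit-swap (toℕ ∘ f ∘ simple k) l al)))) (lower f k ak le))
      ordered : ∀ k l → Asc (toℕ ∘ f) k → Asc (toℕ ∘ f) l → toℕ k < toℕ l → Joined f k l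
      ordered k l ak al lt with m≤n⇒m<n∨m≡n lt
      ... | inj₁ far = joined-far f k l far ak al (s₁ k ak) (s₁ l al)
      ... | inj₂ near = joined-next f k l near ak al s₁ s₂
      split : _ → Sch (f ∘ simple j) (∂* j φ) ≡ Sch (f ∘ simple i) (∂* i φ)
      split (tri< lt _ _) = sym (ordered i j a b lt φ)
      split (tri> _ _ gt) = ordered j i b a gt φ
      split (tri≈ _ eq _) with Finₚ.toℕ-injective eq
      ... | refl = refl

  Sch-swap : ∀ {m} (f : Fin (suc m) → Fin (suc m)) i → Asc (toℕ ∘ f) i → ∀ φ → Sch f φ ≡ Sch (f ∘ simple i) (∂* i φ)
  Sch-swap f = swappable _ f ≤-refl

open SchubertFunctional

-- Sums over the layers of flagged Gelfand-Tsetlin patterns.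

module LayerSums where
  open import Data.Nat as ℕ using (ℕ; zero; suc; _∸_; _≤_; _<_; s≤s; z≤n; _⊔_; _⊓_)
  import Data.Nat.Properties as ℕₚ
  open import Data.Integer using (ℤ; 0ℤ; _+_; _-_; -_)
  import Data.Integer.Properties as ℤₚ
  open import Data.Integer.Tactic.RingSolver using (solve-∀)
  open import Data.Nat.Tactic.RingSolver using () renaming (solve-∀ to solveℕ)
  open import Data.Fin as Fin using (Fin; toℕ)
  open import Data.Vec using (Vec; []; _∷_)
  open import Data.Empty using (⊥-elim)
  open import Data.Unit using (⊤; tt)
  open import Data.Sum using (inj₁; inj₂)
  open import Data.Product using (∃-syntax; _×_; _,_; proj₁; proj₂)
  open import Function using (_∘_)
  open import Relation.Nullary using (¬_; Dec; yes; no)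
  open import Relation.Nullary.Decidable using (_×-dec_; _→-dec_; map′; ¬?)
  open import Relation.Binary.PropositionalEquality hiding (J)
  open import Relation.Binary using (tri<; tri≈; tri>)
  open import Data.Nat.Properties using (+-assoc; +-cancelˡ-≡; +-comm; +-identityʳ; +-mono-≤; +-monoʳ-<; +-monoˡ-≤; +-suc; +-∸-assoc; +-∸-comm; <-cmp; <-irrefl; <-trans; <⇒≤; <⇒≱; [m+n]∸[m+o]≡n∸o; m+[n∸m]≡n; m+n∸m≡n; m∸n+n≡m; m≤m+n; m≤m⊔n; m≤n+m; m≤n⇒m≤1+n; m≤n⇒m⊓n≡m; m≤n⇒m⊔n≡n; m≤n⊔m; m≥n⇒m⊓n≡n; m≥n⇒m⊔n≡m; m⊓n≤m; m⊓n≤n; n≤1+n; suc-injective; ∸-+-assoc; ≤-<-trans; ≤-antisym; ≤-pred; ≤-refl; ≤-reflexive; ≤-total; ≤-trans; ≤∧≢⇒<; ≮⇒≥; ≰⇒>; ⊓-glb; ⊔-identityʳ; ⊔-lub)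
  open ≡-Reasoning

  when : ∀ {A : Set} → Dec A → ℤ → ℤ
  when (yes _) x = x
  when (no _) x = 0ℤ

  when-yes : ∀ {A : Set} (a? : Dec A) {x} → A → when a? x ≡ x
  when-yes (yes _) a = refl
  when-yes (no ¬a) a = ⊥-elim (¬a a)

  when-no : ∀ {A : Set} (a? : Dec A) {x} → ¬ A → when a? x ≡ 0ℤ
  when-no (yes a) ¬a = ⊥-elim (¬a a)
  when-no (no _) ¬a = refl

  when-cong : ∀ {A B : Set} (a? : Dec A) (b? : Dec B) {x y} → (A → B) → (B → A) → (A → x ≡ y) → when a? x ≡ when b? y
  when-cong (yes a) b? f g e = trans (e a) (sym (when-yes b? (f a)))
  when-cong (no ¬a) b? f g e = sym (when-no b? (¬a ∘ g))

  when-0 : ∀ {A : Set} (a? : Dec A) {x} → (A → x ≡ 0ℤ) → when a? x ≡ 0ℤ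
  when-0 (yes a) e = e a
  when-0 (no _) e = refl

  when-× : ∀ {A B C : Set} (a? : Dec A) (b? : Dec B) (c? : Dec C) {x} → (A → B → C) → (C → A × B) → when a? (when b? x) ≡ when c? x
  when-× (yes a) b? c? f g = when-cong b? c? (f a) (proj₂ ∘ g) (λ _ → refl)
  when-× (no ¬a) b? c? f g = sym (when-no c? (¬a ∘ proj₁ ∘ g))

  when-- : ∀ {A : Set} (a? : Dec A) x y → when a? (x - y) ≡ when a? x - when a? y
  when-- (yes _) x y = refl
  when-- (no _) x y = refl

  when-+ : ∀ {A : Set} (a? : Dec A) x y → when a? (x + y) ≡ when a? x + when a? y
  when-+ (yes _) x y = refl
  when-+ (no _) x y = refl

  Σ<-zero : ∀ n {f : ℕ → ℤ} → (∀ k → k < n → f k ≡ 0ℤ) → Σ< n f ≡ 0ℤ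
  Σ<-zero n e = trans (Σ<-cong n e) (Σ<-0 n)

  Σ<-single : ∀ n (f : ℕ → ℤ) y → y < n → (∀ k → k ≢ y → f k ≡ 0ℤ) → Σ< n f ≡ f y
  Σ<-single (suc n) f y y<n z with y ℕ.≟ n
  ... | yes refl = trans (cong (_+ f n) (Σ<-zero n (λ k k<n → z k (ℕₚ.<⇒≢ k<n)))) (ℤₚ.+-identityˡ (f n))
  ... | no y≢n = trans (cong₂ _+_ (Σ<-single n f y (≤∧≢⇒< (≤-pred y<n) y≢n) z) (z n (y≢n ∘ sym))) (ℤₚ.+-identityʳ (f y))

  Σ<-reverse : ∀ d (f : ℕ → ℤ) → Σ< d f ≡ Σ< d (λ k → f (d ∸ suc k))
  Σ<-reverse zero f = refl
  Σ<-reverse (suc d) f = begin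
    Σ< d f + f d ≡⟨ ℤₚ.+-comm (Σ< d f) (f d) ⟩
    f d + Σ< d f ≡⟨ cong (f d +_) (Σ<-reverse d f) ⟩
    f d + Σ< d (λ k → f (d ∸ suc k)) ≡⟨ sym (Σ<-head d (λ k → f (d ∸ k))) ⟩
    Σ< (suc d) (λ k → f (d ∸ k)) ∎

  module Interval (l u : ℕ) {P : ℕ → Set} (P? : ∀ z → Dec (P z)) (to : ∀ z → P z → l ≤ z × z < u) (from : ∀ z → l ≤ z → z < u → P z) where

    interval : ∀ n (F : ℕ → ℤ) → l ≤ u → u ≤ n → Σ< n (λ z → when (P? z) (F z)) ≡ Σ< (u ∸ l) (λ k → F (l ℕ.+ k))
    interval n F l≤u u≤n = begin
      Σ< n W ≡⟨ cong (λ x → Σ< x W) (sym (m+[n∸m]≡n u≤n)) ⟩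
      Σ< (u ℕ.+ (n ∸ u)) W ≡⟨ Σ<-split u (n ∸ u) W ⟩
      Σ< u W + Σ< (n ∸ u) (λ k → W (u ℕ.+ k))
        ≡⟨ cong₂ _+_ (cong (λ x → Σ< x W) (sym (m+[n∸m]≡n l≤u)))
                     (Σ<-zero (n ∸ u) (λ k _ → when-no (P? (u ℕ.+ k)) (λ p → <⇒≱ (proj₂ (to _ p)) (m≤m+n u k)))) ⟩
      Σ< (l ℕ.+ (u ∸ l)) W + 0ℤ ≡⟨ ℤₚ.+-identityʳ _ ⟩
      Σ< (l ℕ.+ (u ∸ l)) W ≡⟨ Σ<-split l (u ∸ l) W ⟩
      Σ< l W + Σ< (u ∸ l) (λ k → W (l ℕ.+ k))
        ≡⟨ cong₂ _+_ (Σ<-zero l (λ k k<l → when-no (P? k) (λ p → <⇒≱ k<l (proj₁ (to _ p)))))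
                     (Σ<-cong (u ∸ l) (λ k k< → when-yes (P? (l ℕ.+ k)) (from _ (m≤m+n l k)
                        (subst (l ℕ.+ k <_) (m+[n∸m]≡n l≤u) (+-monoʳ-< l k<))))) ⟩
      0ℤ + Σ< (u ∸ l) (λ k → F (l ℕ.+ k)) ≡⟨ ℤₚ.+-identityˡ _ ⟩
      Σ< (u ∸ l) (λ k → F (l ℕ.+ k)) ∎
      where
      W : ℕ → ℤ
      W z = when (P? z) (F z)

    telescope : ∀ n (F : ℕ → ℤ) → l ≤ u → u ≤ n → Σ< n (λ z → when (P? z) (F (suc z) - F z)) ≡ F u - F l
    telescope n F l≤u u≤n = trans (interval n (λ z → F (suc z) - F z) l≤u u≤n)
      (trans (tele (u ∸ l)) (cong (λ x → F x - F l) (m+[n∸m]≡n l≤u)))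
      where
      lem : ∀ a b c → (a - b) + (c - a) ≡ c - b
      lem = solve-∀
      tele : ∀ d → Σ< d (λ k → F (suc (l ℕ.+ k)) - F (l ℕ.+ k)) ≡ F (l ℕ.+ d) - F l
      tele zero = sym (trans (cong (λ x → F x - F l) (+-identityʳ l)) (ℤₚ.+-inverseʳ (F l)))
      tele (suc d) = begin
        Σ< d (λ k → F (suc (l ℕ.+ k)) - F (l ℕ.+ k)) + (F (suc (l ℕ.+ d)) - F (l ℕ.+ d))
          ≡⟨ cong (_+ (F (suc (l ℕ.+ d)) - F (l ℕ.+ d))) (tele d) ⟩
        (F (l ℕ.+ d) - F l) + (F (suc (l ℕ.+ d)) - F (l ℕ.+ d)) ≡⟨ lem (F (l ℕ.+ d)) (F l) (F (suc (l ℕ.+ d))) ⟩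
        F (suc (l ℕ.+ d)) - F l ≡⟨ cong (λ x → F x - F l) (sym (+-suc l d)) ⟩
        F (l ℕ.+ suc d) - F l ∎

    -- The substitution z ↦ l + u - 1 - z; for u < l both sums are empty.
    reflect : ∀ n (F : ℕ → ℤ) → u ≤ n → Σ< n (λ z → when (P? z) (F z)) ≡ Σ< n (λ z → when (P? z) (F (l ℕ.+ (u ∸ suc z))))
    reflect n F u≤n with l ℕ.≤? u
    ... | no l≰u = trans (Σ<-zero n (λ k _ → when-no (P? k) (empty k))) (sym (Σ<-zero n (λ k _ → when-no (P? k) (empty k))))
      where
      empty : ∀ k → ¬ P k
      empty k p = l≰u (≤-trans (proj₁ (to k p)) (<⇒≤ (proj₂ (to k p))))
    ... | yes l≤u = begin
      Σ< n (λ z → when (P? z) (F z)) ≡⟨ interval n F l≤u u≤n ⟩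
      Σ< (u ∸ l) (λ k → F (l ℕ.+ k)) ≡⟨ Σ<-reverse (u ∸ l) (λ k → F (l ℕ.+ k)) ⟩
      Σ< (u ∸ l) (λ k → F (l ℕ.+ (u ∸ l ∸ suc k)))
        ≡⟨ Σ<-cong (u ∸ l) (λ k _ → cong (λ x → F (l ℕ.+ x)) (trans (∸-+-assoc u l (suc k)) (cong (u ∸_) (+-suc l k)))) ⟩
      Σ< (u ∸ l) (λ k → F (l ℕ.+ (u ∸ suc (l ℕ.+ k)))) ≡⟨ sym (interval n (λ z → F (l ℕ.+ (u ∸ suc z))) l≤u u≤n) ⟩
      Σ< n (λ z → when (P? z) (F (l ℕ.+ (u ∸ suc z)))) ∎

  -- The default 0 makes the rows beyond the last one empty, so that conditions on neighbouring rows
  -- need no special case at the end.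
  at : ∀ {R} → Vec ℕ R → ℕ → ℕ
  at [] _ = 0
  at (x ∷ v) zero = x
  at (x ∷ v) (suc s) = at v s

  at-beyond : ∀ {R} (v : Vec ℕ R) s → R ≤ s → at v s ≡ 0
  at-beyond [] s le = refl
  at-beyond (x ∷ v) (suc s) (s≤s le) = at-beyond v s le

  size : ∀ {R} → Vec ℕ R → ℕ
  size [] = 0
  size (x ∷ v) = x ℕ.+ size v

  size-mono : ∀ {R} (v w : Vec ℕ R) → (∀ s → at v s ≤ at w s) → size v ≤ size w
  size-mono [] [] e = z≤n
  size-mono (x ∷ v) (y ∷ w) e = +-mono-≤ (e 0) (size-mono v w (e ∘ suc))

  size-cong : ∀ {R} (v w : Vec ℕ R) → (∀ s → at v s ≡ at w s) → size v ≡ size w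
  size-cong [] [] e = refl
  size-cong (x ∷ v) (y ∷ w) e = cong₂ ℕ._+_ (e 0) (size-cong v w (e ∘ suc))

  -- Kept additive, so that no truncated subtraction enters when one row changes its length.
  size-exchange : ∀ {R} r (v w : Vec ℕ R) → r < R → (∀ s → s ≢ r → at v s ≡ at w s) → at w r ℕ.+ size v ≡ at v r ℕ.+ size w
  size-exchange zero (x ∷ v) (y ∷ w) lt h = begin
    y ℕ.+ (x ℕ.+ size v) ≡⟨ cong (λ z → y ℕ.+ (x ℕ.+ z)) (size-cong v w (λ s → h (suc s) λ ())) ⟩
    y ℕ.+ (x ℕ.+ size w) ≡⟨ sym (+-assoc y x (size w)) ⟩
    y ℕ.+ x ℕ.+ size w ≡⟨ cong (ℕ._+ size w) (+-comm y x) ⟩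
    x ℕ.+ y ℕ.+ size w ≡⟨ +-assoc x y (size w) ⟩
    x ℕ.+ (y ℕ.+ size w) ∎
  size-exchange (suc r) (x ∷ v) (y ∷ w) (s≤s lt) h = begin
    at w r ℕ.+ (x ℕ.+ size v) ≡⟨ shuffle (at w r) x (size v) ⟩
    x ℕ.+ (at w r ℕ.+ size v) ≡⟨ cong₂ ℕ._+_ (h 0 λ ()) (size-exchange r v w lt (λ s ne → h (suc s) (ne ∘ suc-injective))) ⟩
    y ℕ.+ (at v r ℕ.+ size w) ≡⟨ sym (shuffle (at v r) y (size w)) ⟩
    at v r ℕ.+ (y ℕ.+ size w) ∎
    where
    shuffle : ∀ a b c → a ℕ.+ (b ℕ.+ c) ≡ b ℕ.+ (a ℕ.+ c)
    shuffle a b c = trans (sym (+-assoc a b c)) (trans (cong (ℕ._+ c) (+-comm a b)) (+-assoc b a c))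

  vecOf : ∀ R → (ℕ → ℕ) → Vec ℕ R
  vecOf zero F = []
  vecOf (suc R) F = F 0 ∷ vecOf R (F ∘ suc)

  at-vecOf : ∀ R F s → s < R → at (vecOf R F) s ≡ F s
  at-vecOf (suc R) F zero lt = refl
  at-vecOf (suc R) F (suc s) (s≤s lt) = at-vecOf R (F ∘ suc) s lt

  module Box (B : ℕ) where

    ΣB : ∀ R → (Vec ℕ R → ℤ) → ℤ
    ΣB zero F = F []
    ΣB (suc R) F = Σ< B (λ b → ΣB R (λ v → F (b ∷ v)))

    ΣB-cong : ∀ R {F G : Vec ℕ R → ℤ} → (∀ v → F v ≡ G v) → ΣB R F ≡ ΣB R G
    ΣB-cong zero e = e []
    ΣB-cong (suc R) e = Σ<-cong B (λ b _ → ΣB-cong R (λ v → e (b ∷ v)))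

    ΣB-0 : ∀ R → ΣB R (λ _ → 0ℤ) ≡ 0ℤ
    ΣB-0 zero = refl
    ΣB-0 (suc R) = Σ<-zero B (λ _ _ → ΣB-0 R)

    ΣB-zero : ∀ R {F : Vec ℕ R → ℤ} → (∀ v → F v ≡ 0ℤ) → ΣB R F ≡ 0ℤ
    ΣB-zero R e = trans (ΣB-cong R e) (ΣB-0 R)

    ΣB-+ : ∀ R (F G : Vec ℕ R → ℤ) → ΣB R (λ v → F v + G v) ≡ ΣB R F + ΣB R G
    ΣB-+ zero F G = refl
    ΣB-+ (suc R) F G = trans (Σ<-cong B (λ b _ → ΣB-+ R (λ v → F (b ∷ v)) (λ v → G (b ∷ v)))) (Σ<-+ B _ _)

    ΣB-- : ∀ R (F G : Vec ℕ R → ℤ) → ΣB R (λ v → F v - G v) ≡ ΣB R F - ΣB R G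
    ΣB-- zero F G = refl
    ΣB-- (suc R) F G = trans (Σ<-cong B (λ b _ → ΣB-- R (λ v → F (b ∷ v)) (λ v → G (b ∷ v)))) (Σ<-- B _ _)

    ΣB-Σ< : ∀ R n (F : Vec ℕ R → ℕ → ℤ) → ΣB R (λ v → Σ< n (F v)) ≡ Σ< n (λ k → ΣB R (λ v → F v k))
    ΣB-Σ< zero n F = refl
    ΣB-Σ< (suc R) n F = trans (Σ<-cong B (λ b _ → ΣB-Σ< R n (λ v → F (b ∷ v)))) (Σ<-swap B n (λ b k → ΣB R (λ v → F (b ∷ v) k)))

    ΣB-swap : ∀ R T (F : Vec ℕ R → Vec ℕ T → ℤ) → ΣB R (λ v → ΣB T (F v)) ≡ ΣB T (λ w → ΣB R (λ v → F v w))
    ΣB-swap zero T F = refl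
    ΣB-swap (suc R) T F = trans (Σ<-cong B (λ b _ → ΣB-swap R T (λ v → F (b ∷ v)))) (sym (ΣB-Σ< T B (λ w b → ΣB R (λ v → F (b ∷ v) w))))

    when-ΣB : ∀ R {A : Set} (a? : Dec A) (F : Vec ℕ R → ℤ) → when a? (ΣB R F) ≡ ΣB R (λ v → when a? (F v))
    when-ΣB R (yes _) F = refl
    when-ΣB R (no _) F = sym (ΣB-0 R)

    ΣB-single : ∀ R (F : Vec ℕ R → ℤ) w → (∀ s → s < R → at w s < B) → (∀ v → ¬ (∀ s → at v s ≡ at w s) → F v ≡ 0ℤ) → ΣB R F ≡ F w
    ΣB-single zero F [] bd z = refl
    ΣB-single (suc R) F (x ∷ w) bd z = trans
      (Σ<-single B (λ b → ΣB R (λ v → F (b ∷ v))) x (bd 0 (s≤s z≤n)) (λ k k≢x → ΣB-zero R (λ v → z (k ∷ v) (λ e → k≢x (e 0)))))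
      (ΣB-single R (λ v → F (x ∷ v)) w (λ s s<R → bd (suc s) (s≤s s<R)) (λ v ne → z (x ∷ v) (λ e → ne (λ s → e (suc s)))))

    -- Both summands live on a single value of coordinate r; replacing x by y there is a bijection
    -- of the supports.
    ΣB-shift : ∀ R r x y (F G : Vec ℕ R → ℤ) → r < R → x < B → y < B →
      (∀ v → at v r ≢ x → F v ≡ 0ℤ) → (∀ v → at v r ≢ y → G v ≡ 0ℤ) →
      (∀ v w → at v r ≡ x → at w r ≡ y → (∀ s → s ≢ r → at v s ≡ at w s) → F v ≡ G w) → ΣB R F ≡ ΣB R G
    ΣB-shift (suc R) zero x y F G r<R x<B y<B fz gz e = begin
      Σ< B (λ b → ΣB R (λ v → F (b ∷ v))) ≡⟨ Σ<-single B _ x x<B (λ k k≢x → ΣB-zero R (λ v → fz (k ∷ v) k≢x)) ⟩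
      ΣB R (λ v → F (x ∷ v)) ≡⟨ ΣB-cong R (λ v → e (x ∷ v) (y ∷ v) refl refl (λ { zero ne → ⊥-elim (ne refl) ; (suc s) _ → refl })) ⟩
      ΣB R (λ v → G (y ∷ v)) ≡⟨ sym (Σ<-single B _ y y<B (λ k k≢y → ΣB-zero R (λ v → gz (k ∷ v) k≢y))) ⟩
      Σ< B (λ b → ΣB R (λ v → G (b ∷ v))) ∎
    ΣB-shift (suc R) (suc r) x y F G (s≤s r<R) x<B y<B fz gz e = Σ<-cong B (λ b _ →
      ΣB-shift R r x y (λ v → F (b ∷ v)) (λ v → G (b ∷ v)) r<R x<B y<B (λ v → fz (b ∷ v)) (λ v → gz (b ∷ v))
        (λ v w p q h → e (b ∷ v) (b ∷ w) p q (λ { zero _ → refl ; (suc s) ne → h s (λ z → ne (cong suc z)) })))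

    -- γ interlaces with α and β below the cap a: it is a possible middle layer between α and β.
    Int : ∀ {R} → ℕ → Vec ℕ R → Vec ℕ R → Vec ℕ R → Set
    Int a [] [] [] = ⊤
    Int a (x ∷ α) (y ∷ β) (z ∷ γ) = (x ≤ z × at β 0 ≤ z × z ≤ y × z ≤ a) × Int x α β γ

    int? : ∀ {R} a (α β γ : Vec ℕ R) → Dec (Int a α β γ)
    int? a [] [] [] = yes tt
    int? a (x ∷ α) (y ∷ β) (z ∷ γ) = ((x ℕ.≤? z) ×-dec (at β 0 ℕ.≤? z) ×-dec (z ℕ.≤? y) ×-dec (z ℕ.≤? a)) ×-dec int? x α β γ

    record IntAt {R} (a : ℕ) (α β γ : Vec ℕ R) (s : ℕ) : Set where
      field
        α≤γ : at α s ≤ at γ s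
        β≤γ : at β (suc s) ≤ at γ s
        γ≤β : at γ s ≤ at β s
        γ≤α : at γ s ≤ at (a ∷ α) s
    open IntAt

    int-elim : ∀ {R} a (α β γ : Vec ℕ R) → Int a α β γ → ∀ s → IntAt a α β γ s
    int-elim a [] [] [] _ s = record { α≤γ = z≤n ; β≤γ = z≤n ; γ≤β = z≤n ; γ≤α = z≤n }
    int-elim a (x ∷ α) (y ∷ β) (z ∷ γ) ((p , q , r , t) , i) zero = record { α≤γ = p ; β≤γ = q ; γ≤β = r ; γ≤α = t }
    int-elim a (x ∷ α) (y ∷ β) (z ∷ γ) (_ , i) (suc s) =
      let h = int-elim x α β γ i s in record { α≤γ = α≤γ h ; β≤γ = β≤γ h ; γ≤β = γ≤β h ; γ≤α = γ≤α h }

    int-intro : ∀ {R} a (α β γ : Vec ℕ R) → (∀ s → IntAt a α β γ s) → Int a α β γ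
    int-intro a [] [] [] h = tt
    int-intro a (x ∷ α) (y ∷ β) (z ∷ γ) h = (α≤γ (h 0) , β≤γ (h 0) , γ≤β (h 0) , γ≤α (h 0)) ,
      int-intro x α β γ (λ s → record { α≤γ = α≤γ (h (suc s)) ; β≤γ = β≤γ (h (suc s)) ; γ≤β = γ≤β (h (suc s)) ; γ≤α = γ≤α (h (suc s)) })

    int-size : ∀ {R} a (α β γ : Vec ℕ R) → Int a α β γ → size γ ≤ size β
    int-size a α β γ i = size-mono γ β (λ s → γ≤β (int-elim a α β γ i s))

    ΣI : ∀ {R} → ℕ → Vec ℕ R → Vec ℕ R → (Vec ℕ R → ℤ) → ℤ
    ΣI {R} a α β F = ΣB R (λ γ → when (int? a α β γ) (F γ))

    ΣI-cong : ∀ {R} a (α β : Vec ℕ R) {F G : Vec ℕ R → ℤ} → (∀ γ → Int a α β γ → F γ ≡ G γ) → ΣI a α β F ≡ ΣI a α β G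
    ΣI-cong {R} a α β e = ΣB-cong R (λ γ → when-cong (int? a α β γ) (int? a α β γ) (λ i → i) (λ i → i) (e γ))

    -- Bender–Knuth: the intervals of the rows are independent, and reflecting each of them
    -- exchanges the numbers of the two entries.
    bender-knuth : ∀ {R} a (α β : Vec ℕ R) (Q : ℕ → ℤ) → (∀ s → s < R → at β s < B) →
      ΣI a α β (λ γ → Q ((a ⊔ at β 0) ℕ.+ size γ)) ≡ ΣI a α β (λ γ → Q (a ℕ.+ size α ℕ.+ size β ∸ size γ))
    bender-knuth a [] [] Q bd = cong Q (trans (+-identityʳ (a ⊔ 0)) (trans (⊔-identityʳ a) (sym (trans (+-identityʳ (a ℕ.+ 0)) (+-identityʳ a)))))
    bender-knuth {suc R} a (x ∷ α) (y ∷ β) Q bd = begin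
      Σ< B (λ z → ΣB R (λ γ → when (c? z ×-dec int? x α β γ) (Q ((a ⊔ y) ℕ.+ (z ℕ.+ size γ)))))
        ≡⟨ Σ<-cong B (λ z _ → factor z) ⟩
      Σ< B (λ z → when (c? z) (T ((a ⊔ y) ℕ.+ z) ))
        -- Reflection sends z to l + (a ⊓ y) - z. As (a ⊔ y) + (a ⊓ y) = a + y, the argument becomes
        -- (a + y - z) + l plus the size of the rest, and l = x ⊔ at β 0 is precisely the offset
        -- that the induction hypothesis expects for the remaining rows.
        ≡⟨ reflect B (λ z → T ((a ⊔ y) ℕ.+ z)) u≤B ⟩
      Σ< B (λ z → when (c? z) (T ((a ⊔ y) ℕ.+ (l ℕ.+ (u ∸ suc z)))))
        ≡⟨ Σ<-cong B (λ z _ → when-cong (c? z) (c? z) (λ c → c) (λ c → c) (step z)) ⟩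
      Σ< B (λ z → when (c? z) (ΣI x α β (λ γ → Q (a ℕ.+ (x ℕ.+ size α) ℕ.+ (y ℕ.+ size β) ∸ (z ℕ.+ size γ)))))
        ≡⟨ Σ<-cong B (λ z _ → unfactor z) ⟩
      Σ< B (λ z → ΣB R (λ γ → when (c? z ×-dec int? x α β γ) (Q (a ℕ.+ (x ℕ.+ size α) ℕ.+ (y ℕ.+ size β) ∸ (z ℕ.+ size γ))))) ∎
      where
      C : ℕ → Set
      C z = x ≤ z × at β 0 ≤ z × z ≤ y × z ≤ a
      c? : ∀ z → Dec (C z)
      c? z = (x ℕ.≤? z) ×-dec (at β 0 ℕ.≤? z) ×-dec (z ℕ.≤? y) ×-dec (z ℕ.≤? a)
      l u : ℕ
      l = x ⊔ at β 0
      u = suc (a ⊓ y)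
      open Interval l u c?
        (λ z (p , q , r , t) → ⊔-lub p q , s≤s (⊓-glb t r))
        (λ z p q → ≤-trans (m≤m⊔n x (at β 0)) p , ≤-trans (m≤n⊔m x (at β 0)) p ,
                   ≤-trans (≤-pred q) (m⊓n≤n a y) , ≤-trans (≤-pred q) (m⊓n≤m a y))
      u≤B : u ≤ B
      u≤B = ≤-trans (s≤s (m⊓n≤n a y)) (bd 0 (s≤s z≤n))
      T : ℕ → ℤ
      T w = ΣI x α β (λ γ → Q (w ℕ.+ size γ))
      factor : ∀ z → ΣB R (λ γ → when (c? z ×-dec int? x α β γ) (Q ((a ⊔ y) ℕ.+ (z ℕ.+ size γ)))) ≡ when (c? z) (T ((a ⊔ y) ℕ.+ z))
      factor z = sym (trans (when-ΣB R (c? z) _) (ΣB-cong R (λ γ → trans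
        (when-× (c? z) (int? x α β γ) (c? z ×-dec int? x α β γ) _,_ (λ p → p))
        (cong (λ s → when (c? z ×-dec int? x α β γ) (Q s)) (+-assoc (a ⊔ y) z (size γ))))))
      unfactor : ∀ z → _ ≡ _
      unfactor z = trans (when-ΣB R (c? z) _) (ΣB-cong R (λ γ →
        when-× (c? z) (int? x α β γ) (c? z ×-dec int? x α β γ) _,_ (λ p → p)))
      step : ∀ z → C z → T ((a ⊔ y) ℕ.+ (l ℕ.+ (u ∸ suc z))) ≡ ΣI x α β (λ γ → Q (a ℕ.+ (x ℕ.+ size α) ℕ.+ (y ℕ.+ size β) ∸ (z ℕ.+ size γ)))
      step z (p , q , r , t) = begin
        ΣI x α β (λ γ → Q ((a ⊔ y) ℕ.+ (l ℕ.+ (a ⊓ y ∸ z)) ℕ.+ size γ))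
          ≡⟨ ΣI-cong x α β (λ γ _ → cong Q (e₁ (size γ))) ⟩
        ΣI x α β (λ γ → Q ((a ℕ.+ y ∸ z) ℕ.+ (l ℕ.+ size γ)))
          ≡⟨ bender-knuth x α β (λ w → Q ((a ℕ.+ y ∸ z) ℕ.+ w)) (λ s s<R → bd (suc s) (s≤s s<R)) ⟩
        ΣI x α β (λ γ → Q ((a ℕ.+ y ∸ z) ℕ.+ (x ℕ.+ size α ℕ.+ size β ∸ size γ)))
          ≡⟨ ΣI-cong x α β (λ γ i → cong Q (e₂ (size γ) (≤-trans (int-size x α β γ i) (m≤n+m (size β) (x ℕ.+ size α))))) ⟩
        ΣI x α β (λ γ → Q (a ℕ.+ (x ℕ.+ size α) ℕ.+ (y ℕ.+ size β) ∸ (z ℕ.+ size γ))) ∎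
        where
        e₁ : ∀ w → (a ⊔ y) ℕ.+ (l ℕ.+ (a ⊓ y ∸ z)) ℕ.+ w ≡ (a ℕ.+ y ∸ z) ℕ.+ (l ℕ.+ w)
        e₁ w = begin
          (a ⊔ y) ℕ.+ (l ℕ.+ (a ⊓ y ∸ z)) ℕ.+ w ≡⟨ ar (a ⊔ y) l (a ⊓ y ∸ z) w ⟩
          (a ⊔ y) ℕ.+ (a ⊓ y ∸ z) ℕ.+ (l ℕ.+ w) ≡⟨ cong (ℕ._+ (l ℕ.+ w)) (sym (+-∸-assoc (a ⊔ y) (⊓-glb t r))) ⟩
          ((a ⊔ y) ℕ.+ (a ⊓ y) ∸ z) ℕ.+ (l ℕ.+ w) ≡⟨ cong (λ v → (v ∸ z) ℕ.+ (l ℕ.+ w)) (max+min a y) ⟩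
          (a ℕ.+ y ∸ z) ℕ.+ (l ℕ.+ w) ∎
          where
          ar : ∀ p q r s → p ℕ.+ (q ℕ.+ r) ℕ.+ s ≡ p ℕ.+ r ℕ.+ (q ℕ.+ s)
          ar = solveℕ
          max+min : ∀ p q → (p ⊔ q) ℕ.+ (p ⊓ q) ≡ p ℕ.+ q
          max+min p q with ≤-total p q
          ... | inj₁ p≤q rewrite m≤n⇒m⊔n≡n p≤q | m≤n⇒m⊓n≡m p≤q = +-comm q p
          ... | inj₂ q≤p rewrite m≥n⇒m⊔n≡m q≤p | m≥n⇒m⊓n≡n q≤p = refl
        e₂ : ∀ w → w ≤ x ℕ.+ size α ℕ.+ size β → (a ℕ.+ y ∸ z) ℕ.+ (x ℕ.+ size α ℕ.+ size β ∸ w) ≡ a ℕ.+ (x ℕ.+ size α) ℕ.+ (y ℕ.+ size β) ∸ (z ℕ.+ w)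
        e₂ w w≤ = begin
          (a ℕ.+ y ∸ z) ℕ.+ (x ℕ.+ size α ℕ.+ size β ∸ w) ≡⟨ sym (+-∸-assoc (a ℕ.+ y ∸ z) w≤) ⟩
          (a ℕ.+ y ∸ z) ℕ.+ (x ℕ.+ size α ℕ.+ size β) ∸ w ≡⟨ cong (_∸ w) (sym (+-∸-comm (x ℕ.+ size α ℕ.+ size β) (≤-trans t (m≤m+n a y)))) ⟩
          a ℕ.+ y ℕ.+ (x ℕ.+ size α ℕ.+ size β) ∸ z ∸ w ≡⟨ ∸-+-assoc (a ℕ.+ y ℕ.+ (x ℕ.+ size α ℕ.+ size β)) z w ⟩
          a ℕ.+ y ℕ.+ (x ℕ.+ size α ℕ.+ size β) ∸ (z ℕ.+ w) ≡⟨ cong (_∸ (z ℕ.+ w)) (ar a y (x ℕ.+ size α) (size β)) ⟩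
          a ℕ.+ (x ℕ.+ size α) ℕ.+ (y ℕ.+ size β) ∸ (z ℕ.+ w) ∎
          where
          ar : ∀ p q r s → p ℕ.+ q ℕ.+ (r ℕ.+ s) ≡ p ℕ.+ r ℕ.+ (q ℕ.+ s)
          ar = solveℕ

  when-Σ< : ∀ n {A : Set} (a? : Dec A) (F : ℕ → ℤ) → when a? (Σ< n F) ≡ Σ< n (λ k → when a? (F k))
  when-Σ< n (yes _) F = refl
  when-Σ< n (no _) F = sym (Σ<-0 n)

  module Layers (B : ℕ) where
    open Box B
    open IntAt

    ΣI-- : ∀ {R} a (α β : Vec ℕ R) (F G : Vec ℕ R → ℤ) → ΣI a α β (λ γ → F γ - G γ) ≡ ΣI a α β F - ΣI a α β G
    ΣI-- {R} a α β F G = trans (ΣB-cong R (λ γ → when-- (int? a α β γ) (F γ) (G γ)))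
      (ΣB-- R (λ γ → when (int? a α β γ) (F γ)) (λ γ → when (int? a α β γ) (G γ)))

    -- In the rows before r, α and β coincide; γ is pinned there and merely shifts the argument of
    -- Q. At row r, `bender-knuth` for the later rows turns the second term into Q at the offset l =
    -- x ⊔ at β 0, and the difference between Q at y and Q at l telescopes over the values that row
    -- r of γ may take below y.
    two-layers : ∀ {R} r a (α β : Vec ℕ R) (Q : ℕ → ℤ) → r < R → (∀ s → s < r → at α s ≡ at β s) → at α r ≤ at β r →
      (∀ s → s ≤ r → at β (suc s) ≤ at β s) → at β 0 ≤ a → (∀ s → s < R → at β s < B) →
      ΣB R (λ γ → when (int? a α β γ ×-dec (at γ r ℕ.≟ at β r)) (Q (size γ) - Q (size α ℕ.+ size β ∸ size γ)))
      ≡ ΣB R (λ γ → when (int? a α β γ ×-dec (at γ r ℕ.<? at β r)) (Q (suc (size γ)) - Q (size γ)))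
    two-layers {suc R} zero a (x ∷ α) (y ∷ β) Q _ pin x≤y anti y≤a bd = begin
      Σ< B (λ z → ΣB R (λ γ → when ((c? z ×-dec int? x α β γ) ×-dec (z ℕ.≟ y)) (E z γ)))
        ≡⟨ Σ<-single B _ y (bd 0 (s≤s z≤n)) (λ z z≢y → ΣB-zero R (λ γ → when-no ((c? z ×-dec int? x α β γ) ×-dec (z ℕ.≟ y)) (z≢y ∘ proj₂))) ⟩
      ΣB R (λ γ → when ((c? y ×-dec int? x α β γ) ×-dec (y ℕ.≟ y)) (E y γ))
        ≡⟨ ΣB-cong R (λ γ → when-cong ((c? y ×-dec int? x α β γ) ×-dec (y ℕ.≟ y)) (int? x α β γ) (proj₂ ∘ proj₁)
             (λ i → ((x≤y , anti 0 z≤n , ≤-refl , y≤a) , i) , refl) (λ _ → cong (λ w → Q (y ℕ.+ size γ) - Q w) (cancel (size γ)))) ⟩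
      ΣI x α β (λ γ → Q (y ℕ.+ size γ) - Q (x ℕ.+ size α ℕ.+ size β ∸ size γ)) ≡⟨ ΣI-- x α β _ _ ⟩
      ΣI x α β (λ γ → Q (y ℕ.+ size γ)) - ΣI x α β (λ γ → Q (x ℕ.+ size α ℕ.+ size β ∸ size γ))
        ≡⟨ cong (λ w → ΣI x α β (λ γ → Q (y ℕ.+ size γ)) - w) (sym (bender-knuth x α β Q (λ s s<R → bd (suc s) (s≤s s<R)))) ⟩
      ΣI x α β (λ γ → Q (y ℕ.+ size γ)) - ΣI x α β (λ γ → Q (l ℕ.+ size γ)) ≡⟨ sym (ΣI-- x α β _ _) ⟩
      ΣI x α β (λ γ → Q (y ℕ.+ size γ) - Q (l ℕ.+ size γ))
        ≡⟨ ΣI-cong x α β (λ γ _ → sym (telescope B (λ z → Q (z ℕ.+ size γ)) (⊔-lub x≤y (anti 0 z≤n)) (<⇒≤ (bd 0 (s≤s z≤n))))) ⟩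
      ΣI x α β (λ γ → Σ< B (λ z → when (d? z) (Q (suc (z ℕ.+ size γ)) - Q (z ℕ.+ size γ))))
        ≡⟨ ΣB-cong R (λ γ → when-Σ< B (int? x α β γ) _) ⟩
      ΣB R (λ γ → Σ< B (λ z → when (int? x α β γ) (when (d? z) (Q (suc (z ℕ.+ size γ)) - Q (z ℕ.+ size γ)))))
        ≡⟨ ΣB-Σ< R B _ ⟩
      Σ< B (λ z → ΣB R (λ γ → when (int? x α β γ) (when (d? z) (Q (suc (z ℕ.+ size γ)) - Q (z ℕ.+ size γ)))))
        ≡⟨ Σ<-cong B (λ z _ → ΣB-cong R (λ γ → when-× (int? x α β γ) (d? z) ((c? z ×-dec int? x α β γ) ×-dec (z ℕ.<? y))
             (λ i (c , lt) → (c , i) , lt) (λ ((c , i) , lt) → i , (c , lt)))) ⟩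
      Σ< B (λ z → ΣB R (λ γ → when ((c? z ×-dec int? x α β γ) ×-dec (z ℕ.<? y)) (Q (suc (z ℕ.+ size γ)) - Q (z ℕ.+ size γ)))) ∎
      where
      C : ℕ → Set
      C z = x ≤ z × at β 0 ≤ z × z ≤ y × z ≤ a
      c? : ∀ z → Dec (C z)
      c? z = (x ℕ.≤? z) ×-dec (at β 0 ℕ.≤? z) ×-dec (z ℕ.≤? y) ×-dec (z ℕ.≤? a)
      d? : ∀ z → Dec (C z × z < y)
      d? z = c? z ×-dec (z ℕ.<? y)
      l : ℕ
      l = x ⊔ at β 0
      E : ℕ → Vec ℕ R → ℤ
      E z γ = Q (z ℕ.+ size γ) - Q ((x ℕ.+ size α) ℕ.+ (y ℕ.+ size β) ∸ (z ℕ.+ size γ))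
      open Interval l y d?
        (λ z ((p , q , _) , lt) → ⊔-lub p q , lt)
        (λ z p q → (≤-trans (m≤m⊔n x (at β 0)) p , ≤-trans (m≤n⊔m x (at β 0)) p , <⇒≤ q , ≤-trans (<⇒≤ q) y≤a) , q)
      cancel : ∀ w → (x ℕ.+ size α) ℕ.+ (y ℕ.+ size β) ∸ (y ℕ.+ w) ≡ x ℕ.+ size α ℕ.+ size β ∸ w
      cancel w = trans (cong (_∸ (y ℕ.+ w)) (trans (sym (+-assoc (x ℕ.+ size α) y (size β)))
        (trans (cong (ℕ._+ size β) (+-comm (x ℕ.+ size α) y)) (+-assoc y (x ℕ.+ size α) (size β)))))
        ([m+n]∸[m+o]≡n∸o y (x ℕ.+ size α ℕ.+ size β) w)
    two-layers {suc R} (suc r) a (x ∷ α) (y ∷ β) Q (s≤s r<R) pin le anti y≤a bd with pin 0 (s≤s z≤n)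
    ... | refl = begin
      Σ< B (λ z → ΣB R (λ γ → when ((c? z ×-dec int? x α β γ) ×-dec (at γ r ℕ.≟ at β r)) (E z γ)))
        ≡⟨ Σ<-single B _ x (bd 0 (s≤s z≤n)) (λ z z≢x → ΣB-zero R (λ γ → when-no ((c? z ×-dec int? x α β γ) ×-dec (at γ r ℕ.≟ at β r)) (λ ((c , _) , _) → pinned z≢x c))) ⟩
      ΣB R (λ γ → when ((c? x ×-dec int? x α β γ) ×-dec (at γ r ℕ.≟ at β r)) (E x γ))
        ≡⟨ ΣB-cong R (λ γ → when-cong ((c? x ×-dec int? x α β γ) ×-dec (at γ r ℕ.≟ at β r)) (int? x α β γ ×-dec (at γ r ℕ.≟ at β r))
             (λ ((_ , i) , e) → i , e) (λ (i , e) → (cx , i) , e)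
             (λ ((_ , i) , _) → cong (λ w → Q (x ℕ.+ size γ) - Q w) (cancel (size γ) (≤-trans (int-size x α β γ i) (m≤n+m (size β) (size α)))))) ⟩
      ΣB R (λ γ → when (int? x α β γ ×-dec (at γ r ℕ.≟ at β r)) (Q (x ℕ.+ size γ) - Q (x ℕ.+ (size α ℕ.+ size β ∸ size γ))))
        ≡⟨ two-layers r x α β (λ w → Q (x ℕ.+ w)) r<R (λ s s<r → pin (suc s) (s≤s s<r)) le (λ s s≤r → anti (suc s) (s≤s s≤r)) (anti 0 z≤n) (λ s s<R → bd (suc s) (s≤s s<R)) ⟩
      ΣB R (λ γ → when (int? x α β γ ×-dec (at γ r ℕ.<? at β r)) (Q (x ℕ.+ suc (size γ)) - Q (x ℕ.+ size γ)))
        ≡⟨ ΣB-cong R (λ γ → when-cong (int? x α β γ ×-dec (at γ r ℕ.<? at β r)) ((c? x ×-dec int? x α β γ) ×-dec (at γ r ℕ.<? at β r))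
             (λ (i , e) → (cx , i) , e) (λ ((_ , i) , e) → i , e) (λ _ → cong (λ w → Q w - Q (x ℕ.+ size γ)) (+-suc x (size γ)))) ⟩
      ΣB R (λ γ → when ((c? x ×-dec int? x α β γ) ×-dec (at γ r ℕ.<? at β r)) (Q (suc (x ℕ.+ size γ)) - Q (x ℕ.+ size γ)))
        ≡⟨ sym (Σ<-single B _ x (bd 0 (s≤s z≤n)) (λ z z≢x → ΣB-zero R (λ γ → when-no ((c? z ×-dec int? x α β γ) ×-dec (at γ r ℕ.<? at β r)) (λ ((c , _) , _) → pinned z≢x c)))) ⟩
      Σ< B (λ z → ΣB R (λ γ → when ((c? z ×-dec int? x α β γ) ×-dec (at γ r ℕ.<? at β r)) (Q (suc (z ℕ.+ size γ)) - Q (z ℕ.+ size γ)))) ∎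
      where
      C : ℕ → Set
      C z = x ≤ z × at β 0 ≤ z × z ≤ x × z ≤ a
      c? : ∀ z → Dec (C z)
      c? z = (x ℕ.≤? z) ×-dec (at β 0 ℕ.≤? z) ×-dec (z ℕ.≤? x) ×-dec (z ℕ.≤? a)
      pinned : ∀ {z} → z ≢ x → ¬ C z
      pinned z≢x (p , _ , q , _) = z≢x (≤-antisym q p)
      cx : C x
      cx = ≤-refl , anti 0 z≤n , ≤-refl , y≤a
      E : ℕ → Vec ℕ R → ℤ
      E z γ = Q (z ℕ.+ size γ) - Q ((x ℕ.+ size α) ℕ.+ (x ℕ.+ size β) ∸ (z ℕ.+ size γ))
      cancel : ∀ w → w ≤ size α ℕ.+ size β → (x ℕ.+ size α) ℕ.+ (x ℕ.+ size β) ∸ (x ℕ.+ w) ≡ x ℕ.+ (size α ℕ.+ size β ∸ w)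
      cancel w w≤ = trans (cong (_∸ (x ℕ.+ w)) (trans (+-assoc x (size α) (x ℕ.+ size β)) (cong (x ℕ.+_)
          (trans (sym (+-assoc (size α) x (size β))) (trans (cong (ℕ._+ size β) (+-comm (size α) x)) (+-assoc x (size α) (size β)))))))
        (trans ([m+n]∸[m+o]≡n∸o x (x ℕ.+ (size α ℕ.+ size β)) w) (+-∸-assoc x w≤))

  -- One layer of a flagged Gelfand–Tsetlin pattern: row s of the tableau has at α s entries < t and at β s entries ≤ t.
  record Step {R} (μ g : ℕ → ℕ) (t : ℕ) (α β : Vec ℕ R) : Set where
    constructor mkStep
    field
      grow : ∀ s → at α s ≤ at β s
      fit : ∀ s → at β s ≤ μ s
      strip : ∀ s → at β (suc s) ≤ at α s
      full : ∀ s → s < R → g s ≤ t → at β s ≡ μ s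
  open Step public

  step? : ∀ {R} μ g t (α β : Vec ℕ R) → Dec (Step μ g t α β)
  step? {R} μ g t α β = map′ to from (ℕₚ.allUpTo? (λ s → (at α s ℕ.≤? at β s) ×-dec (at β s ℕ.≤? μ s) ×-dec (at β (suc s) ℕ.≤? at α s) ×-dec ((g s ℕ.≤? t) →-dec (at β s ℕ.≟ μ s))) R)
    where
    Row : ℕ → Set
    Row s = at α s ≤ at β s × at β s ≤ μ s × at β (suc s) ≤ at α s × (g s ≤ t → at β s ≡ μ s)
    to : (∀ {s} → s < R → Row s) → Step μ g t α β
    to h = mkStep
      (λ s → extend s (λ lt → proj₁ (h lt)) (λ ge → subst (_≤ at β s) (sym (at-beyond α s ge)) z≤n))
      (λ s → extend s (λ lt → proj₁ (proj₂ (h lt))) (λ ge → subst (_≤ μ s) (sym (at-beyond β s ge)) z≤n))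
      (λ s → extend s (λ lt → proj₁ (proj₂ (proj₂ (h lt)))) (λ ge → subst (_≤ at α s) (sym (at-beyond β (suc s) (m≤n⇒m≤1+n ge))) z≤n))
      (λ s lt → proj₂ (proj₂ (proj₂ (h lt))))
      where
      extend : ∀ {A : Set} s → (s < R → A) → (R ≤ s → A) → A
      extend s p q with s ℕ.<? R
      ... | yes lt = p lt
      ... | no ≮ = q (≮⇒≥ ≮)
    from : Step μ g t α β → ∀ {s} → s < R → Row s
    from st {s} lt = grow st s , fit st s , strip st s , full st s lt

  module Chains (B R : ℕ) where
    open Box B
    open Layers B
    open IntAt

    -- The sum of φ over the contents of all chains of k further layers on top of α. The growth of
    -- the size in a layer is the number of entries t, that is, the exponent of the variable t.
    S : (μ g : ℕ → ℕ) (k t : ℕ) → Vec ℕ R → Functional k → ℤ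
    S μ g zero t α φ = φ []
    S μ g (suc k) t α φ = ΣB R (λ β → when (step? μ g t α β) (S μ g k (suc t) β (λ v → φ (size β ∸ size α ∷ v))))

    S-cong : ∀ μ g k t α {φ ψ} → (∀ v → φ v ≡ ψ v) → S μ g k t α φ ≡ S μ g k t α ψ
    S-cong μ g zero t α e = e []
    S-cong μ g (suc k) t α e = ΣB-cong R (λ β → cong (when (step? μ g t α β)) (S-cong μ g k (suc t) β (λ v → e _)))

    S-0 : ∀ μ g k t α → S μ g k t α (λ _ → 0ℤ) ≡ 0ℤ
    S-0 μ g zero t α = refl
    S-0 μ g (suc k) t α = ΣB-zero R (λ β → when-0 (step? μ g t α β) (λ _ → S-0 μ g k (suc t) β))

    S-+ : ∀ μ g k t α φ ψ → S μ g k t α (λ v → φ v + ψ v) ≡ S μ g k t α φ + S μ g k t α ψ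
    S-+ μ g zero t α φ ψ = refl
    S-+ μ g (suc k) t α φ ψ = trans (ΣB-cong R (λ β → trans (cong (when (step? μ g t α β)) (S-+ μ g k (suc t) β _ _)) (when-+ (step? μ g t α β) _ _))) (ΣB-+ R _ _)

    S-- : ∀ μ g k t α φ ψ → S μ g k t α (λ v → φ v - ψ v) ≡ S μ g k t α φ - S μ g k t α ψ
    S-- μ g zero t α φ ψ = refl
    S-- μ g (suc k) t α φ ψ = trans (ΣB-cong R (λ β → trans (cong (when (step? μ g t α β)) (S-- μ g k (suc t) β _ _)) (when-- (step? μ g t α β) _ _))) (ΣB-- R _ _)

    S-Σ : ∀ μ g k t α n (φ : ℕ → Functional k) → S μ g k t α (λ v → Σ< n (λ x → φ x v)) ≡ Σ< n (λ x → S μ g k t α (φ x))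
    S-Σ μ g k t α zero φ = S-0 μ g k t α
    S-Σ μ g k t α (suc n) φ = trans (S-+ μ g k t α _ (φ n)) (cong (_+ S μ g k t α (φ n)) (S-Σ μ g k t α n φ))

    S-δ : ∀ μ g k t α (φ : ℕ → ℕ → Functional k) a b → S μ g k t α (λ v → δ (λ x y → φ x y v) a b) ≡ δ (λ x y → S μ g k t α (φ x y)) a b
    S-δ μ g k t α φ a b = trans (S-- μ g k t α _ _) (cong₂ _-_ (S-Σ μ g k t α a _) (S-Σ μ g k t α b _))

    -- By column strictness row s + 1 + y has at most `at α s` cells once the entries up to t + y
    -- are placed, but its flag demands that it be complete by then. If the layers run out earlier,
    -- row s + 1 must already be complete, with the same contradiction.
    dead : ∀ μ g → (∀ s → μ (suc s) ≤ μ s) → ∀ k t → (∀ s → g s ≤ t ℕ.+ k) → ∀ α s y φ → s ℕ.+ suc y < R →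
      at α s < μ (s ℕ.+ suc y) → g (s ℕ.+ suc y) ≤ t ℕ.+ y → S μ g (suc k) t α φ ≡ 0ℤ
    dead μ g anti k t gt α s y φ s+y<R short flag = ΣB-zero R (λ β → when-0 (step? μ g t α β) (λ st → ⊥-or-rec y k (λ v → φ (size β ∸ size α ∷ v)) β st s+y<R short flag gt))
      where
      μ-anti : ∀ s y → μ (s ℕ.+ y) ≤ μ s
      μ-anti s zero = ≤-reflexive (cong μ (+-identityʳ s))
      μ-anti s (suc y) = ≤-trans (≤-reflexive (cong μ (+-suc s y))) (≤-trans (anti (s ℕ.+ y)) (μ-anti s y))
      next<R : ∀ y → s ℕ.+ suc y < R → suc s < R
      next<R y lt = ≤-<-trans (subst (suc s ≤_) (sym (+-suc s y)) (s≤s (m≤m+n s y))) lt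
      absurd : ∀ y β → Step μ g t α β → at α s < μ (s ℕ.+ suc y) → at β (suc s) ≢ μ (suc s)
      absurd y β st short e = <⇒≱ short (≤-trans (≤-trans (≤-reflexive (cong μ (+-suc s y))) (μ-anti (suc s) y))
        (≤-trans (≤-reflexive (sym e)) (strip st s)))
      ⊥-or-rec : ∀ y k (φ : Functional k) β → Step μ g t α β → s ℕ.+ suc y < R → at α s < μ (s ℕ.+ suc y) → g (s ℕ.+ suc y) ≤ t ℕ.+ y →
        (∀ s → g s ≤ t ℕ.+ k) → S μ g k (suc t) β φ ≡ 0ℤ
      ⊥-or-rec zero k φ β st lt short flag gt = ⊥-elim (absurd zero β st short (full st (suc s) (next<R zero lt)
        (subst₂ (λ a b → g a ≤ b) (trans (+-suc s 0) (cong suc (+-identityʳ s))) (+-identityʳ t) flag)))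
      ⊥-or-rec (suc y) zero φ β st lt short flag gt = ⊥-elim (absurd (suc y) β st short (full st (suc s) (next<R (suc y) lt)
        (subst (g (suc s) ≤_) (+-identityʳ t) (gt (suc s)))))
      ⊥-or-rec (suc y) (suc k) φ β st lt short flag gt = dead μ g anti k (suc t) (λ s → subst (g s ≤_) (+-suc t k) (gt s)) β (suc s) y φ
        (subst (_< R) (+-suc s (suc y)) lt)
        (≤-<-trans (strip st s) (subst (λ a → at α s < μ a) (+-suc s (suc y)) short))
        (subst₂ (λ a b → g a ≤ b) (+-suc s (suc y)) (+-suc t y) flag)

    -- By column strictness a later row of the same length forces the lower flag.
    reflag : ∀ μ g g′ → (∀ s → μ (suc s) ≤ μ s) → (∀ s → s < R → 0 < μ s → g′ s ≤ g s) →
      (∀ s → s < R → 0 < μ s → ∃[ y ] (s ℕ.+ y < R × μ (s ℕ.+ y) ≡ μ s × g (s ℕ.+ y) ≤ g′ s ℕ.+ y)) →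
      ∀ k t → (∀ s → g s < t ℕ.+ k) → ∀ α φ → S μ g k t α φ ≡ S μ g′ k t α φ
    reflag μ g g′ anti g′≤g force zero t gt α φ = refl
    reflag μ g g′ anti g′≤g force (suc k) t gt α φ = ΣB-cong R (λ β → term β (step? μ g t α β) (step? μ g′ t α β))
      where
      gt′ : ∀ s → g s < suc t ℕ.+ k
      gt′ s = subst (g s <_) (+-suc t k) (gt s)
      deadβ : ∀ k β s {φ : Functional k} → (∀ s → g s < suc t ℕ.+ k) → s < R → g′ s ≤ t → at β s < μ s → Step μ g t α β → S μ g k (suc t) β φ ≡ 0ℤ
      deadβ k β s gt s<R flag short st with force s s<R (≤-<-trans z≤n short)
      ... | zero , _ , _ , le = ⊥-elim (<-irrefl (full st s s<R (≤-trans (subst₂ (λ a b → g a ≤ b) (+-identityʳ s) (+-identityʳ (g′ s)) le) flag)) short)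
      deadβ zero β s gt s<R flag short st | suc y , _ , _ , _ =
        ⊥-elim (<-irrefl (full st s s<R (subst (g s ≤_) (+-identityʳ t) (≤-pred (gt s)))) short)
      deadβ (suc k) β s {φ} gt s<R flag short st | suc y , lt , e , le = dead μ g anti k (suc t)
        (λ s → ≤-pred (subst (g s <_) (+-suc (suc t) k) (gt s))) β s y φ lt (subst (at β s <_) (sym e) short)
        (≤-trans le (≤-trans (+-monoˡ-≤ (suc y) flag) (≤-reflexive (+-suc t y))))
      term : ∀ β (d : Dec (Step μ g t α β)) (d′ : Dec (Step μ g′ t α β)) →
        when d (S μ g k (suc t) β (λ v → φ (size β ∸ size α ∷ v))) ≡ when d′ (S μ g′ k (suc t) β (λ v → φ (size β ∸ size α ∷ v)))
      term β (yes _) (yes _) = reflag μ g g′ anti g′≤g force k (suc t) gt′ β _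
      term β (no _) (no _) = refl
      term β (no ¬st) (yes st) = ⊥-elim (¬st (mkStep (grow st) (fit st) (strip st) full′))
        where
        full′ : ∀ s → s < R → g s ≤ t → at β s ≡ μ s
        full′ s lt le with 0 ℕ.<? μ s
        ... | yes pos = full st s lt (≤-trans (g′≤g s lt pos) le)
        ... | no ¬pos = ≤-antisym (fit st s) (≤-trans (≮⇒≥ ¬pos) z≤n)
      term β (yes st) (no ¬st) with ℕₚ.anyUpTo? (λ s → (g′ s ℕ.≤? t) ×-dec ¬? (at β s ℕ.≟ μ s)) R
      ... | yes (s , s<R , flag , ne) = deadβ k β s gt′ s<R flag (≤∧≢⇒< (fit st s) ne) st
      ... | no none = ⊥-elim (¬st (mkStep (grow st) (fit st) (strip st) full′))
        where
        full′ : ∀ s → s < R → g′ s ≤ t → at β s ≡ μ s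
        full′ s lt le with at β s ℕ.≟ μ s
        ... | yes e = e
        ... | no ne = ⊥-elim (none (s , lt , le , ne))

  -- Row r of length m with flag i + 1 (data w) against length m + 1 with flag i (data u); the other rows agree.
  record Raising (R : ℕ) (μᵘ μʷ gᵘ gʷ : ℕ → ℕ) (r i m : ℕ) : Set where
    field
      r<R : r < R
      μᵘ-r : μᵘ r ≡ suc m
      μʷ-r : μʷ r ≡ m
      μ-other : ∀ s → s ≢ r → μᵘ s ≡ μʷ s
      μᵘ-anti : ∀ s → μᵘ (suc s) ≤ μᵘ s
      μʷ-next : μʷ (suc r) ≤ m
      gᵘ-r : gᵘ r ≡ i
      gʷ-r : gʷ r ≡ suc i
      g-other : ∀ s → s ≢ r → gᵘ s ≡ gʷ s
      g-above : ∀ s → s < r → gʷ s < i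
      g-below : ∀ s → r < s → i < gʷ s

  module Raise (B R : ℕ) {μᵘ μʷ gᵘ gʷ : ℕ → ℕ} {r i m : ℕ} (raising : Raising R μᵘ μʷ gᵘ gʷ r i m) (bd : ∀ s → μᵘ s < B) where
    open Raising raising
    open Box B
    open Layers B
    open IntAt
    open Chains B R

    m<B : suc m < B
    m<B = subst (_< B) μᵘ-r (bd r)

    μʷ≤μᵘ : ∀ s → μʷ s ≤ μᵘ s
    μʷ≤μᵘ s with s ℕ.≟ r
    ... | yes refl = subst₂ _≤_ (sym μʷ-r) (sym μᵘ-r) (n≤1+n m)
    ... | no ne = ≤-reflexive (sym (μ-other s ne))

    μᵘ-next : μᵘ (suc r) ≤ m
    μᵘ-next = subst (_≤ m) (sym (μ-other (suc r) (λ e → <-irrefl (sym e) ≤-refl))) μʷ-next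

    μʷ-prev : ∀ s → suc s ≡ r → suc m ≤ μʷ s
    μʷ-prev s refl = subst (suc m ≤_) (μ-other s (λ e → <-irrefl e ≤-refl)) (subst (_≤ μᵘ s) μᵘ-r (μᵘ-anti s))

    -- The rows before r have flags below i, hence are complete when the entries i start to be
    -- placed.
    Full : Vec ℕ R → Set
    Full α = ∀ s → s < r → at α s ≡ μʷ s

    <r⇒≢ : ∀ {s} → s < r → s ≢ r
    <r⇒≢ lt refl = <-irrefl refl lt

    <r⇒<R : ∀ {s} → s < r → s < R
    <r⇒<R lt = <-trans lt r<R

    step-full : ∀ {t α β} → i ≤ suc t → Step μʷ gʷ t α β → Full β
    step-full le st s s<r = full st s (<r⇒<R s<r) (≤-pred (≤-trans (g-above s s<r) le))

    step-fullᵘ : ∀ {t α β} → i ≤ suc t → Step μᵘ gᵘ t α β → Full β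
    step-fullᵘ le st s s<r = trans (full st s (<r⇒<R s<r) (subst (_≤ _) (sym (g-other s (<r⇒≢ s<r))) (≤-pred (≤-trans (g-above s s<r) le)))) (μ-other s (<r⇒≢ s<r))

    -- Relates corresponding layers after the entries i + 1 are placed: row r is complete on both
    -- sides, and w lacks its last cell.
    record Cut (v w : Vec ℕ R) : Set where
      constructor cut
      field
        v-r : at v r ≡ suc m
        w-r : at w r ≡ m
        other : ∀ s → s ≢ r → at v s ≡ at w s
    open Cut

    cut-size : ∀ {v w} → Cut v w → size v ≡ suc (size w)
    cut-size {v} {w} c = +-cancelˡ-≡ m _ _ (trans (cong (ℕ._+ size v) (sym (w-r c)))
      (trans (size-exchange r v w r<R (other c)) (trans (cong (ℕ._+ size w) (v-r c)) (sym (+-suc m (size w))))))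

    step-cut : ∀ {t α α′ β β′} → suc i ≤ t → Cut α α′ → Cut β β′ → Step μᵘ gᵘ t α β → Step μʷ gʷ t α′ β′
    step-cut {t} {α} {α′} {β} {β′} i<t cα cβ st = mkStep grow′ fit′ strip′ full′
      where
      grow′ : ∀ s → at α′ s ≤ at β′ s
      grow′ s with s ℕ.≟ r
      ... | yes refl = ≤-reflexive (trans (w-r cα) (sym (w-r cβ)))
      ... | no ne = subst₂ _≤_ (other cα s ne) (other cβ s ne) (grow st s)
      fit′ : ∀ s → at β′ s ≤ μʷ s
      fit′ s with s ℕ.≟ r
      ... | yes refl = ≤-reflexive (trans (w-r cβ) (sym μʷ-r))
      ... | no ne = subst₂ _≤_ (other cβ s ne) (μ-other s ne) (fit st s)
      strip′ : ∀ s → at β′ (suc s) ≤ at α′ s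
      strip′ s with s ℕ.≟ r | suc s ℕ.≟ r
      ... | yes refl | yes ()
      ... | yes refl | no ne = ≤-trans (≤-reflexive (sym (other cβ (suc s) ne))) (≤-trans (fit st (suc s)) (≤-trans μᵘ-next (≤-reflexive (sym (w-r cα)))))
      ... | no ne | yes refl = ≤-trans (≤-trans (≤-reflexive (w-r cβ)) (n≤1+n m))
        (≤-trans (≤-reflexive (sym (v-r cβ))) (≤-trans (strip st s) (≤-reflexive (other cα s ne))))
      ... | no ne | no ne′ = subst₂ _≤_ (other cβ (suc s) ne′) (other cα s ne) (strip st s)
      full′ : ∀ s → s < R → gʷ s ≤ t → at β′ s ≡ μʷ s
      full′ s lt le with s ℕ.≟ r
      ... | yes refl = trans (w-r cβ) (sym μʷ-r)
      ... | no ne = trans (sym (other cβ s ne)) (trans (full st s lt (subst (_≤ t) (sym (g-other s ne)) le)) (μ-other s ne))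

    -- The restored cell respects column strictness because row r - 1 of α is complete by `Full α`
    -- and longer than m.
    step-uncut : ∀ {t α α′ β β′} → Full α → Cut α α′ → Cut β β′ → Step μʷ gʷ t α′ β′ → Step μᵘ gᵘ t α β
    step-uncut {t} {α} {α′} {β} {β′} fα cα cβ st = mkStep grow′ fit′ strip′ full′
      where
      grow′ : ∀ s → at α s ≤ at β s
      grow′ s with s ℕ.≟ r
      ... | yes refl = ≤-reflexive (trans (v-r cα) (sym (v-r cβ)))
      ... | no ne = subst₂ _≤_ (sym (other cα s ne)) (sym (other cβ s ne)) (grow st s)
      fit′ : ∀ s → at β s ≤ μᵘ s
      fit′ s with s ℕ.≟ r
      ... | yes refl = ≤-reflexive (trans (v-r cβ) (sym μᵘ-r))
      ... | no ne = subst₂ _≤_ (sym (other cβ s ne)) (sym (μ-other s ne)) (fit st s)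
      strip′ : ∀ s → at β (suc s) ≤ at α s
      strip′ s with s ℕ.≟ r | suc s ℕ.≟ r
      ... | yes refl | yes ()
      ... | yes refl | no ne = ≤-trans (≤-reflexive (other cβ (suc s) ne)) (≤-trans (strip st s)
        (≤-trans (≤-reflexive (w-r cα)) (≤-trans (n≤1+n m) (≤-reflexive (sym (v-r cα))))))
      ... | no ne | yes e = ≤-trans (≤-reflexive (trans (cong (at β) e) (v-r cβ)))
        (≤-trans (μʷ-prev s e) (≤-reflexive (sym (fα s (subst (s <_) e ≤-refl)))))
      ... | no ne | no ne′ = subst₂ _≤_ (sym (other cβ (suc s) ne′)) (sym (other cα s ne)) (strip st s)
      full′ : ∀ s → s < R → gᵘ s ≤ t → at β s ≡ μᵘ s
      full′ s lt le with s ℕ.≟ r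
      ... | yes refl = trans (v-r cβ) (sym μᵘ-r)
      ... | no ne = trans (other cβ s ne) (trans (full st s lt (subst (_≤ t) (g-other s ne) le)) (sym (μ-other s ne)))

    -- Beyond entry i + 1 row r stays complete on both sides, so cutting its last cell matches the
    -- layers and leaves all later exponents unchanged.
    suffix : ∀ k t → suc i ≤ t → ∀ α α′ → Cut α α′ → Full α → ∀ φ → S μᵘ gᵘ k t α φ ≡ S μʷ gʷ k t α′ φ
    suffix zero t i<t α α′ c f φ = refl
    suffix (suc k) t i<t α α′ c f φ = ΣB-shift R r (suc m) m _ _ r<R m<B (<-trans ≤-refl m<B)
      (λ β ne → when-no (step? μᵘ gᵘ t α β) (λ st → ne (trans (full st r r<R (subst (_≤ t) (sym gᵘ-r) (<⇒≤ i<t))) μᵘ-r)))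
      (λ β ne → when-no (step? μʷ gʷ t α′ β) (λ st → ne (trans (full st r r<R (subst (_≤ t) (sym gʷ-r) i<t)) μʷ-r)))
      (λ β β′ e e′ o → let cβ = cut e e′ o in when-cong (step? μᵘ gᵘ t α β) (step? μʷ gʷ t α′ β′) (step-cut i<t c cβ) (step-uncut f c cβ)
        (λ st → trans (suffix k (suc t) (m≤n⇒m≤1+n i<t) β β′ cβ (step-fullᵘ (m≤n⇒m≤1+n (<⇒≤ i<t)) st) _)
          (S-cong μʷ gʷ k (suc t) β′ (λ v → cong (λ x → φ (x ∷ v)) (cong₂ _∸_ (cut-size cβ) (cut-size c))))))

    -- The two layers with entries i and i + 1, where ∂ᵢ acts: α lies before them, γ between them
    -- and β after them.
    module Block (k : ℕ) (α : Vec ℕ R) (fα : Full α) (α≤ : at α r ≤ suc m) (φ : Functional (2 ℕ.+ k)) where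

      Φᵘ Φʷ : Vec ℕ R → ℕ → ℕ → ℤ
      Φᵘ β x y = S μᵘ gᵘ k (2 ℕ.+ i) β (λ v → φ (x ∷ y ∷ v))
      Φʷ β x y = S μʷ gʷ k (2 ℕ.+ i) β (λ v → φ (x ∷ y ∷ v))

      -- A step from β to itself expresses just the conditions on β alone, separating them from the
      -- interlacing conditions on γ.
      Final : Vec ℕ R → Set
      Final β = Step μᵘ gᵘ (suc i) β β

      final? : ∀ β → Dec (Final β)
      final? β = step? μᵘ gᵘ (suc i) β β

      -- The cap for row 0 of γ, in place of a preceding row of α.
      a : ℕ
      a = μᵘ 0

      -- On the side of u the flag i completes row r already in γ; this is the equation
      -- `at γ r ≡ at β r`, the remaining conditions being interlacing.
      toᵘ : ∀ {β γ} → Step μᵘ gᵘ i α γ → Step μᵘ gᵘ (suc i) γ β → Final β × (Int a α β γ × at γ r ≡ at β r)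
      toᵘ {β} {γ} s₁ s₂ = mkStep (λ s → ≤-refl) (fit s₂) (λ s → ≤-trans (strip s₂ s) (grow s₂ s)) (full s₂) ,
        int-intro a α β γ (λ s → record { α≤γ = grow s₁ s ; β≤γ = strip s₂ s ; γ≤β = grow s₂ s ; γ≤α = cap s }) ,
        trans (full s₁ r r<R (≤-reflexive gᵘ-r)) (sym (full s₂ r r<R (≤-trans (≤-reflexive gᵘ-r) (n≤1+n i))))
        where
        cap : ∀ s → at γ s ≤ at (a ∷ α) s
        cap zero = fit s₁ 0
        cap (suc s) = strip s₁ s

      fullᵘ : ∀ {β} → Final β → at β r ≡ suc m
      fullᵘ fin = trans (full fin r r<R (≤-trans (≤-reflexive gᵘ-r) (n≤1+n i))) μᵘ-r

      pinned : ∀ {β γ} → Final β → Int a α β γ → ∀ s → s < r → at γ s ≡ μʷ s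
      pinned {β} {γ} fin int s s<r = ≤-antisym (≤-trans (γ≤β (int-elim a α β γ int s)) (≤-trans (fit fin s) (≤-reflexive (μ-other s (<r⇒≢ s<r)))))
        (≤-trans (≤-reflexive (sym (fα s s<r))) (α≤γ (int-elim a α β γ int s)))

      fromᵘ : ∀ {β γ} → Final β × (Int a α β γ × at γ r ≡ at β r) → Step μᵘ gᵘ i α γ × Step μᵘ gᵘ (suc i) γ β
      fromᵘ {β} {γ} (fin , int , e) = mkStep (λ s → α≤γ (I s)) (λ s → ≤-trans (γ≤β (I s)) (fit fin s)) (λ s → γ≤α (I (suc s))) full′ ,
        mkStep (λ s → γ≤β (I s)) (fit fin) (λ s → β≤γ (I s)) (full fin)
        where
        I = int-elim a α β γ int
        full′ : ∀ s → s < R → gᵘ s ≤ i → at γ s ≡ μᵘ s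
        full′ s lt le with <-cmp s r
        ... | tri< s<r ne _ = trans (pinned fin int s s<r) (sym (μ-other s ne))
        ... | tri≈ _ refl _ = trans e (trans (fullᵘ fin) (sym μᵘ-r))
        ... | tri> _ ne r<s = ⊥-elim (<⇒≱ (g-below s r<s) (subst (_≤ i) (g-other s ne) le))

      -- On the side of w row r can hold only m cells, one less than in the uncut β. This becomes
      -- the strict inequality `at γ r < at β r`.
      toʷ : ∀ {β β′ γ} → Cut β β′ → Step μʷ gʷ i α γ → Step μʷ gʷ (suc i) γ β′ → Final β × (Int a α β γ × at γ r < at β r)
      toʷ {β} {β′} {γ} c s₁ s₂ = mkStep (λ s → ≤-refl) fit′ strip′ full′ ,
        int-intro a α β γ (λ s → record { α≤γ = grow s₁ s ; β≤γ = below s ; γ≤β = grow′ s ; γ≤α = cap s }) ,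
        subst₂ _≤_ refl (sym (v-r c)) (s≤s (≤-trans (grow s₂ r) (≤-reflexive (w-r c))))
        where
        fγ : Full γ
        fγ = step-full (n≤1+n i) s₁
        cap : ∀ s → at γ s ≤ at (a ∷ α) s
        cap zero = ≤-trans (fit s₁ 0) (μʷ≤μᵘ 0)
        cap (suc s) = strip s₁ s
        grow′ : ∀ s → at γ s ≤ at β s
        grow′ s with s ℕ.≟ r
        ... | yes refl = ≤-trans (grow s₂ s) (≤-trans (≤-reflexive (w-r c)) (≤-trans (n≤1+n m) (≤-reflexive (sym (v-r c)))))
        ... | no ne = ≤-trans (grow s₂ s) (≤-reflexive (sym (other c s ne)))
        below : ∀ s → at β (suc s) ≤ at γ s
        below s with suc s ℕ.≟ r
        ... | yes e = ≤-trans (≤-reflexive (trans (cong (at β) e) (v-r c))) (≤-trans (μʷ-prev s e) (≤-reflexive (sym (fγ s (subst (s <_) e ≤-refl)))))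
        ... | no ne = ≤-trans (≤-reflexive (other c (suc s) ne)) (strip s₂ s)
        fit′ : ∀ s → at β s ≤ μᵘ s
        fit′ s with s ℕ.≟ r
        ... | yes refl = ≤-reflexive (trans (v-r c) (sym μᵘ-r))
        ... | no ne = subst₂ _≤_ (sym (other c s ne)) (sym (μ-other s ne)) (fit s₂ s)
        strip′ : ∀ s → at β (suc s) ≤ at β s
        strip′ s = ≤-trans (below s) (grow′ s)
        full′ : ∀ s → s < R → gᵘ s ≤ suc i → at β s ≡ μᵘ s
        full′ s lt le with s ℕ.≟ r
        ... | yes refl = trans (v-r c) (sym μᵘ-r)
        ... | no ne = trans (other c s ne) (trans (full s₂ s lt (subst (_≤ suc i) (g-other s ne) le)) (sym (μ-other s ne)))

      fromʷ : ∀ {β β′ γ} → Cut β β′ → Final β × (Int a α β γ × at γ r < at β r) → Step μʷ gʷ i α γ × Step μʷ gʷ (suc i) γ β′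
      fromʷ {β} {β′} {γ} c (fin , int , lt) = mkStep (λ s → α≤γ (I s)) (λ s → ≤-trans (grow′ s) (fit′ s)) (λ s → γ≤α (I (suc s))) full₁ ,
        mkStep grow′ fit′ strip′ full₂
        where
        I = int-elim a α β γ int
        grow′ : ∀ s → at γ s ≤ at β′ s
        grow′ s with s ℕ.≟ r
        ... | yes refl = subst (at γ s ≤_) (sym (w-r c)) (≤-pred (subst (at γ s <_) (v-r c) lt))
        ... | no ne = subst (at γ s ≤_) (other c s ne) (γ≤β (I s))
        fit′ : ∀ s → at β′ s ≤ μʷ s
        fit′ s with s ℕ.≟ r
        ... | yes refl = ≤-reflexive (trans (w-r c) (sym μʷ-r))
        ... | no ne = subst₂ _≤_ (other c s ne) (μ-other s ne) (fit fin s)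
        strip′ : ∀ s → at β′ (suc s) ≤ at γ s
        strip′ s with suc s ℕ.≟ r
        ... | yes refl = ≤-trans (≤-trans (≤-reflexive (w-r c)) (≤-trans (n≤1+n m) (≤-reflexive (sym (v-r c))))) (β≤γ (I s))
        ... | no ne = ≤-trans (≤-reflexive (sym (other c (suc s) ne))) (β≤γ (I s))
        full₁ : ∀ s → s < R → gʷ s ≤ i → at γ s ≡ μʷ s
        full₁ s lt le with <-cmp s r
        ... | tri< s<r ne _ = pinned fin int s s<r
        ... | tri≈ _ refl _ = ⊥-elim (<-irrefl refl (subst (_≤ i) gʷ-r le))
        ... | tri> _ ne r<s = ⊥-elim (<⇒≱ (g-below s r<s) le)
        full₂ : ∀ s → s < R → gʷ s ≤ suc i → at β′ s ≡ μʷ s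
        full₂ s lt le with s ℕ.≟ r
        ... | yes refl = trans (w-r c) (sym μʷ-r)
        ... | no ne = trans (sym (other c s ne)) (trans (full fin s lt (subst (_≤ suc i) (sym (g-other s ne)) le)) (μ-other s ne))

      Fᵘ Fʷ : Vec ℕ R → Vec ℕ R → ℤ
      Fᵘ γ β = when (step? μᵘ gᵘ i α γ) (when (step? μᵘ gᵘ (suc i) γ β) (δ (Φᵘ β) (size γ ∸ size α) (size β ∸ size γ)))
      Fʷ γ β = when (step? μʷ gʷ i α γ) (when (step? μʷ gʷ (suc i) γ β) (Φʷ β (size γ ∸ size α) (size β ∸ size γ)))

      -- For fixed β the divided difference is a difference of two values of the antiderivative Q,
      -- and a single value of `Φʷ` is an increment of Q. Both sums then have the form compared in
      -- `two-layers`.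
      fixed : ∀ β β′ → Cut β β′ → Final β → ΣB R (λ γ → Fᵘ γ β) ≡ ΣB R (λ γ → Fʷ γ β′)
      fixed β β′ c fin = begin
        ΣB R (λ γ → Fᵘ γ β)
          ≡⟨ ΣB-cong R (λ γ → trans (when-× (step? μᵘ gᵘ i α γ) (step? μᵘ gᵘ (suc i) γ β) (final? β ×-dec (int? a α β γ ×-dec (at γ r ℕ.≟ at β r))) toᵘ fromᵘ)
               (when-cong (final? β ×-dec (int? a α β γ ×-dec (at γ r ℕ.≟ at β r))) (int? a α β γ ×-dec (at γ r ℕ.≟ at β r)) proj₂ (fin ,_)
                 (λ (_ , int , _) → valueᵘ γ int))) ⟩
        ΣB R (λ γ → when (int? a α β γ ×-dec (at γ r ℕ.≟ at β r)) (Q (size γ) - Q (size α ℕ.+ size β ∸ size γ)))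
          ≡⟨ two-layers r a α β Q r<R (λ s s<r → trans (fα s s<r) (sym (trans (full fin s (<r⇒<R s<r) (flag s s<r)) (μ-other s (<r⇒≢ s<r)))))
               (subst (at α r ≤_) (sym (fullᵘ fin)) α≤) (λ s _ → strip fin s) (fit fin 0) (λ s _ → ≤-<-trans (fit fin s) (bd s)) ⟩
        ΣB R (λ γ → when (int? a α β γ ×-dec (at γ r ℕ.<? at β r)) (Q (suc (size γ)) - Q (size γ)))
          ≡⟨ sym (ΣB-cong R (λ γ → trans (when-× (step? μʷ gʷ i α γ) (step? μʷ gʷ (suc i) γ β′) (final? β ×-dec (int? a α β γ ×-dec (at γ r ℕ.<? at β r))) (toʷ c) (fromʷ c))
               (when-cong (final? β ×-dec (int? a α β γ ×-dec (at γ r ℕ.<? at β r))) (int? a α β γ ×-dec (at γ r ℕ.<? at β r)) proj₂ (fin ,_)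
                 (λ (_ , int , _) → valueʷ γ int)))) ⟩
        ΣB R (λ γ → Fʷ γ β′) ∎
        where
        N : ℕ
        N = size β ∸ size α
        -- The antiderivative along the antidiagonal of total exponent N, as a function of the size
        -- of γ.
        Q : ℕ → ℤ
        Q w = ∫ (Φᵘ β) N (w ∸ size α)
        flag : ∀ s → s < r → gᵘ s ≤ suc i
        flag s s<r = subst (_≤ suc i) (sym (g-other s (<r⇒≢ s<r))) (m≤n⇒m≤1+n (<⇒≤ (g-above s s<r)))
        fβ : Full β
        fβ = step-fullᵘ (m≤n⇒m≤1+n (n≤1+n i)) fin
        α≤γ′ : ∀ γ → Int a α β γ → size α ≤ size γ
        α≤γ′ γ int = size-mono α γ (λ s → α≤γ (int-elim a α β γ int s))
        valueᵘ : ∀ γ → Int a α β γ → δ (Φᵘ β) (size γ ∸ size α) (size β ∸ size γ) ≡ Q (size γ) - Q (size α ℕ.+ size β ∸ size γ)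
        valueᵘ γ int = cong₂ _-_ (cong (λ n → ∫ (Φᵘ β) n (size γ ∸ size α)) total)
          (cong₂ (λ n j → ∫ (Φᵘ β) n j) total (sym (trans (cong (_∸ size α) (+-∸-assoc (size α) (int-size a α β γ int))) (m+n∸m≡n (size α) _))))
          where
          total : (size γ ∸ size α) ℕ.+ (size β ∸ size γ) ≡ N
          total = trans (+-comm (size γ ∸ size α) _) (trans (sym (+-∸-assoc (size β ∸ size γ) (α≤γ′ γ int))) (cong (_∸ size α) (m∸n+n≡m (int-size a α β γ int))))
        lem : ∀ p q → q ≡ (p + q) - p
        lem = solve-∀
        valueʷ : ∀ γ → Int a α β γ → Φʷ β′ (size γ ∸ size α) (size β′ ∸ size γ) ≡ Q (suc (size γ)) - Q (size γ)
        valueʷ γ int = begin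
          Φʷ β′ x (size β′ ∸ size γ) ≡⟨ sym (suffix k (2 ℕ.+ i) (n≤1+n (suc i)) β β′ c fβ _) ⟩
          Φᵘ β x (size β′ ∸ size γ) ≡⟨ cong (Φᵘ β x) rest ⟩
          Φᵘ β x (N ∸ suc x) ≡⟨ lem (∫ (Φᵘ β) N x) _ ⟩
          ∫ (Φᵘ β) N (suc x) - ∫ (Φᵘ β) N x ≡⟨ cong (λ j → ∫ (Φᵘ β) N j - ∫ (Φᵘ β) N x) (sym (+-∸-assoc 1 (α≤γ′ γ int))) ⟩
          Q (suc (size γ)) - Q (size γ) ∎
          where
          x = size γ ∸ size α
          rest : size β′ ∸ size γ ≡ N ∸ suc x
          rest = trans (cong (_∸ suc (size γ)) (sym (cut-size c)))
            (trans (cong (size β ∸_) (sym (trans (+-suc (size α) x) (cong suc (m+[n∸m]≡n (α≤γ′ γ int)))))) (sym (∸-+-assoc (size β) (size α) (suc x))))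

      block : S μᵘ gᵘ (2 ℕ.+ k) i α (∂* Fin.zero φ) ≡ S μʷ gʷ (2 ℕ.+ k) i α φ
      block = begin
        S μᵘ gᵘ (2 ℕ.+ k) i α (∂* Fin.zero φ)
          ≡⟨ ΣB-cong R (λ γ → trans (when-ΣB R (step? μᵘ gᵘ i α γ) _) (ΣB-cong R (λ β → cong (when (step? μᵘ gᵘ i α γ)) (cong (when (step? μᵘ gᵘ (suc i) γ β))
               (S-δ μᵘ gᵘ k (2 ℕ.+ i) β (λ x y v → φ (x ∷ y ∷ v)) (size γ ∸ size α) (size β ∸ size γ)))))) ⟩
        ΣB R (λ γ → ΣB R (Fᵘ γ)) ≡⟨ ΣB-swap R R Fᵘ ⟩
        ΣB R (λ β → ΣB R (λ γ → Fᵘ γ β)) ≡⟨ ΣB-shift R r (suc m) m _ _ r<R m<B (<-trans ≤-refl m<B) zᵘ zʷ each ⟩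
        ΣB R (λ β → ΣB R (λ γ → Fʷ γ β)) ≡⟨ sym (ΣB-swap R R Fʷ) ⟩
        ΣB R (λ γ → ΣB R (Fʷ γ)) ≡⟨ sym (ΣB-cong R (λ γ → when-ΣB R (step? μʷ gʷ i α γ) _)) ⟩
        S μʷ gʷ (2 ℕ.+ k) i α φ ∎
        where
        zᵘ : ∀ β → at β r ≢ suc m → ΣB R (λ γ → Fᵘ γ β) ≡ 0ℤ
        zᵘ β ne = ΣB-zero R (λ γ → when-0 (step? μᵘ gᵘ i α γ) (λ s₁ → when-no (step? μᵘ gᵘ (suc i) γ β) (λ s₂ → ne (fullᵘ (proj₁ (toᵘ s₁ s₂))))))
        zʷ : ∀ β → at β r ≢ m → ΣB R (λ γ → Fʷ γ β) ≡ 0ℤ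
        zʷ β ne = ΣB-zero R (λ γ → when-0 (step? μʷ gʷ i α γ) (λ _ → when-no (step? μʷ gʷ (suc i) γ β)
          (λ s₂ → ne (trans (full s₂ r r<R (≤-reflexive gʷ-r)) μʷ-r))))
        each : ∀ β β′ → at β r ≡ suc m → at β′ r ≡ m → (∀ s → s ≢ r → at β s ≡ at β′ s) → ΣB R (λ γ → Fᵘ γ β) ≡ ΣB R (λ γ → Fʷ γ β′)
        each β β′ e e′ o with final? β
        ... | yes fin = fixed β β′ (cut e e′ o) fin
        ... | no ¬fin = trans
          (ΣB-zero R (λ γ → when-0 (step? μᵘ gᵘ i α γ) (λ s₁ → when-no (step? μᵘ gᵘ (suc i) γ β) (λ s₂ → ¬fin (proj₁ (toᵘ s₁ s₂))))))
          (sym (ΣB-zero R (λ γ → when-0 (step? μʷ gʷ i α γ) (λ s₁ → when-no (step? μʷ gʷ (suc i) γ β′) (λ s₂ → ¬fin (proj₁ (toʷ (cut e e′ o) s₁ s₂)))))))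

    -- Row r never shrinks and may not exceed m.
    overfull : ∀ k t α φ → m < at α r → S μʷ gʷ (suc k) t α φ ≡ 0ℤ
    overfull k t α φ lt = ΣB-zero R (λ β → when-no (step? μʷ gʷ t α β) (λ st →
      <⇒≱ lt (≤-trans (grow st r) (≤-trans (fit st r) (≤-reflexive μʷ-r)))))

    -- Before entry i the conditions for u and w differ only in that row r may reach m + 1 cells for
    -- u. Such a layer contributes nothing: the induction hypothesis equates its sum with one for w,
    -- which vanishes by `overfull`.
    raise : ∀ k (j : Fin (suc k)) t → toℕ j ℕ.+ t ≡ i → ∀ α φ → at α r ≤ suc m → (t ≡ i → Full α) →
      S μᵘ gᵘ (2 ℕ.+ k) t α (∂* j φ) ≡ S μʷ gʷ (2 ℕ.+ k) t α φ
    raise k Fin.zero t refl α φ α≤ fα = Block.block k α (fα refl) α≤ φ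
    raise (suc k) (Fin.suc j) t e α φ α≤ _ = ΣB-cong R (λ β → term β (step? μᵘ gᵘ t α β) (step? μʷ gʷ t α β))
      where
      t<i : t < i
      t<i = subst (t <_) e (s≤s (m≤n+m t (toℕ j)))
      ih : ∀ β → Step μᵘ gᵘ t α β → _
      ih β st = raise k j (suc t) (trans (+-suc (toℕ j) t) e) β (λ v → φ (size β ∸ size α ∷ v))
        (≤-trans (fit st r) (≤-reflexive μᵘ-r)) (λ t+1≡i → step-fullᵘ (≤-reflexive (sym t+1≡i)) st)
      toU : ∀ β → Step μʷ gʷ t α β → Step μᵘ gᵘ t α β
      toU β st = mkStep (grow st) (λ s → ≤-trans (fit st s) (μʷ≤μᵘ s)) (strip st) full′
        where
        full′ : ∀ s → s < R → gᵘ s ≤ t → at β s ≡ μᵘ s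
        full′ s lt le with s ℕ.≟ r
        ... | yes refl = ⊥-elim (<⇒≱ t<i (subst (_≤ t) gᵘ-r le))
        ... | no ne = trans (full st s lt (subst (_≤ t) (g-other s ne) le)) (sym (μ-other s ne))
      toW : ∀ β → at β r ≤ m → Step μᵘ gᵘ t α β → Step μʷ gʷ t α β
      toW β le st = mkStep (grow st) fit′ (strip st) full′
        where
        fit′ : ∀ s → at β s ≤ μʷ s
        fit′ s with s ℕ.≟ r
        ... | yes refl = subst (at β s ≤_) (sym μʷ-r) le
        ... | no ne = subst (at β s ≤_) (μ-other s ne) (fit st s)
        full′ : ∀ s → s < R → gʷ s ≤ t → at β s ≡ μʷ s
        full′ s lt le with s ℕ.≟ r
        ... | yes refl = ⊥-elim (<⇒≱ (<-trans t<i ≤-refl) (subst (_≤ t) gʷ-r le))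
        ... | no ne = trans (full st s lt (subst (_≤ t) (sym (g-other s ne)) le)) (μ-other s ne)
      term : ∀ β (d : Dec (Step μᵘ gᵘ t α β)) (d′ : Dec (Step μʷ gʷ t α β)) →
        when d (S μᵘ gᵘ (2 ℕ.+ k) (suc t) β (λ v → ∂* (Fin.suc j) φ (size β ∸ size α ∷ v))) ≡ when d′ (S μʷ gʷ (2 ℕ.+ k) (suc t) β (λ v → φ (size β ∸ size α ∷ v)))
      term β (yes st) (yes _) = ih β st
      term β (no _) (no _) = refl
      term β (no ¬st) (yes st) = ⊥-elim (¬st (toU β st))
      term β (yes st) (no ¬st) with at β r ℕ.≤? m
      ... | yes le = ⊥-elim (¬st (toW β le st))
      ... | no ≰ = trans (ih β st) (overfull (suc k) (suc t) β (λ v → φ (size β ∸ size α ∷ v)) (≰⇒> ≰))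

open LayerSums

-- Ascents whose swap preserves vexillarity.

module Peaks where
  open import Data.Nat as ℕ using (ℕ; suc; _≤_; _<_; s≤s; _+_)
  open import Data.Fin as Fin using (Fin; toℕ; inject₁)
  import Data.Fin.Properties as Finₚ
  open import Data.Empty using (⊥; ⊥-elim)
  open import Data.Sum using (_⊎_; inj₁; inj₂)
  open import Data.Product using (∃; ∃-syntax; _×_; _,_; proj₁)
  open import Function using (_∘_)
  open import Relation.Nullary using (¬_; Dec; yes; no)
  open import Relation.Nullary.Decidable using (_×-dec_; _⊎-dec_)
  open import Relation.Binary using (tri<; tri≈; tri>)
  open import Relation.Binary.PropositionalEquality hiding (J)
  open import Data.Nat.Properties using (<-asym; <-cmp; <-irrefl; <-trans; <⇒≤; <⇒≱; m≤n⇒m<n∨m≡n; m≤n⇒m≤1+n; ≤-<-trans; ≤-pred; ≤-refl; ≤-reflexive; ≤-trans; ≤∧≢⇒<; ≰⇒>)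

  Vex : ∀ {n} → (Fin n → ℕ) → Set
  Vex {n} f = ¬ (∃[ a ] ∃[ b ] ∃[ c ] ∃[ d ]
    (a Fin.< b × b Fin.< c × c Fin.< d × f b < f a × f a < f d × f d < f c))

  Injective : ∀ {n} → (Fin n → ℕ) → Set
  Injective f = ∀ {x y} → f x ≡ f y → x ≡ y

  first-max : ∀ {m} {P : Fin m → Set} (P? : ∀ i → Dec (P i)) (v : Fin m → ℕ) → ∃ P →
    ∃[ i ] (P i × (∀ j → P j → v j ≤ v i) × (∀ j → P j → j Fin.< i → v j < v i))
  first-max {suc m} {P} P? v ex with Finₚ.any? (P? ∘ Fin.suc)
  first-max {suc m} {P} P? v (Fin.zero , p) | no none = Fin.zero , p ,
    (λ { Fin.zero _ → ≤-refl ; (Fin.suc j) q → ⊥-elim (none (j , q)) }) , (λ j _ ())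
  first-max {suc m} {P} P? v (Fin.suc i , p) | no none = ⊥-elim (none (i , p))
  first-max {suc m} {P} P? v ex | yes ex′ with first-max (P? ∘ Fin.suc) (v ∘ Fin.suc) ex′ | P? Fin.zero
  ... | i , p , mx , lf | no ¬p₀ = Fin.suc i , p ,
    (λ { Fin.zero q → ⊥-elim (¬p₀ q) ; (Fin.suc j) q → mx j q }) ,
    (λ { Fin.zero q _ → ⊥-elim (¬p₀ q) ; (Fin.suc j) q (s≤s lt) → lf j q lt })
  ... | i , p , mx , lf | yes p₀ with v (Fin.suc i) ℕ.≤? v Fin.zero
  ...   | yes le = Fin.zero , p₀ , (λ { Fin.zero _ → ≤-refl ; (Fin.suc j) q → ≤-trans (mx j q) le }) , (λ j _ ())
  ...   | no ≰ = Fin.suc i , p ,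
    (λ { Fin.zero q → <⇒≤ (≰⇒> ≰) ; (Fin.suc j) q → mx j q }) ,
    (λ { Fin.zero q _ → ≰⇒> ≰ ; (Fin.suc j) q (s≤s lt) → lf j q lt })

  -- A discrete intermediate value argument: walking back from z, the first position with value at
  -- most v is the foot of an ascent.
  crossing : ∀ {m} (f : Fin (suc m) → ℕ) v b z → b Fin.< z → f b ≤ v → v < f z →
    ∃[ q ] (Asc f q × b Fin.< Fin.suc q × Fin.suc q Fin.≤ z × v < f (Fin.suc q))
  crossing {m} f v b z lt fb fz = go (toℕ z) z ≤-refl lt fz
    where
    go : ∀ N (z : Fin (suc m)) → toℕ z ≤ N → b Fin.< z → v < f z → ∃[ q ] (Asc f q × b Fin.< Fin.suc q × Fin.suc q Fin.≤ z × v < f (Fin.suc q))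
    go (suc N) (Fin.suc z) (s≤s le) lt fz with f (inject₁ z) ℕ.≤? v
    ... | yes p = z , ≤-<-trans p fz , lt , ≤-refl , fz
    ... | no ≰ with go N (inject₁ z) (subst (_≤ N) (sym (Finₚ.toℕ-inject₁ z)) le) b<z (≰⇒> ≰)
      where
      b<z : b Fin.< inject₁ z
      b<z = subst (toℕ b <_) (sym (Finₚ.toℕ-inject₁ z)) (≤∧≢⇒< (≤-pred lt)
        (λ e → ≰ (subst (λ x → f x ≤ v) (Finₚ.toℕ-injective (trans e (sym (Finₚ.toℕ-inject₁ z)))) fb)))
    ...   | q , a , l₁ , l₂ , fq = q , a , l₁ , m≤n⇒m≤1+n (subst (suc (toℕ q) ≤_) (Finₚ.toℕ-inject₁ z) l₂) , fq

  -- Swapping this ascent keeps a permutation vexillary and lengthens a single row of its shape.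
  record Peak {m} (f : Fin (suc m) → ℕ) (i : Fin m) : Set where
    field
      inj : Injective f
      vex : Vex f
      asc : Asc f i
      maximal : ∀ j → Asc f j → code f (Fin.suc j) ≤ code f (Fin.suc i)
      leftmost : ∀ j → Asc f j → j Fin.< i → code f (Fin.suc j) < code f (Fin.suc i)

  module PeakProperties {m} {f : Fin (suc m) → ℕ} {i : Fin m} (peak : Peak f i) where
    open Peak peak
    open Swap f i asc public using (I; J; I<J; beyond; u)

    c : Fin (suc m) → ℕ
    c = code f

    ≢⇒<⊎> : ∀ {x y : Fin (suc m)} → x ≢ y → f x < f y ⊎ f y < f x
    ≢⇒<⊎> {x} {y} ne with <-cmp (f x) (f y)
    ... | tri< lt _ _ = inj₁ lt
    ... | tri≈ _ e _ = ⊥-elim (ne (inj e))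
    ... | tri> _ _ gt = inj₂ gt

    <⇒≢ : ∀ {x y : Fin (suc m)} → x Fin.< y → x ≢ y
    <⇒≢ lt refl = <-irrefl refl lt

    <J⇒≤I : ∀ {k : Fin (suc m)} → k Fin.< J → k Fin.≤ I
    <J⇒≤I {k} lt = subst (toℕ k ≤_) (sym (Finₚ.toℕ-inject₁ i)) (≤-pred lt)

    <J⇒≡I⊎<I : ∀ {k : Fin (suc m)} → k Fin.< J → k ≡ I ⊎ k Fin.< I
    <J⇒≡I⊎<I {k} lt with m≤n⇒m<n∨m≡n (<J⇒≤I lt)
    ... | inj₁ k<I = inj₂ k<I
    ... | inj₂ e = inj₁ (Finₚ.toℕ-injective e)

    -- Walking back towards J, an ascent is covered by maximality, and at a descent the code entry
    -- on the left is larger.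
    code-after : ∀ (j : Fin (suc m)) → J Fin.≤ j → c j ≤ c J
    code-after j le = go (toℕ j) j ≤-refl le
      where
      go : ∀ N (j : Fin (suc m)) → toℕ j ≤ N → J Fin.≤ j → c j ≤ c J
      go (suc N) (Fin.suc j) (s≤s j≤N) (s≤s le) with Asc? f j
      ... | yes a = maximal j a
      ... | no ¬a with Fin.suc j Fin.≟ J
      ...   | yes e = ≤-reflexive (cong c e)
      ...   | no ne = ≤-trans (<⇒≤ descent) (go N (inject₁ j) (subst (_≤ N) (sym (Finₚ.toℕ-inject₁ j)) j≤N) (subst (suc (toℕ i) ≤_) (sym (Finₚ.toℕ-inject₁ j)) i<j))
        where
        i<j : toℕ i < toℕ j
        i<j = ≤∧≢⇒< le (λ e → ne (cong Fin.suc (Finₚ.toℕ-injective (sym e))))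
        j<j+1 : inject₁ j Fin.< Fin.suc j
        j<j+1 = s≤s (≤-reflexive (Finₚ.toℕ-inject₁ j))
        desc : f (Fin.suc j) < f (inject₁ j)
        desc with ≢⇒<⊎> (<⇒≢ j<j+1)
        ... | inj₁ a = ⊥-elim (¬a a)
        ... | inj₂ d = d
        descent : c (Fin.suc j) < c (inject₁ j)
        descent = cnt-strict (Inv? f (Fin.suc j)) (Inv? f (inject₁ j)) (Fin.suc j)
          (λ k (lt , v) → <-trans j<j+1 lt , <-trans v desc) (λ (lt , _) → <-irrefl refl lt) (j<j+1 , desc)

    code-I≤ : c I ≤ c J
    code-I≤ = cnt-mono (Inv? f I) (Inv? f J)
      (λ k (lt , v) → beyond lt (λ { refl → <-asym v asc }) , <-trans v asc)

    -- As c p ≤ c J and q is an inversion of p but not of J, some e is an inversion of J but not of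
    -- p. It must lie before p, and then J, e, p, q form the pattern 2143.
    no-21-before : ∀ {p q : Fin (suc m)} → J Fin.< p → p Fin.< q → f J < f q → f q < f p → ⊥
    no-21-before {p} {q} J<p p<q v₁ v₂
      with cnt-missing (Inv? f p) (Inv? f J) q (code-after p (<⇒≤ J<p)) (p<q , v₂) (λ (_ , v) → <-asym v v₁)
    ... | e , (J<e , ve) , ¬inv with <-cmp (toℕ e) (toℕ p)
    ...   | tri< e<p _ _ = vex (J , e , p , q , J<e , e<p , p<q , ve , v₁ , v₂)
    ...   | tri≈ _ e≡p _ = <-asym ve (subst (λ x → f J < f x) (sym (Finₚ.toℕ-injective e≡p)) (<-trans v₁ v₂))
    ...   | tri> _ _ p<e = ¬inv (p<e , <-trans ve (<-trans v₁ v₂))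

    I≤⇒<J : ∀ {q : Fin m} → Fin.suc q Fin.≤ I → q Fin.< i
    I≤⇒<J {q} le = subst (suc (toℕ q) ≤_) (Finₚ.toℕ-inject₁ i) le

    -- Some ascent between b and I ends above `f a`. By vexillarity, applied to a, b, J and d, every
    -- inversion d of J has a value below `f a`. So the code entry after that ascent is at least c
    -- J, although the ascent is further to the left.
    no-43-after : ∀ {a b : Fin (suc m)} → a Fin.< b → b Fin.< I → f b < f a → f a < f I → ⊥
    no-43-after {a} {b} a<b b<I v₁ v₂ with crossing f (f a) b I b<I (<⇒≤ v₁) v₂
    ... | q , aq , b<q , q≤I , vq = <⇒≱ (leftmost q aq (I≤⇒<J q≤I)) (cnt-mono (Inv? f J) (Inv? f (Fin.suc q)) sub)
      where
      sub : ∀ d → Inv f J d → Inv f (Fin.suc q) d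
      sub d (J<d , vd) = ≤-<-trans q≤I (<-trans I<J J<d) , <-trans small vq
        where
        small : f d < f a
        small with ≢⇒<⊎> (<⇒≢ (<-trans a<b (<-trans b<I (<-trans I<J J<d))))
        ... | inj₂ p = p
        ... | inj₁ p = ⊥-elim (vex (a , b , J , d , a<b , <-trans b<I I<J , J<d , v₁ , p , vd))

    -- A pattern 2143 of u pulls back to f unless it uses the swapped pair as neighbours. This pair
    -- is a descent of u, so it must be the 21 or the 43, which the two preceding exclusions rule
    -- out.
    u-vex : Vex u
    u-vex (a , b , p , q , a<b , b<p , p<q , v₁ , v₂ , v₃)
      with simple-mono i a b a<b | simple-mono i b p b<p | simple-mono i p q p<q
    ... | inj₂ l₁ | inj₂ l₂ | inj₂ l₃ = vex (_ , _ , _ , _ , l₁ , l₂ , l₃ , v₁ , v₂ , v₃)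
    ... | _ | inj₁ (refl , refl) | _ = <-asym asc (subst₂ (λ x y → f x < f y) (simple-inject₁ i) (simple-fsuc i) (<-trans v₁ (<-trans v₂ v₃)))
    ... | inj₁ (refl , refl) | _ | _ = no-21-before b<p p<q
            (subst₂ (λ x y → f x < f y) (simple-inject₁ i) (fixed (<-trans b<p p<q)) v₂)
            (subst₂ (λ x y → f x < f y) (fixed (<-trans b<p p<q)) (fixed b<p) v₃)
      where
      fixed : ∀ {x : Fin (suc m)} → J Fin.< x → simple i x ≡ x
      fixed {x} lt = simple-other i x (λ { refl → <-asym lt I<J }) (λ { refl → <-irrefl refl lt })
    ... | _ | _ | inj₁ (refl , refl) = no-43-after a<b b<p
            (subst₂ (λ x y → f x < f y) (fixed b<p) (fixed (<-trans a<b b<p)) v₁)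
            (subst₂ (λ x y → f x < f y) (fixed (<-trans a<b b<p)) (simple-fsuc i) v₂)
      where
      fixed : ∀ {x : Fin (suc m)} → x Fin.< I → simple i x ≡ x
      fixed {x} lt = simple-other i x (λ { refl → <-irrefl refl lt }) (λ { refl → <-asym lt I<J })

    u-inj : Injective u
    u-inj e = simple-injective i (inj e)

    two-more : ∀ {j x y : Fin (suc m)} → (∀ d → Inv f J d → Inv f j d) → ¬ Inv f J x → ¬ Inv f J y → x ≢ y → Inv f j x → Inv f j y → 2 + c J ≤ c j
    two-more {j} {x} {y} sub ¬x ¬y x≢y jx jy = subst (λ n → suc n ≤ c j)
      (cnt-insert (Inv? f J) P? x ¬x (inj₁ refl) (λ _ → inj₂) (λ _ p → p))
      (cnt-strict P? (Inv? f j) y (λ { k (inj₁ refl) → jx ; k (inj₂ p) → sub k p }) (λ { (inj₁ e) → x≢y (sym e) ; (inj₂ p) → ¬y p }) jy)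
      where
      P? : ∀ k → Dec (k ≡ x ⊎ Inv f J k)
      P? k = (k Fin.≟ x) ⊎-dec Inv? f J k

    not-before-J : ∀ {x : Fin (suc m)} → x Fin.≤ J → ¬ Inv f J x
    not-before-J le (lt , _) = <⇒≱ lt le

    -- If j + 1 were before I, counting would give `f j < f J` and a smaller value between j and J;
    -- then also `f I < f j`, and by vexillarity every inversion of J is one of j. An ascent at j
    -- now contradicts the leftmost choice, while a descent gives j two additional inversions, at j
    -- + 1 and at I.
    code-one-more : ∀ {j : Fin (suc m)} → j Fin.< I → c j ≡ suc (c J) → suc (toℕ j) ≡ toℕ I
    code-one-more {j} j<I e with m≤n⇒m<n∨m≡n j<I
    ... | inj₂ eq = eq
    ... | inj₁ j+1<I = ⊥-elim (contra (Finₚ.any? (λ b → (j Fin.<? b) ×-dec (b Fin.<? J) ×-dec (f b ℕ.<? f j))))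
      where
      j<J = <-trans j<I I<J
      fj<fJ : f j < f J
      fj<fJ with ≢⇒<⊎> (<⇒≢ j<J)
      ... | inj₁ p = p
      ... | inj₂ p = ⊥-elim (<-irrefl (sym e) (two-more (λ d (l , v) → <-trans j<J l , <-trans v p)
        (not-before-J (≤-refl {toℕ J})) (not-before-J (<⇒≤ I<J)) (λ q → <⇒≢ I<J (sym q)) (j<J , p) (j<I , <-trans asc p)))
      contra : Dec (∃[ b ] (j Fin.< b × b Fin.< J × f b < f j)) → ⊥
      contra (no none) = <⇒≱ (≤-reflexive (sym e)) (cnt-mono (Inv? f j) (Inv? f J) sub)
        where
        sub : ∀ k → Inv f j k → Inv f J k
        sub k (l , v) with <-cmp (toℕ k) (toℕ J)
        ... | tri< k<J _ _ = ⊥-elim (none (k , l , k<J , v))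
        ... | tri≈ _ k≡J _ = ⊥-elim (<-asym v (subst (λ x → f j < f x) (sym (Finₚ.toℕ-injective k≡J)) fj<fJ))
        ... | tri> _ _ J<k = J<k , <-trans v fj<fJ
      contra (yes (b , j<b , b<J , fb<fj)) = next (≢⇒<⊎> {inject₁ j′} {Fin.suc j′} (<⇒≢ (s≤s (≤-reflexive (Finₚ.toℕ-inject₁ j′)))))
        where
        fI<fj : f I < f j
        fI<fj with <J⇒≡I⊎<I b<J | ≢⇒<⊎> (<⇒≢ j<I)
        ... | inj₁ refl | _ = fb<fj
        ... | inj₂ b<I | inj₂ p = p
        ... | inj₂ b<I | inj₁ p = ⊥-elim (no-43-after j<b b<I fb<fj p)
        small : ∀ d → Inv f J d → f d < f j
        small d (J<d , vd) with ≢⇒<⊎> (<⇒≢ (<-trans j<J J<d))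
        ... | inj₂ p = p
        ... | inj₁ p = ⊥-elim (vex (j , b , J , d , j<b , b<J , J<d , fb<fj , p , vd))
        j<m : toℕ j < m
        j<m = <-trans (subst (toℕ j <_) (Finₚ.toℕ-inject₁ i) j<I) (Finₚ.toℕ<n i)
        j′ : Fin m
        j′ = Fin.fromℕ< j<m
        tj′ : toℕ j′ ≡ toℕ j
        tj′ = Finₚ.toℕ-fromℕ< j<m
        j≡ : inject₁ j′ ≡ j
        j≡ = Finₚ.toℕ-injective (trans (Finₚ.toℕ-inject₁ j′) tj′)
        next : f (inject₁ j′) < f (Fin.suc j′) ⊎ f (Fin.suc j′) < f (inject₁ j′) → ⊥
        next (inj₁ up) = <⇒≱ (leftmost j′ up (subst₂ _<_ (sym tj′) (Finₚ.toℕ-inject₁ i) j<I))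
          (cnt-mono (Inv? f J) (Inv? f (Fin.suc j′)) (λ d inv → <-trans (subst (λ x → suc x < toℕ J) (sym tj′) (<-trans j+1<I I<J)) (proj₁ inv) ,
            <-trans (small d inv) (subst (λ x → f x < f (Fin.suc j′)) j≡ up)))
        next (inj₂ down) = <-irrefl (sym e) (two-more (λ d inv → <-trans j<J (proj₁ inv) , small d inv)
          (not-before-J (subst (λ x → suc x ≤ toℕ J) (sym tj′) (<⇒≤ (<-trans j+1<I I<J)))) (not-before-J (<⇒≤ I<J))
          (λ q → <-irrefl (trans (cong suc (sym tj′)) (cong toℕ q)) j+1<I)
          (s≤s (≤-reflexive (sym tj′)) , subst (λ x → f (Fin.suc j′) < f x) j≡ down) (j<I , fI<fj))

    -- If `f j` exceeds `f J`, then j has all inversions of J and J itself; if it lies between `f I`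
    -- and `f J`, vexillarity gives all inversions of J and I itself. If it is below `f I`, an
    -- inversion of j missing at I lies before I and is excluded by `no-43-after`.
    no-code-between : ∀ {j : Fin (suc m)} → j Fin.< I → c I < c j → c j ≤ c J → ⊥
    no-code-between {j} j<I lt le with ≢⇒<⊎> (<⇒≢ (<-trans j<I I<J)) | ≢⇒<⊎> (<⇒≢ j<I)
    ... | inj₂ fJ<fj | _ = <⇒≱ (cnt-strict (Inv? f J) (Inv? f j) J (λ d (l , v) → <-trans (<-trans j<I I<J) l , <-trans v fJ<fj)
            (not-before-J (≤-refl {toℕ J})) (<-trans j<I I<J , fJ<fj)) le
    ... | inj₁ _ | inj₂ fI<fj = <⇒≱ (cnt-strict (Inv? f J) (Inv? f j) I sub (not-before-J (<⇒≤ I<J)) (j<I , fI<fj)) le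
      where
      sub : ∀ d → Inv f J d → Inv f j d
      sub d (J<d , vd) = <-trans (<-trans j<I I<J) J<d , small
        where
        small : f d < f j
        small with ≢⇒<⊎> (<⇒≢ (<-trans (<-trans j<I I<J) J<d))
        ... | inj₂ p = p
        ... | inj₁ p = ⊥-elim (vex (j , I , J , d , j<I , I<J , J<d , fI<fj , p , vd))
    ... | inj₁ _ | inj₁ fj<fI with cnt-surplus (Inv? f I) (Inv? f j) lt
    ...   | b , (j<b , fb<fj) , ¬inv with <-cmp (toℕ b) (toℕ I)
    ...     | tri< b<I _ _ = no-43-after j<b b<I fb<fj fj<fI
    ...     | tri≈ _ b≡I _ = <-asym fj<fI (subst (λ x → f x < f j) (Finₚ.toℕ-injective b≡I) fb<fj)
    ...     | tri> _ _ I<b = ¬inv (I<b , <-trans fb<fj fj<fI)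

    -- A value below `f J` between J and j would, by comparing c J with c j, create a pattern 2143.
    -- So all inversions of J lie beyond j and are inversions of q as well.
    code-plateau : ∀ {q j : Fin (suc m)} → J Fin.< q → q Fin.< j → c J ≤ c j → c J ≤ c q
    code-plateau {q} {j} J<q q<j le = cnt-mono (Inv? f J) (Inv? f q) sub
      where
      J<j = <-trans J<q q<j
      fJ<fj : f J < f j
      fJ<fj with ≢⇒<⊎> (<⇒≢ J<j)
      ... | inj₁ p = p
      ... | inj₂ p = ⊥-elim (<⇒≱ (cnt-strict (Inv? f j) (Inv? f J) j (λ d (l , v) → <-trans J<j l , <-trans v p)
        (λ (l , _) → <-irrefl refl l) (J<j , p)) le)
      high : ∀ b → J Fin.< b → b Fin.< j → f J < f b
      high b J<b b<j with ≢⇒<⊎> (<⇒≢ J<b)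
      ... | inj₁ p = p
      ... | inj₂ p with cnt-missing (Inv? f J) (Inv? f j) b le (J<b , p) (λ (l , _) → <-asym l b<j)
      ...   | d , (j<d , vd) , ¬inv with ≢⇒<⊎> (<⇒≢ (<-trans J<j j<d))
      ...     | inj₁ r = ⊥-elim (vex (J , b , j , d , J<b , b<j , j<d , p , r , vd))
      ...     | inj₂ r = ⊥-elim (¬inv (<-trans J<j j<d , r))
      sub : ∀ d → Inv f J d → Inv f q d
      sub d (J<d , vd) with <-cmp (toℕ d) (toℕ j)
      ... | tri< d<j _ _ = ⊥-elim (<-asym vd (high d J<d d<j))
      ... | tri≈ _ d≡j _ = ⊥-elim (<-asym vd (subst (λ x → f J < f x) (sym (Finₚ.toℕ-injective d≡j)) fJ<fj))
      ... | tri> _ _ j<d = <-trans q<j j<d , <-trans vd (high q J<q q<j)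

open Peaks

-- Sorted codes, their flags and the effect of a swap on both.

module Shapes where
  open import Data.Nat as ℕ using (ℕ; zero; suc; _∸_; _≤_; _<_; s≤s; z≤n; _+_)
  import Data.Nat.Properties as ℕₚ
  open import Data.Nat.Tactic.RingSolver using (solve-∀)
  open import Data.Fin as Fin using (Fin; toℕ; inject₁)
  import Data.Fin.Properties as Finₚ
  open import Data.Empty using (⊥; ⊥-elim)
  open import Data.Sum using (_⊎_; inj₁; inj₂)
  open import Data.Product using (∃; ∃-syntax; _×_; _,_; proj₁; proj₂)
  open import Function using (_∘_)
  open import Relation.Nullary using (¬_; Dec; yes; no)
  open import Relation.Nullary.Decidable using (_×-dec_; _⊎-dec_)
  open import Relation.Binary using (tri<; tri≈; tri>)
  open import Relation.Binary.PropositionalEquality hiding (J)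
  open import Data.Nat.Properties using (+-comm; +-identityʳ; +-mono-≤; +-monoʳ-≤; +-suc; <-cmp; <-irrefl; <-trans; <-≤-trans; <⇒≤; <⇒≱; m+[n∸m]≡n; m<n⇒m<1+n; m≤m+n; m≤n⇒m<n∨m≡n; m≤n⇒m≤1+n; n≤1+n; ≤-<-trans; ≤-antisym; ≤-pred; ≤-refl; ≤-reflexive; ≤-trans; ≤⇒≯; ≤∧≢⇒<; ≮⇒≥; ≰⇒>)

  largest : ∀ {P : ℕ → Set} → (∀ k → Dec (P k)) → ℕ → ℕ
  largest P? zero = 0
  largest P? (suc n) with P? (suc n)
  ... | yes _ = suc n
  ... | no _ = largest P? n

  largest-sat : ∀ {P : ℕ → Set} (P? : ∀ k → Dec (P k)) n → 0 < largest P? n → P (largest P? n)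
  largest-sat P? (suc n) lt with P? (suc n)
  ... | yes p = p
  ... | no _ = largest-sat P? n lt

  largest-max : ∀ {P : ℕ → Set} (P? : ∀ k → Dec (P k)) n k → k ≤ n → P k → k ≤ largest P? n
  largest-max P? zero k le p = le
  largest-max P? (suc n) k le p with P? (suc n)
  ... | yes _ = le
  ... | no ¬p with m≤n⇒m<n∨m≡n le
  ...   | inj₁ (s≤s lt) = largest-max P? n k lt p
  ...   | inj₂ refl = ⊥-elim (¬p p)

  last : ∀ {n} {P : Fin n → Set} → (∀ j → Dec (P j)) → ℕ
  last {zero} P? = 0
  last {suc n} P? with Finₚ.any? (P? ∘ Fin.suc)
  ... | yes _ = suc (last (P? ∘ Fin.suc))
  ... | no _ = 0

  last-max : ∀ {n} {P : Fin n → Set} (P? : ∀ j → Dec (P j)) j → P j → toℕ j ≤ last P?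
  last-max {suc n} P? Fin.zero p = z≤n
  last-max {suc n} P? (Fin.suc j) p with Finₚ.any? (P? ∘ Fin.suc)
  ... | yes _ = s≤s (last-max (P? ∘ Fin.suc) j p)
  ... | no none = ⊥-elim (none (j , p))

  last-sat : ∀ {n} {P : Fin n → Set} (P? : ∀ j → Dec (P j)) → ∃ P → ∃[ j ] (P j × toℕ j ≡ last P?)
  last-sat {suc n} P? ex with Finₚ.any? (P? ∘ Fin.suc)
  last-sat {suc n} P? ex | yes ex′ with last-sat (P? ∘ Fin.suc) ex′
  ... | j , p , e = Fin.suc j , p , cong suc e
  last-sat {suc n} P? (Fin.zero , p) | no none = Fin.zero , p , refl
  last-sat {suc n} P? (Fin.suc j , p) | no none = ⊥-elim (none (j , p))

  last< : ∀ {n} {P : Fin (suc n) → Set} (P? : ∀ j → Dec (P j)) → last P? < suc n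
  last< {zero} P? = s≤s z≤n
  last< {suc n} P? with Finₚ.any? (P? ∘ Fin.suc)
  ... | yes _ = s≤s (last< (P? ∘ Fin.suc))
  ... | no _ = s≤s z≤n

  cnt-pos : ∀ {n} {P : Fin n → Set} (P? : ∀ k → Dec (P k)) → 0 < cnt P? → ∃ P
  cnt-pos P? lt with Finₚ.any? P?
  ... | yes ex = ex
  ... | no none = ⊥-elim (<⇒≱ lt (≤-reflexive (zero-cnt P? (λ k p → none (k , p)))))
    where
    zero-cnt : ∀ {n} {P : Fin n → Set} (P? : ∀ k → Dec (P k)) → (∀ k → ¬ P k) → cnt P? ≡ 0
    zero-cnt {zero} P? h = refl
    zero-cnt {suc n} P? h with P? Fin.zero
    ... | yes p = ⊥-elim (h Fin.zero p)
    ... | no _ = zero-cnt (P? ∘ Fin.suc) (h ∘ Fin.suc)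

  cnt-range : ∀ {n} lo d → lo + d ≤ n → d ≤ cnt {n} (λ j → (lo ℕ.≤? toℕ j) ×-dec (toℕ j ℕ.<? lo + d))
  cnt-range {n} lo zero le = z≤n
  cnt-range {suc n} zero (suc d) (s≤s le) = s≤s (≤-trans (cnt-range 0 d le)
    (cnt-mono (λ (j : Fin n) → (0 ℕ.≤? toℕ j) ×-dec (toℕ j ℕ.<? d)) (λ j → (0 ℕ.≤? suc (toℕ j)) ×-dec (suc (toℕ j) ℕ.<? suc d)) (λ j (_ , lt) → z≤n , s≤s lt)))
  cnt-range {suc n} (suc lo) (suc d) (s≤s le) = ≤-trans (cnt-range lo (suc d) le)
    (cnt-mono (λ (j : Fin n) → (lo ℕ.≤? toℕ j) ×-dec (toℕ j ℕ.<? lo + suc d)) (λ j → (suc lo ℕ.≤? suc (toℕ j)) ×-dec (suc (toℕ j) ℕ.<? suc lo + suc d)) (λ j (a , b) → s≤s a , s≤s b))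

  cnt-disjoint : ∀ {n} {P Q T : Fin n → Set} (P? : ∀ k → Dec (P k)) (Q? : ∀ k → Dec (Q k)) (T? : ∀ k → Dec (T k)) →
    (∀ k → P k → Q k → ⊥) → (∀ k → P k → T k) → (∀ k → Q k → T k) → cnt P? + cnt Q? ≤ cnt T?
  cnt-disjoint {zero} P? Q? T? d f g = z≤n
  cnt-disjoint {suc n} P? Q? T? d f g = ≤-trans (≤-reflexive (swap (ind (P? Fin.zero)) _ (ind (Q? Fin.zero)) _))
    (+-mono-≤ (head (P? Fin.zero) (Q? Fin.zero) (T? Fin.zero)) (cnt-disjoint (P? ∘ Fin.suc) (Q? ∘ Fin.suc) (T? ∘ Fin.suc) (d ∘ Fin.suc) (f ∘ Fin.suc) (g ∘ Fin.suc)))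
    where
    swap : ∀ a b c e → (a + b) + (c + e) ≡ (a + c) + (b + e)
    swap = solve-∀
    head : ∀ p? q? t? → ind p? + ind q? ≤ ind t?
    head (yes p) (yes q) t? = ⊥-elim (d _ p q)
    head (yes p) (no _) t? = ind-mono (yes p) t? (f _)
    head (no _) q? t? = ind-mono q? t? (g _)

  module _ {n : ℕ} (c : Fin n → ℕ) where
    -- The length of column k, counted from 1, of the sorted diagram: the conjugate partition.
    height : ℕ → ℕ
    height k = cnt (λ j → k ℕ.≤? c j)

    height-anti : ∀ {k l} → k ≤ l → height l ≤ height k
    height-anti {k} {l} le = cnt-mono (λ j → l ℕ.≤? c j) (λ j → k ℕ.≤? c j) (λ j → ≤-trans le)

    height-pos : (∀ j → c j < n) → ∀ {k s} → s < height k → k < n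
    height-pos c<n {k} lt with cnt-pos (λ j → k ℕ.≤? c j) (≤-<-trans z≤n lt)
    ... | j , le = ≤-<-trans le (c<n j)

    abstract
      -- The conjugate description of the sorted code: k ≤ shapeOf s iff column k has more than s cells.
      shapeOf : ℕ → ℕ
      shapeOf s = largest (λ k → s ℕ.<? height k) n

      lastRow : ℕ → ℕ
      lastRow k = last (λ j → k ℕ.≤? c j)

      lastRow-max : ∀ {k} j → k ≤ c j → toℕ j ≤ lastRow k
      lastRow-max {k} = last-max (λ j → k ℕ.≤? c j)

      lastRow-sat : ∀ {k s} → s < height k → ∃[ j ] (k ≤ c j × toℕ j ≡ lastRow k)
      lastRow-sat {k} lt = last-sat (λ j → k ℕ.≤? c j) (cnt-pos (λ j → k ℕ.≤? c j) (≤-<-trans z≤n lt))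

      shape⇒height : ∀ {k s} → 0 < k → k ≤ shapeOf s → s < height k
      shape⇒height {k} {s} 0<k le = <-≤-trans (largest-sat (λ k → s ℕ.<? height k) n (<-≤-trans 0<k le)) (height-anti le)

      height⇒shape : (∀ j → c j < n) → ∀ {k s} → s < height k → k ≤ shapeOf s
      height⇒shape c<n {k} {s} lt = largest-max (λ k → s ℕ.<? height k) n k (<⇒≤ (height-pos c<n lt)) lt

    -- The bound e(k) for the length k of row s; rows of equal length therefore have equal flags.
    flag : ℕ → ℕ
    flag s = lastRow (shapeOf s)

    module _ (c<n : ∀ j → c j < n) where
      shape≤ : ∀ {s x} → ¬ (s < height (suc x)) → shapeOf s ≤ x
      shape≤ {s} {x} ¬lt with shapeOf s ℕ.≤? x
      ... | yes le = le
      ... | no ≰ = ⊥-elim (¬lt (shape⇒height (s≤s z≤n) (≰⇒> ≰)))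

      shape-anti : ∀ s → shapeOf (suc s) ≤ shapeOf s
      shape-anti s with shapeOf (suc s) | shape⇒height {shapeOf (suc s)} {suc s}
      ... | zero | _ = z≤n
      ... | suc k | h = height⇒shape c<n (<-trans ≤-refl (h (s≤s z≤n) ≤-refl))

  shape<n : ∀ {m} (c : Fin (suc m) → ℕ) → (∀ j → c j < suc m) → ∀ s → shapeOf c s < suc m
  shape<n c c<n s with shapeOf c s | shape⇒height c {shapeOf c s} {s}
  ... | zero | _ = s≤s z≤n
  ... | suc k | h = height-pos c c<n (h (s≤s z≤n) ≤-refl)

  abstract
    lastRow< : ∀ {m} (c : Fin (suc m) → ℕ) k → lastRow c k < suc m
    lastRow< c k = last< (λ j → k ℕ.≤? c j)

  shape-ext : ∀ {n} (c c′ : Fin n → ℕ) (c<n : ∀ j → c j < n) (c′<n : ∀ j → c′ j < n) s →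
    (∀ k → 0 < k → s < height c k → s < height c′ k) → shapeOf c s ≤ shapeOf c′ s
  shape-ext c c′ c<n c′<n s h with shapeOf c s | shape⇒height c {shapeOf c s} {s}
  ... | zero | _ = z≤n
  ... | suc k | g = height⇒shape c′ c′<n (h (suc k) (s≤s z≤n) (g (s≤s z≤n) ≤-refl))

  abstract
    override : ℕ → ℕ → (ℕ → ℕ) → ℕ → ℕ
    override r x g s with s ℕ.≟ r
    ... | yes _ = x
    ... | no _ = g s

    override-at : ∀ r x g → override r x g r ≡ x
    override-at r x g with r ℕ.≟ r
    ... | yes _ = refl
    ... | no ne = ⊥-elim (ne refl)

    override-other : ∀ r x g s → s ≢ r → override r x g s ≡ g s
    override-other r x g s ne with s ℕ.≟ r
    ... | yes e = ⊥-elim (ne e)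
    ... | no _ = refl

    override-≤ : ∀ r x g → x ≤ g r → ∀ s → override r x g s ≤ g s
    override-≤ r x g le s with s ℕ.≟ r
    ... | yes refl = le
    ... | no _ = ≤-refl

  -- All that the comparison of shapes and flags has to know about the swap at a peak; the
  -- permutation itself no longer occurs.
  record CodeStep {m} (i : Fin m) (c c′ : Fin (suc m) → ℕ) : Set where
    I : Fin (suc m)
    I = inject₁ i
    J : Fin (suc m)
    J = Fin.suc i
    field
      c<n : ∀ j → c j < suc m
      c′<n : ∀ j → c′ j < suc m
      code-left : c′ I ≡ suc (c J)
      code-right : c′ J ≡ c I
      code-other : ∀ j → j ≢ I → j ≢ J → c′ j ≡ c j
      code-I≤ : c I ≤ c J
      code-after : ∀ j → J Fin.≤ j → c j ≤ c J
      code-one-more : ∀ {j} → j Fin.< I → c j ≡ suc (c J) → suc (toℕ j) ≡ toℕ I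
      no-code-between : ∀ {j} → j Fin.< I → c I < c j → c j ≤ c J → ⊥
      code-plateau : ∀ {q j} → J Fin.< q → q Fin.< j → c J ≤ c j → c J ≤ c q

  -- Row s + y is as long as row s and has to be complete at `g′ s + y` at the latest; column
  -- strictness then completes row s at `g′ s`.
  Forced : ℕ → (μ g g′ : ℕ → ℕ) → ℕ → Set
  Forced n μ g g′ s = ∃[ y ] (s + y < n × μ (s + y) ≡ μ s × g (s + y) ≤ g′ s + y)

  unforced : ∀ {n} μ g g′ {s} → s < n → g s ≤ g′ s → Forced n μ g g′ s
  unforced {n} μ g g′ {s} lt le = 0 , subst (_< n) e lt , cong μ (sym e) ,
    subst₂ _≤_ (cong g e) (sym (+-identityʳ (g′ s))) le
    where e = sym (+-identityʳ s)

  module Raised {m} {i : Fin m} {c c′ : Fin (suc m) → ℕ} (codeStep : CodeStep i c c′) where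
    open CodeStep codeStep

    I<J : I Fin.< J
    I<J = s≤s (≤-reflexive (Finₚ.toℕ-inject₁ i))

    <⇒≢ : ∀ {x y : Fin (suc m)} → x Fin.< y → x ≢ y
    <⇒≢ lt refl = <-irrefl refl lt

    <J⇒≡I⊎<I : ∀ {k : Fin (suc m)} → k Fin.< J → k ≡ I ⊎ k Fin.< I
    <J⇒≡I⊎<I {k} lt with m≤n⇒m<n∨m≡n (subst (toℕ k ≤_) (sym (Finₚ.toℕ-inject₁ i)) (≤-pred lt))
    ... | inj₁ k<I = inj₂ k<I
    ... | inj₂ e = inj₁ (Finₚ.toℕ-injective e)

    code-simple-J : c′ (simple i J) ≡ suc (c J)
    code-simple-J = trans (cong c′ (simple-fsuc i)) code-left

    code-simple : ∀ j → j ≢ J → c′ (simple i j) ≡ c j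
    code-simple j j≢J with cases i j
    ... | is-left = trans (cong c′ (simple-inject₁ i)) code-right
    ... | is-right = ⊥-elim (j≢J refl)
    ... | is-other p q e = trans (cong c′ e) (code-other j p q)

    -- There are r rows longer than M, so in the sorted shape r is the first row of length M for w
    -- and becomes the last row of length M + 1 for u.
    M r : ℕ
    M = c J
    r = height c (suc M)

    μʷ μᵘ : ℕ → ℕ
    μʷ = shapeOf c
    μᵘ = shapeOf c′

    -- Up to the transposition only the entry `c J` changes, from M to M + 1, so column M + 1 alone
    -- gains a cell.
    height-same : ∀ k → k ≢ suc M → height c′ k ≡ height c k
    height-same k ne = trans (sym (cnt-simple i (λ j → k ℕ.≤? c′ j)))
      (cnt-cong (λ j → k ℕ.≤? c′ (simple i j)) (λ j → k ℕ.≤? c j) (λ j → to j (j Fin.≟ J)) (λ j → from j (j Fin.≟ J)))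
      where
      to : ∀ j → Dec (j ≡ J) → k ≤ c′ (simple i j) → k ≤ c j
      to j (yes refl) le = ≤-pred (≤∧≢⇒< (subst (k ≤_) code-simple-J le) ne)
      to j (no j≢J) le = subst (k ≤_) (code-simple j j≢J) le
      from : ∀ j → Dec (j ≡ J) → k ≤ c j → k ≤ c′ (simple i j)
      from j (yes refl) le = subst (k ≤_) (sym code-simple-J) (m≤n⇒m≤1+n le)
      from j (no j≢J) le = subst (k ≤_) (sym (code-simple j j≢J)) le

    height-bump : height c′ (suc M) ≡ suc r
    height-bump = trans (sym (cnt-simple i (λ j → suc M ℕ.≤? c′ j)))
      (cnt-insert (λ j → suc M ℕ.≤? c j) (λ j → suc M ℕ.≤? c′ (simple i j)) J (<-irrefl refl)
        (≤-reflexive (sym code-simple-J)) (λ j → to j (j Fin.≟ J)) (λ j → from j (j Fin.≟ J)))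
      where
      to : ∀ j → Dec (j ≡ J) → suc M ≤ c j → suc M ≤ c′ (simple i j)
      to j (yes refl) le = ≤-reflexive (sym code-simple-J)
      to j (no j≢J) le = subst (suc M ≤_) (sym (code-simple j j≢J)) le
      from : ∀ j → Dec (j ≡ J) → suc M ≤ c′ (simple i j) → j ≡ J ⊎ suc M ≤ c j
      from j (yes e) le = inj₁ e
      from j (no j≢J) le = inj₂ (subst (suc M ≤_) (code-simple j j≢J) le)

    μᵘ-r : μᵘ r ≡ suc M
    μᵘ-r = ≤-antisym
      (shape≤ c′ c′<n (λ lt → <⇒≱ (subst (r <_) (height-same (2 + M) (λ e → <-irrefl (sym e) ≤-refl)) lt) (height-anti c (n≤1+n (suc M)))))
      (height⇒shape c′ c′<n (subst (r <_) (sym height-bump) ≤-refl))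

    height-M : r < height c M
    height-M = cnt-strict (λ j → suc M ℕ.≤? c j) (λ j → M ℕ.≤? c j) J (λ j → ≤-trans (n≤1+n M)) (<-irrefl refl) ≤-refl

    μʷ-r : μʷ r ≡ M
    μʷ-r = ≤-antisym (shape≤ c c<n (<-irrefl refl)) (height⇒shape c c<n height-M)

    μ-other : ∀ s → s ≢ r → μᵘ s ≡ μʷ s
    μ-other s ne = ≤-antisym (shape-ext c′ c c′<n c<n s to) (shape-ext c c′ c<n c′<n s from)
      where
      to : ∀ k → 0 < k → s < height c′ k → s < height c k
      to k _ lt with k ℕ.≟ suc M
      ... | yes refl = ≤∧≢⇒< (≤-pred (subst (s <_) height-bump lt)) ne
      ... | no k≢ = subst (s <_) (height-same k k≢) lt
      from : ∀ k → 0 < k → s < height c k → s < height c′ k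
      from k _ lt with k ℕ.≟ suc M
      ... | yes refl = subst (s <_) (sym height-bump) (m<n⇒m<1+n lt)
      ... | no k≢ = subst (s <_) (sym (height-same k k≢)) lt

    r<n : r < suc m
    r<n = <-≤-trans height-M (cnt≤n (λ j → M ℕ.≤? c j))

    iℕ : ℕ
    iℕ = toℕ i

    toℕI : toℕ I ≡ iℕ
    toℕI = Finₚ.toℕ-inject₁ i

    high⇒<I : ∀ {k} j → M < k → k ≤ c j → j Fin.< I
    high⇒<I {k} j M<k le with <-cmp (toℕ j) (toℕ I)
    ... | tri< lt _ _ = lt
    ... | tri≈ _ e _ = ⊥-elim (<⇒≱ (<-≤-trans M<k le) (subst (λ x → c x ≤ M) (sym (Finₚ.toℕ-injective e)) code-I≤))
    ... | tri> _ _ gt = ⊥-elim (<⇒≱ (<-≤-trans M<k le) (code-after j (subst (_< toℕ j) toℕI gt)))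

    above : ∀ {s} → s < r → M < μʷ s
    above lt = height⇒shape c c<n lt

    below : ∀ {s} → r ≤ s → μʷ s ≤ M
    below le = shape≤ c c<n (≤⇒≯ le)

    -- The flags of w in all rows except r. Agreement outside row r is what `Raising` asks for; the
    -- true flags of u and w need not agree there.
    gʷ gᵘ : ℕ → ℕ
    gʷ = override r (suc iℕ) (flag c)
    gᵘ = override r iℕ (flag c)

    gʷ-r : gʷ r ≡ suc iℕ
    gʷ-r = override-at r (suc iℕ) (flag c)

    gᵘ-r : gᵘ r ≡ iℕ
    gᵘ-r = override-at r iℕ (flag c)

    gʷ-other : ∀ s → s ≢ r → gʷ s ≡ flag c s
    gʷ-other = override-other r (suc iℕ) (flag c)

    gᵘ-other : ∀ s → s ≢ r → gᵘ s ≡ flag c s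
    gᵘ-other = override-other r iℕ (flag c)

    sat : ∀ {s} → 0 < μʷ s → ∃[ j ] (μʷ s ≤ c j × toℕ j ≡ flag c s)
    sat {s} pos = lastRow-sat c (shape⇒height c {s = s} pos ≤-refl)

    raising : Raising (suc m) μᵘ μʷ gᵘ gʷ r iℕ M
    raising = record
      { r<R = r<n ; μᵘ-r = μᵘ-r ; μʷ-r = μʷ-r ; μ-other = μ-other ; μᵘ-anti = shape-anti c′ c′<n
      ; μʷ-next = below (n≤1+n r) ; gᵘ-r = gᵘ-r ; gʷ-r = gʷ-r
      ; g-other = λ s ne → trans (gᵘ-other s ne) (sym (gʷ-other s ne))
      ; g-above = λ s lt → subst (_< iℕ) (sym (gʷ-other s (ℕₚ.<⇒≢ lt))) (flag-above lt)
      ; g-below = λ s lt → subst (iℕ <_) (sym (gʷ-other s (λ e → <-irrefl (sym e) lt))) (lastRow-max c J (below (<⇒≤ lt))) }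
      where
      flag-above : ∀ {s} → s < r → flag c s < iℕ
      flag-above {s} lt with sat {s} (≤-<-trans z≤n (above lt))
      ... | j , le , e = subst₂ _<_ e toℕI (high⇒<I j (above lt) le)

    gʷ≤ : ∀ s → gʷ s ≤ flag c s
    gʷ≤ = override-≤ r (suc iℕ) (flag c) (lastRow-max c J (≤-reflexive μʷ-r))

    -- By `code-plateau` all positions from J up to the last row E with at least M cells have at
    -- least M cells, and these E - i rows follow the r longer ones in the sorted shape. So with y =
    -- E - i - 1 row r + y still has length M, and its flag E equals i + 1 + y.
    forcedʷ : ∀ s → s < suc m → 0 < μʷ s → Forced (suc m) μʷ (flag c) gʷ s
    forcedʷ s lt pos with s ℕ.≟ r
    ... | no ne = unforced μʷ (flag c) gʷ lt (≤-reflexive (sym (gʷ-other s ne)))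
    ... | yes refl = y , <-≤-trans in-column (cnt≤n (λ j → M ℕ.≤? c j)) , trans μ-y (sym μʷ-r) ,
        subst₂ _≤_ (cong (lastRow c) (sym μ-y)) (cong (_+ y) (sym gʷ-r)) (≤-reflexive (sym (m+[n∸m]≡n i<E)))
      where
      E = lastRow c M
      i<E : suc iℕ ≤ E
      i<E = lastRow-max c J ≤-refl
      y = E ∸ suc iℕ
      E-sat = lastRow-sat c height-M
      e = proj₁ E-sat
      between : ∀ q → suc iℕ ≤ toℕ q → toℕ q ≤ E → M ≤ c q
      between q lo hi with m≤n⇒m<n∨m≡n lo | m≤n⇒m<n∨m≡n hi
      ... | inj₂ q≡J | _ = ≤-reflexive (cong c (Finₚ.toℕ-injective q≡J))
      ... | inj₁ _ | inj₂ q≡E = subst (λ x → M ≤ c x) (Finₚ.toℕ-injective (trans (proj₂ (proj₂ E-sat)) (sym q≡E))) (proj₁ (proj₂ E-sat))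
      ... | inj₁ J<q | inj₁ q<E = code-plateau J<q (subst (toℕ q <_) (sym (proj₂ (proj₂ E-sat))) q<E) (proj₁ (proj₂ E-sat))
      total : suc iℕ + suc y ≡ suc E
      total = trans (+-suc (suc iℕ) y) (cong suc (m+[n∸m]≡n i<E))
      Range? : ∀ (j : Fin (suc m)) → Dec (suc iℕ ≤ toℕ j × toℕ j < suc iℕ + suc y)
      Range? j = (suc iℕ ℕ.≤? toℕ j) ×-dec (toℕ j ℕ.<? suc iℕ + suc y)
      in-column : r + y < height c M
      in-column = ≤-trans (≤-reflexive (sym (+-suc r y))) (≤-trans
        (+-monoʳ-≤ r (cnt-range {suc m} (suc iℕ) (suc y) (≤-trans (≤-reflexive total) (lastRow< c M))))
        (cnt-disjoint (λ j → suc M ℕ.≤? c j) Range? (λ j → M ℕ.≤? c j)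
          (λ j hi (lo , _) → <⇒≱ hi (code-after j lo)) (λ j → <⇒≤)
          (λ j (lo , hi) → between j lo (≤-pred (subst (toℕ j <_) total hi)))))
      μ-y : μʷ (r + y) ≡ M
      μ-y = ≤-antisym (below (m≤m+n r y)) (height⇒shape c c<n in-column)

    code-c′-other : ∀ {j k} → k ≤ c′ j → M < k → j ≢ I → k ≤ c j
    code-c′-other {j} {k} le M<k j≢I with j Fin.≟ J
    ... | yes refl = ⊥-elim (<⇒≱ (<-≤-trans M<k (subst (k ≤_) code-right le)) code-I≤)
    ... | no j≢J = subst (k ≤_) (code-other j j≢I j≢J) le

    top-flag : lastRow c′ (suc M) ≤ iℕ
    top-flag with lastRow-sat c′ {suc M} {r} (subst (r <_) (sym height-bump) ≤-refl)
    ... | j , le , e with j Fin.≟ I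
    ...   | yes refl = ≤-reflexive (trans (sym e) toℕI)
    ...   | no j≢I = <⇒≤ (subst₂ _<_ e toℕI (high⇒<I j ≤-refl (code-c′-other le ≤-refl j≢I)))

    -- Only J can drop out, when `c I < k`. Column k has more than r + 1 cells, so a further row has
    -- length between k and M. It precedes J if J was the last such row, is not I, and cannot
    -- precede I by `no-code-between`.
    low-flag≤ : ∀ {k s} → k ≤ M → r < s → s < height c k → lastRow c k ≤ lastRow c′ k
    low-flag≤ {k} {s} k≤M r<s lt with lastRow-sat c lt
    ... | j , le , e with cases i j
    ...   | is-other p q _ = subst (_≤ lastRow c′ k) e (lastRow-max c′ j (subst (k ≤_) (sym (code-other j p q)) le))
    ...   | is-left = subst (_≤ lastRow c′ k) e (lastRow-max c′ I (subst (k ≤_) (sym code-left) (m≤n⇒m≤1+n k≤M)))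
    ...   | is-right with k ℕ.≤? c I
    ...     | yes k≤ = subst (_≤ lastRow c′ k) e (lastRow-max c′ J (subst (k ≤_) (sym code-right) k≤))
    ...     | no k≰ = ⊥-elim (contra (cnt-surplus P? (λ j → k ℕ.≤? c j) big))
      where
      P? : ∀ j → Dec (j ≡ J ⊎ suc M ≤ c j)
      P? j = (j Fin.≟ J) ⊎-dec (suc M ℕ.≤? c j)
      big : cnt P? < height c k
      big = ≤-<-trans (≤-reflexive (cnt-insert (λ j → suc M ℕ.≤? c j) P? J (<-irrefl refl) (inj₁ refl) (λ _ → inj₂) (λ _ p → p)))
        (≤-<-trans r<s lt)
      contra : ∃[ j ] (k ≤ c j × ¬ (j ≡ J ⊎ suc M ≤ c j)) → ⊥
      contra (j , k≤cj , ¬p) with <J⇒≡I⊎<I (≤∧≢⇒< (subst (toℕ j ≤_) (sym e) (lastRow-max c j k≤cj)) (λ q → ¬p (inj₁ (Finₚ.toℕ-injective q))))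
      ... | inj₁ refl = k≰ k≤cj
      ... | inj₂ j<I = no-code-between j<I (<-≤-trans (≰⇒> k≰) k≤cj) (≮⇒≥ (λ lt → ¬p (inj₂ lt)))

    low-flag≥ : ∀ {k s} → k ≤ M → s < height c′ k → lastRow c′ k ≤ lastRow c k
    low-flag≥ {k} k≤M lt with lastRow-sat c′ lt
    ... | j , le , e with cases i j
    ...   | is-other p q _ = subst (_≤ lastRow c k) e (lastRow-max c j (subst (k ≤_) (code-other j p q) le))
    ...   | is-left = ≤-trans (subst (_≤ toℕ J) e (<⇒≤ I<J)) (lastRow-max c J k≤M)
    ...   | is-right = subst (_≤ lastRow c k) e (lastRow-max c J k≤M)

    gᵘ≤ : ∀ s → s < suc m → 0 < μᵘ s → gᵘ s ≤ flag c′ s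
    gᵘ≤ s lt pos with <-cmp s r
    ... | tri≈ _ refl _ = subst₂ _≤_ (trans toℕI (sym gᵘ-r)) refl (lastRow-max c′ I (≤-reflexive (trans μᵘ-r (sym code-left))))
    ... | tri> _ ne gt = subst₂ _≤_ (sym (gᵘ-other s ne)) (cong (lastRow c′) (sym (μ-other s ne)))
          (low-flag≤ (below (<⇒≤ gt)) gt (shape⇒height c (subst (0 <_) (μ-other s ne) pos) ≤-refl))
    ... | tri< s<r ne _ with sat {s} (subst (0 <_) (μ-other s ne) pos)
    ...   | j , le , e = subst₂ _≤_ (trans e (sym (gᵘ-other s ne))) refl (lastRow-max c′ j (subst₂ _≤_ (sym (μ-other s ne)) (sym (code-other j j≢I j≢J)) le))
      where
      j<I = high⇒<I j (above s<r) le
      j≢I : j ≢ I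
      j≢I = <⇒≢ j<I
      j≢J : j ≢ J
      j≢J = <⇒≢ (<-trans j<I I<J)

    -- Outside the rows of length M + 1 before r, the adjusted flag is already at least the true
    -- flag. In those rows it may be smaller, and the next row of the same length has to supply the
    -- bound.
    forcedᵘ : ∀ s → s < suc m → 0 < μᵘ s → Forced (suc m) μᵘ (flag c′) gᵘ s
    forcedᵘ s lt pos with <-cmp s r
    ... | tri≈ _ refl _ = unforced μᵘ (flag c′) gᵘ lt (subst₂ _≤_ (cong (lastRow c′) (sym μᵘ-r)) (sym gᵘ-r) top-flag)
    ... | tri> _ ne gt = unforced μᵘ (flag c′) gᵘ lt (subst₂ _≤_ refl (sym (trans (gᵘ-other s ne) (cong (lastRow c) (sym (μ-other s ne)))))
          (low-flag≥ (subst (_≤ M) (sym (μ-other s ne)) (below (<⇒≤ gt))) (shape⇒height c′ pos ≤-refl)))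
    ... | tri< s<r ne _ with μᵘ s ℕ.≟ suc M
    ...   | no ne′ with lastRow-sat c′ (shape⇒height c′ {s = s} pos ≤-refl)
    ...     | j , le , e = unforced μᵘ (flag c′) gᵘ lt (subst₂ _≤_ e (sym (trans (gᵘ-other s ne) (cong (lastRow c) (sym (μ-other s ne)))))
                (lastRow-max c j (code-c′-other le (<-trans ≤-refl M+1<) j≢I)))
      where
      M+1< : suc M < μᵘ s
      M+1< = ≤∧≢⇒< (subst (M <_) (sym (μ-other s ne)) (above s<r)) (ne′ ∘ sym)
      j≢I : j ≢ I
      j≢I refl = <⇒≱ M+1< (subst (μᵘ s ≤_) code-left le)
    -- One row further suffices: its true flag is at most i, and the adjusted flag of row s is at
    -- least i - 1, because some row of w has exactly M + 1 cells and `code-one-more` places it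
    -- directly before I.
    forcedᵘ s lt pos | tri< s<r ne _ | yes eq = 1 , subst (_< suc m) (sym (+-comm s 1)) (≤-<-trans s<r r<n) ,
        trans next (sym eq) , subst₂ _≤_ (cong (lastRow c′) (sym next)) (trans (+-comm 1 (flag c s)) (cong (_+ 1) (sym (gᵘ-other s ne)))) (≤-trans top-flag prev)
      where
      next : μᵘ (s + 1) ≡ suc M
      next = trans (cong μᵘ (+-comm s 1)) (≤-antisym (≤-trans (shape-anti c′ c′<n s) (≤-reflexive eq))
        (height⇒shape c′ c′<n (subst (suc s <_) (sym height-bump) (s≤s s<r))))
      μʷs : μʷ s ≡ suc M
      μʷs = trans (sym (μ-other s ne)) eq
      prev : iℕ ≤ suc (flag c s)
      prev with cnt-surplus (λ j → suc (suc M) ℕ.≤? c j) (λ j → suc M ℕ.≤? c j)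
            (≤-<-trans (≮⇒≥ (λ lt → <-irrefl refl (subst (2 + M ≤_) μʷs (height⇒shape c c<n lt)))) s<r)
      ... | j , le , ¬le = subst₂ _≤_ (trans (code-one-more j<I (≤-antisym (≤-pred (≰⇒> ¬le)) le)) toℕI) refl
          (s≤s (subst (toℕ j ≤_) (cong (lastRow c) (sym μʷs)) (lastRow-max c j le)))
        where
        j<I = high⇒<I j ≤-refl le

open Shapes

-- Schubert functionals as sums over flagged tableaux.

module Tableaux where
  open import Data.Nat as ℕ using (ℕ; zero; suc; _∸_; _≤_; _<_; s≤s; z≤n; _+_)
  open import Data.Integer using (ℤ)
  open import Data.Fin as Fin using (Fin; toℕ; inject₁)
  import Data.Fin.Properties as Finₚ
  open import Data.Vec as Vec using (Vec; []; _∷_)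
  import Data.Vec.Properties as Vecₚ
  open import Data.Empty using (⊥-elim)
  open import Data.Product using (∃; _×_; _,_; proj₁)
  open import Function using (_∘_)
  open import Relation.Nullary using (¬_; Dec; yes; no)
  open import Relation.Nullary.Decidable using (_×-dec_)
  open import Relation.Binary using (tri<; tri≈; tri>)
  open import Relation.Binary.PropositionalEquality hiding (J)
  open import Data.Nat.Properties using (+-identityʳ; +-suc; <-cmp; <-irrefl; <⇒≤; <⇒≱; m+n∸n≡m; m<n⇒m<1+n; m∸n≤m; m≤m+n; n≤0⇒n≡0; n≤1+n; ∸-cancelʳ-≤; ∸-monoʳ-≤; ≤-<-trans; ≤-antisym; ≤-pred; ≤-refl; ≤-reflexive; ≤-trans; ≤⇒≯; ≤∧≢⇒<; ≮⇒≥; ≰⇒>)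
  open ≡-Reasoning

  peak⇒codeStep : ∀ {m} {f : Fin (suc m) → ℕ} {i : Fin m} → Peak f i → CodeStep i (code f) (code (f ∘ simple i))
  peak⇒codeStep {m} {f} {i} peak = record
    { c<n = code< f ; c′<n = code< (f ∘ simple i)
    ; code-left = code-left ; code-right = code-right ; code-other = code-other
    ; code-I≤ = code-I≤ ; code-after = code-after ; code-one-more = code-one-more
    ; no-code-between = no-code-between ; code-plateau = code-plateau }
    where
    open PeakProperties peak
    open Swap f i (Peak.asc peak) using (code-left; code-right; code-other)

  cnt-above : ∀ n x → cnt {n} (λ k → x ℕ.<? toℕ k) ≡ n ∸ suc x
  cnt-above zero x = refl
  cnt-above (suc n) zero = trans (cnt-cong {n} (λ k → 0 ℕ.<? suc (toℕ k)) (λ k → yes (refl {x = k})) (λ _ _ → refl) (λ _ _ → s≤s z≤n)) (cnt-all n)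
  cnt-above (suc n) (suc x) = trans (cnt-cong {n} (λ k → suc x ℕ.<? suc (toℕ k)) (λ k → x ℕ.<? toℕ k) (λ _ → ≤-pred) (λ _ → s≤s)) (cnt-above n x)

  cnt-below : ∀ n x → cnt {n} (λ k → toℕ k ℕ.<? x) ≤ x
  cnt-below zero x = z≤n
  cnt-below (suc n) zero = ≤-trans (cnt-mono {n} (λ k → suc (toℕ k) ℕ.<? 0) (λ k → toℕ k ℕ.<? 0) (λ _ ())) (cnt-below n 0)
  cnt-below (suc n) (suc x) = s≤s (≤-trans (cnt-mono {n} (λ k → suc (toℕ k) ℕ.<? suc x) (λ k → toℕ k ℕ.<? x) (λ _ → ≤-pred)) (cnt-below n x))

  decreasing : ∀ {m} (f : Fin (suc m) → ℕ) → Injective f → (∀ i → ¬ Asc f i) → ∀ j k → j Fin.< k → f k < f j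
  decreasing {m} f inj none j k lt = go (toℕ k) k ≤-refl lt
    where
    go : ∀ N (k : Fin (suc m)) → toℕ k ≤ N → j Fin.< k → f k < f j
    go (suc N) (Fin.suc k) (s≤s le) lt with toℕ j ℕ.≟ toℕ k
    ... | yes e = subst (λ x → f (Fin.suc k) < f x) (Finₚ.toℕ-injective (trans (Finₚ.toℕ-inject₁ k) (sym e))) desc
      where
      desc : f (Fin.suc k) < f (inject₁ k)
      desc = ≤∧≢⇒< (≮⇒≥ (none k)) (λ e → <-irrefl (trans (sym (Finₚ.toℕ-inject₁ k)) (cong toℕ (sym (inj e)))) ≤-refl)
    ... | no ne = ≤-<-trans (≮⇒≥ (none k)) (go N (inject₁ k) (subst (_≤ N) (sym (Finₚ.toℕ-inject₁ k)) le)
        (subst (toℕ j <_) (sym (Finₚ.toℕ-inject₁ k)) (≤∧≢⇒< (≤-pred lt) ne)))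

  code-longest : ∀ {m} (f : Fin (suc m) → ℕ) → Injective f → (∀ i → ¬ Asc f i) → ∀ j → code f j ≡ m ∸ toℕ j
  code-longest {m} f inj none j = trans
    (cnt-cong (Inv? f j) (λ k → toℕ j ℕ.<? toℕ k) (λ k → proj₁) (λ k lt → lt , decreasing f inj none j k lt)) (cnt-above (suc m) (toℕ j))

  descent : ∀ m k → ℕ → Vec ℕ k
  descent m zero t = []
  descent m (suc k) t = m ∸ t ∷ descent m k (suc t)

  staircase≡descent : ∀ m → staircase (suc m) ≡ descent m (suc m) 0
  staircase≡descent m = go (suc m) 0
    where
    go : ∀ k t → Vec.tabulate {n = k} (λ i → m ∸ (t + toℕ i)) ≡ descent m k t
    go zero t = refl
    go (suc k) t = cong₂ _∷_ (cong (m ∸_) (+-identityʳ t)) (trans (Vecₚ.tabulate-cong (λ i → cong (m ∸_) (+-suc t (toℕ i)))) (go k (suc t)))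

  -- Opaque, so that sums over a box are never unfolded by conversion checking.
  abstract
    bound : ℕ → ℕ
    bound n = n

    <bound : ∀ {x n} → x < n → x < bound n
    <bound lt = lt

  -- For the longest permutation the flag of row s is s, so column strictness and flags leave one
  -- tableau only, with all entries of row s equal to s.
  module Staircase {m} (c : Fin (suc m) → ℕ) (c<n : ∀ j → c j < suc m) (c≡ : ∀ j → c j ≡ m ∸ toℕ j) where
    open Box (bound (suc m))
    open Chains (bound (suc m)) (suc m)

    tall : ∀ s → s ≤ m → s < height c (m ∸ s)
    tall s s≤m = ≤-trans (cnt-range {suc m} 0 (suc s) (s≤s s≤m))
      (cnt-mono (λ j → (0 ℕ.≤? toℕ j) ×-dec (toℕ j ℕ.<? suc s)) (λ j → (m ∸ s) ℕ.≤? c j)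
        (λ j (_ , lt) → subst (m ∸ s ≤_) (sym (c≡ j)) (∸-monoʳ-≤ m (≤-pred lt))))

    shape-s : ∀ s → s ≤ m → shapeOf c s ≡ m ∸ s
    shape-s s s≤m = ≤-antisym (shape≤ c c<n (≤⇒≯ low)) (height⇒shape c c<n (tall s s≤m))
      where
      low : height c (suc (m ∸ s)) ≤ s
      low = ≤-trans (cnt-mono (λ j → suc (m ∸ s) ℕ.≤? c j) (λ j → toℕ j ℕ.<? s)
        (λ j lt → ≰⇒> (λ s≤j → <⇒≱ (subst (m ∸ s <_) (c≡ j) lt) (∸-monoʳ-≤ m s≤j)))) (cnt-below (suc m) s)

    flag-s : ∀ s → s ≤ m → flag c s ≡ s
    flag-s s s≤m = trans (cong (lastRow c) (shape-s s s≤m)) (≤-antisym hi lo)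
      where
      hi : lastRow c (m ∸ s) ≤ s
      hi with lastRow-sat c (tall s s≤m)
      ... | j , le , e = subst (_≤ s) e (∸-cancelʳ-≤ (≤-pred (Finₚ.toℕ<n j)) (subst (m ∸ s ≤_) (c≡ j) le))
      lo : s ≤ lastRow c (m ∸ s)
      lo = subst (_≤ lastRow c (m ∸ s)) (Finₚ.toℕ-fromℕ< (s≤s s≤m)) (lastRow-max c (Fin.fromℕ< (s≤s s≤m))
        (≤-reflexive (sym (trans (c≡ _) (cong (m ∸_) (Finₚ.toℕ-fromℕ< (s≤s s≤m)))))))

    -- The layer of entries below t of this tableau: the rows before t are complete, the others
    -- empty.
    stair : ℕ → ℕ → ℕ
    stair t s with s ℕ.<? t
    ... | yes _ = m ∸ s
    ... | no _ = 0

    stair-< : ∀ {t s} → s < t → stair t s ≡ m ∸ s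
    stair-< {t} {s} lt with s ℕ.<? t
    ... | yes _ = refl
    ... | no ≮ = ⊥-elim (≮ lt)

    stair-≥ : ∀ {t s} → t ≤ s → stair t s ≡ 0
    stair-≥ {t} {s} le with s ℕ.<? t
    ... | yes lt = ⊥-elim (<⇒≱ lt le)
    ... | no _ = refl

    stair-≤ : ∀ t s → stair t s ≤ m ∸ s
    stair-≤ t s with s ℕ.<? t
    ... | yes _ = ≤-refl
    ... | no _ = z≤n

    IsStair : ℕ → Vec ℕ (suc m) → Set
    IsStair t α = ∀ s → s ≤ m → at α s ≡ stair t s

    next-stair : ∀ {t α β} → t ≤ m → IsStair t α → Step (shapeOf c) (flag c) t α β → IsStair (suc t) β
    next-stair {t} {α} {β} t≤m st step s s≤m with s ℕ.≤? t
    next-stair {t} {α} {β} t≤m st step s s≤m | yes s≤t = trans (full step s (s≤s s≤m) (subst (_≤ t) (sym (flag-s s s≤m)) s≤t)) (trans (shape-s s s≤m) (sym (stair-< (s≤s s≤t))))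
    next-stair {t} {α} {β} t≤m st step zero s≤m | no s≰t = ⊥-elim (s≰t z≤n)
    next-stair {t} {α} {β} t≤m st step (suc s) s≤m | no s≰t = trans
      (n≤0⇒n≡0 (subst (at β (suc s) ≤_) (trans (st s (<⇒≤ s≤m)) (stair-≥ (≤-pred (≰⇒> s≰t)))) (strip step s)))
      (sym (stair-≥ (≰⇒> s≰t)))

    stair-step : ∀ {t α β} → t ≤ m → IsStair t α → IsStair (suc t) β → Step (shapeOf c) (flag c) t α β
    stair-step {t} {α} {β} t≤m sα sβ = mkStep grow′ fit′ strip′ full′
      where
      by : ∀ {P : ℕ → Set} → (∀ s → s ≤ m → P s) → (∀ s → suc m ≤ s → P s) → ∀ s → P s
      by h z s with s ℕ.≤? m
      ... | yes le = h s le
      ... | no ≰ = z s (≰⇒> ≰)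
      mono : ∀ s → stair t s ≤ stair (suc t) s
      mono s with s ℕ.<? t
      ... | yes lt = ≤-reflexive (sym (stair-< (m<n⇒m<1+n lt)))
      ... | no _ = z≤n
      drop : ∀ s → stair (suc t) (suc s) ≤ stair t s
      drop s with suc s ℕ.<? suc t
      ... | yes (s≤s lt) = ≤-trans (∸-monoʳ-≤ m (n≤1+n s)) (≤-reflexive (sym (stair-< lt)))
      ... | no _ = z≤n
      grow′ : ∀ s → at α s ≤ at β s
      grow′ = by (λ s le → subst₂ _≤_ (sym (sα s le)) (sym (sβ s le)) (mono s)) (λ s ge → subst (_≤ at β s) (sym (at-beyond α s ge)) z≤n)
      fit′ : ∀ s → at β s ≤ shapeOf c s
      fit′ = by (λ s le → subst₂ _≤_ (sym (sβ s le)) (sym (shape-s s le)) (stair-≤ (suc t) s)) (λ s ge → subst (_≤ shapeOf c s) (sym (at-beyond β s ge)) z≤n)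
      strip′ : ∀ s → at β (suc s) ≤ at α s
      strip′ s with suc s ℕ.≤? m
      ... | yes le = subst₂ _≤_ (sym (sβ (suc s) le)) (sym (sα s (<⇒≤ le))) (drop s)
      ... | no ≰ = subst (_≤ at α s) (sym (at-beyond β (suc s) (≰⇒> ≰))) z≤n
      full′ : ∀ s → s < suc m → flag c s ≤ t → at β s ≡ shapeOf c s
      full′ s (s≤s le) fl = trans (sβ s le) (trans (stair-< (s≤s (subst (_≤ t) (flag-s s le) fl))) (sym (shape-s s le)))

    stair-size : ∀ {t α β} → t ≤ m → IsStair t α → IsStair (suc t) β → size β ∸ size α ≡ m ∸ t
    stair-size {t} {α} {β} t≤m sα sβ = trans (cong (_∸ size α) total) (m+n∸n≡m (m ∸ t) (size α))
      where
      others : ∀ s → s ≢ t → at β s ≡ at α s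
      others s ne with s ℕ.≤? m
      ... | no ≰ = trans (at-beyond β s (≰⇒> ≰)) (sym (at-beyond α s (≰⇒> ≰)))
      ... | yes le with <-cmp s t
      ...   | tri< lt _ _ = trans (sβ s le) (trans (stair-< (m<n⇒m<1+n lt)) (sym (trans (sα s le) (stair-< lt))))
      ...   | tri≈ _ e _ = ⊥-elim (ne e)
      ...   | tri> _ _ gt = trans (sβ s le) (trans (stair-≥ gt) (sym (trans (sα s le) (stair-≥ (<⇒≤ gt)))))
      total : size β ≡ (m ∸ t) + size α
      total = trans (cong (_+ size β) (sym (trans (sα t t≤m) (stair-≥ {t} {t} ≤-refl))))
        (trans (size-exchange t β α (s≤s t≤m) others) (cong (_+ size α) (trans (sβ t t≤m) (stair-< {suc t} {t} ≤-refl))))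

    S-staircase : ∀ k t → t + k ≡ suc m → ∀ α → IsStair t α → ∀ φ → S (shapeOf c) (flag c) k t α φ ≡ φ (descent m k t)
    S-staircase zero t e α st φ = refl
    S-staircase (suc k) t e α st φ = begin
      ΣB (suc m) (λ β → when (step? (shapeOf c) (flag c) t α β) (rest β))
        ≡⟨ ΣB-single (suc m) (λ β → when (step? (shapeOf c) (flag c) t α β) (rest β)) w w<B
             (λ v ne → when-no (step? (shapeOf c) (flag c) t α v) (λ step → ne (same v (next-stair {t} {α} {v} t≤m st step)))) ⟩
      when (step? (shapeOf c) (flag c) t α w) (rest w)
        ≡⟨ when-yes (step? (shapeOf c) (flag c) t α w) (stair-step {t} {α} {w} t≤m st w-stair) ⟩
      rest w
        ≡⟨ S-staircase k (suc t) (trans (sym (+-suc t k)) e) w w-stair (λ v → φ (size w ∸ size α ∷ v)) ⟩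
      φ (size w ∸ size α ∷ descent m k (suc t)) ≡⟨ cong (λ x → φ (x ∷ descent m k (suc t))) (stair-size {t} {α} {w} t≤m st w-stair) ⟩
      φ (descent m (suc k) t) ∎
      where
      rest : Vec ℕ (suc m) → ℤ
      rest β = S (shapeOf c) (flag c) k (suc t) β (λ v → φ (size β ∸ size α ∷ v))
      t≤m : t ≤ m
      t≤m = ≤-pred (subst (suc t ≤_) e (subst (suc t ≤_) (sym (+-suc t k)) (s≤s (m≤m+n t k))))
      w : Vec ℕ (suc m)
      w = vecOf (suc m) (stair (suc t))
      w-stair : IsStair (suc t) w
      w-stair s le = at-vecOf (suc m) (stair (suc t)) s (s≤s le)
      w<B : ∀ s → s < suc m → at w s < bound (suc m)
      w<B s (s≤s le) = <bound (s≤s (≤-trans (≤-reflexive (w-stair s le)) (≤-trans (stair-≤ (suc t) s) (m∸n≤m m s))))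
      same : ∀ v → IsStair (suc t) v → ∀ s → at v s ≡ at w s
      same v sv s with s ℕ.≤? m
      ... | yes le = trans (sv s le) (sym (w-stair s le))
      ... | no ≰ = trans (at-beyond v s (≰⇒> ≰)) (sym (at-beyond w s (≰⇒> ≰)))

  zeros : ∀ n → Vec ℕ n
  zeros n = vecOf n (λ _ → 0)

  at-zeros : ∀ n s → at (zeros n) s ≡ 0
  at-zeros zero s = refl
  at-zeros (suc n) zero = refl
  at-zeros (suc n) (suc s) = at-zeros n s

  Reflag : ℕ → (μ g g′ : ℕ → ℕ) → Set
  Reflag R μ g g′ = (∀ s → μ (suc s) ≤ μ s) × (∀ s → s < R → 0 < μ s → g′ s ≤ g s) × (∀ s → s < R → 0 < μ s → Forced R μ g g′ s)

  module _ (B R : ℕ) where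
    open Chains B R

    -- The true flags h are replaced by the adjusted flags g, for which `raise` applies, and are
    -- then restored on the other side.
    raise-reflagged : ∀ {μᵘ μʷ gᵘ gʷ hᵘ hʷ : ℕ → ℕ} {r m} k (j : Fin (suc k)) → Raising R μᵘ μʷ gᵘ gʷ r (toℕ j) m → (∀ s → μᵘ s < B) →
      Reflag R μᵘ hᵘ gᵘ → Reflag R μʷ hʷ gʷ → (∀ s → hᵘ s < suc (suc k)) → (∀ s → hʷ s < suc (suc k)) →
      ∀ z → (∀ s → at z s ≡ 0) → ∀ φ → S μᵘ hᵘ (suc (suc k)) 0 z (∂* j φ) ≡ S μʷ hʷ (suc (suc k)) 0 z φ
    raise-reflagged {μᵘ} {μʷ} {gᵘ} {gʷ} {hᵘ} {hʷ} {r} {m} k j raising bd (a , b , c) (a′ , b′ , c′) h< h<′ z z≡0 φ = begin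
      S μᵘ hᵘ (suc (suc k)) 0 z (∂* j φ) ≡⟨ reflag μᵘ hᵘ gᵘ a b c (suc (suc k)) 0 h< z (∂* j φ) ⟩
      S μᵘ gᵘ (suc (suc k)) 0 z (∂* j φ) ≡⟨ raise k j 0 (+-identityʳ (toℕ j)) z φ (subst (_≤ suc m) (sym (z≡0 r)) z≤n) start ⟩
      S μʷ gʷ (suc (suc k)) 0 z φ ≡⟨ sym (reflag μʷ hʷ gʷ a′ b′ c′ (suc (suc k)) 0 h<′ z φ) ⟩
      S μʷ hʷ (suc (suc k)) 0 z φ ∎
      where
      open Raise B R raising bd using (raise; Full)
      start : 0 ≡ toℕ j → Full z
      -- For i = 0 no row precedes r, since its flag would have to be smaller than 0.
      start e s s<r = ⊥-elim (<⇒≱ (Raising.g-above raising s s<r) (subst (_≤ gʷ s) e z≤n))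

  abstract
    tableaux : ∀ {m} → (Fin (suc m) → ℕ) → Functional (suc m) → ℤ
    tableaux {m} c = Chains.S (bound (suc m)) (suc m) (shapeOf c) (flag c) (suc m) 0 (zeros (suc m))

    tableaux-def : ∀ {m} (c : Fin (suc m) → ℕ) φ → tableaux c φ ≡ Chains.S (bound (suc m)) (suc m) (shapeOf c) (flag c) (suc m) 0 (zeros (suc m)) φ
    tableaux-def c φ = refl

  tableaux-raise : ∀ {m} {i : Fin m} {c c′ : Fin (suc m) → ℕ} → CodeStep i c c′ → ∀ φ → tableaux c′ (∂* i φ) ≡ tableaux c φ
  tableaux-raise {suc k} {i} {c} {c′} codeStep φ = trans (tableaux-def c′ (∂* i φ)) (trans (raise-reflagged (bound (suc (suc k))) (suc (suc k)) k i raising (λ s → <bound (shape<n c′ c′<n s))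
    (shape-anti c′ c′<n , gᵘ≤ , forcedᵘ) (shape-anti c c<n , (λ s _ _ → gʷ≤ s) , forcedʷ)
    (λ s → lastRow< c′ (shapeOf c′ s)) (λ s → lastRow< c (shapeOf c s)) (zeros (suc (suc k))) (at-zeros (suc (suc k))) φ) (sym (tableaux-def c φ)))
    where
    open CodeStep codeStep
    open Raised codeStep

  tableaux-none : ∀ {m} (f : Fin (suc m) → ℕ) → Injective f → (∀ i → ¬ Asc f i) → ∀ φ → tableaux (code f) φ ≡ φ (staircase (suc m))
  tableaux-none {m} f inj none φ = trans (tableaux-def (code f) φ) (trans
    (Staircase.S-staircase (code f) (code< f) (code-longest f inj none) (suc m) 0 refl (zeros (suc m)) (λ s _ → at-zeros (suc m) s) φ)
    (cong φ (sym (staircase≡descent m))))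

  peak : ∀ {m} (f : Fin (suc m) → ℕ) → Injective f → Vex f → ∃ (Asc f) → ∃ (Peak f)
  peak f inj vex ex = let (i , asc , mx , lf) = first-max (Asc? f) (code f ∘ Fin.suc) ex in
    i , record { inj = inj ; vex = vex ; asc = asc ; maximal = mx ; leftmost = lf }

  -- Induction on the deficit along peaks. `Sch-swap` is essential here, as the peak is in general
  -- not the first ascent.
  schubert-tableaux : ∀ {m} d (f : Fin (suc m) → Fin (suc m)) → deficit (toℕ ∘ f) ≤ d → Injective (toℕ ∘ f) → Vex (toℕ ∘ f) →
    ∀ φ → Sch f φ ≡ tableaux (code (toℕ ∘ f)) φ
  schubert-tableaux {m} d f le inj vex φ = split (Finₚ.any? (Asc? (toℕ ∘ f)))
    where
    descend : ∀ d → deficit (toℕ ∘ f) ≤ d → ∃ (Peak (toℕ ∘ f)) → Sch f φ ≡ tableaux (code (toℕ ∘ f)) φ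
    descend zero le (i , pk) = ⊥-elim (<⇒≱ (s≤s z≤n) (subst (_≤ 0) (deficit-swap (toℕ ∘ f) i (Peak.asc pk)) le))
    descend (suc d) le (i , pk) = begin
      Sch f φ ≡⟨ Sch-swap f i (Peak.asc pk) φ ⟩
      Sch (f ∘ simple i) (∂* i φ)
        ≡⟨ schubert-tableaux d (f ∘ simple i) (≤-pred (subst (_≤ suc d) (deficit-swap (toℕ ∘ f) i (Peak.asc pk)) le))
             (PeakProperties.u-inj pk) (PeakProperties.u-vex pk) (∂* i φ) ⟩
      tableaux (code (toℕ ∘ f ∘ simple i)) (∂* i φ) ≡⟨ tableaux-raise (peak⇒codeStep pk) φ ⟩
      tableaux (code (toℕ ∘ f)) φ ∎
    split : Dec (∃ (Asc (toℕ ∘ f))) → Sch f φ ≡ tableaux (code (toℕ ∘ f)) φ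
    split (no none) = trans (Sch-none f (λ i a → none (i , a)) φ) (sym (tableaux-none (toℕ ∘ f) inj (λ i a → none (i , a)) φ))
    split (yes ex) = descend d le (peak (toℕ ∘ f) inj vex ex)

open Tableaux

-- Tableaux drawn as diagrams and the effect of a single excited move.

module Patterns where
  open import Data.Nat as ℕ using (ℕ; zero; suc; _∸_; _≤_; _<_; s≤s; z≤n; _+_)
  import Data.Nat.Properties as ℕₚ
  open import Data.Nat.Tactic.RingSolver using (solve-∀)
  open import Data.Bool using (Bool; true; false)
  open import Data.Fin as Fin using (Fin; toℕ)
  import Data.Fin.Properties as Finₚ
  open import Data.Vec using (lookup; tabulate)
  import Data.Vec.Properties as Vecₚ
  open import Data.Empty using (⊥; ⊥-elim)
  open import Data.Sum using (inj₁; inj₂)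
  open import Data.Product using (∃-syntax; _×_; _,_; proj₁; proj₂)
  open import Function using (_∘_)
  open import Relation.Nullary using (¬_; Dec; yes; no; does)
  open import Relation.Nullary.Decidable using (_×-dec_; dec-true)
  open import Relation.Binary using (tri<; tri≈; tri>)
  open import Relation.Binary.PropositionalEquality hiding (J)
  open import Data.Nat.Properties using (+-cancelʳ-≡; +-cancelʳ-≤; +-mono-≤; +-mono-≤-<; +-monoˡ-<; +-monoˡ-≤; +-suc; <-cmp; <-irrefl; <-trans; <-≤-trans; <⇒≤; <⇒≱; m+[n∸m]≡n; m<n⇒m<1+n; m∸n≤m; m≤n⇒m<n∨m≡n; n≤0⇒n≡0; suc-injective; ≤-<-trans; ≤-pred; ≤-refl; ≤-reflexive; ≤-trans; ≤⇒≤′; ≤∧≢⇒<; ≰⇒>)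

  least : ∀ {P : ℕ → Set} (P? : ∀ k → Dec (P k)) k → P k → ∃[ l ] (P l × (∀ j → j < l → ¬ P j))
  least {P} P? k p with ℕₚ.anyUpTo? P? k
  ... | no none = k , p , λ j lt q → none (j , lt , q)
  ... | yes (j , lt , q) = go k j lt q
    where
    go : ∀ N j → j < N → P j → ∃[ l ] (P l × (∀ j → j < l → ¬ P j))
    go (suc N) j (s≤s le) q with ℕₚ.anyUpTo? P? j
    ... | no none = j , q , λ i lt r → none (i , lt , r)
    ... | yes (i , lt , r) = go N i (<-≤-trans lt le) r

  greatest : ∀ {P : ℕ → Set} (P? : ∀ k → Dec (P k)) n k → k < n → P k → ∃[ l ] (l < n × P l × (∀ j → l < j → j < n → ¬ P j))
  greatest P? (suc n) k lt p with P? n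
  ... | yes q = n , ≤-refl , q , λ j n<j j<n → ⊥-elim (<⇒≱ n<j (≤-pred j<n))
  ... | no ¬q with m≤n⇒m<n∨m≡n (≤-pred lt)
  ...   | inj₂ refl = ⊥-elim (¬q p)
  ...   | inj₁ k<n with greatest P? n k k<n p
  ...     | l , l<n , q , mx = l , m<n⇒m<1+n l<n , q , mx′
    where
    mx′ : ∀ j → l < j → j < suc n → ¬ _
    mx′ j l<j (s≤s j≤n) r with m≤n⇒m<n∨m≡n j≤n
    ... | inj₁ j<n = mx j l<j j<n r
    ... | inj₂ refl = ¬q r

  Array : Set
  Array = ℕ → ℕ → ℕ

  -- K t s is the number of entries < t in row s of a tableau of shape μ.
  record Pattern (n : ℕ) (μ : ℕ → ℕ) (K : Array) : Set where
    field
      start : ∀ s → K 0 s ≡ 0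
      fits : ∀ t s → K t s ≤ μ s
      grows : ∀ t s → t < n → K t s ≤ K (suc t) s
      strips : ∀ t s → t < n → K (suc t) (suc s) ≤ K t s

  -- Cell (s , c) with entry t is drawn at (t , c + t − s).
  Cell : ℕ → Array → ℕ → ℕ → Set
  Cell n K t x = ∃[ s ] (s < n × K t s + t ≤ x + s × x + s < K (suc t) s + t)

  cell? : ∀ n K t x → Dec (Cell n K t x)
  cell? n K t x = ℕₚ.anyUpTo? (λ s → (K t s + t ℕ.≤? x + s) ×-dec (x + s ℕ.<? K (suc t) s + t)) n

  Draws : ∀ {n} → Array → Diagram n → Set
  Draws {n} K D = ∀ (i j : Fin n) → (cell D i j ≡ true → Cell n K (toℕ i) (toℕ j)) × (Cell n K (toℕ i) (toℕ j) → cell D i j ≡ true)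

  draw : ∀ n → Array → Diagram n
  draw n K = tabulate (λ i → tabulate (λ j → does (cell? n K (toℕ i) (toℕ j))))

  cell-tabulate : ∀ {n} (F : Fin n → Fin n → Bool) i j → cell (tabulate (λ i → tabulate (F i))) i j ≡ F i j
  cell-tabulate F i j = trans (cong (λ v → lookup v j) (Vecₚ.lookup∘tabulate (λ i → tabulate (F i)) i)) (Vecₚ.lookup∘tabulate (F i) j)

  does-true : ∀ {A : Set} (a? : Dec A) → does a? ≡ true → A
  does-true (yes a) _ = a

  draws-draw : ∀ n K → Draws K (draw n K)
  draws-draw n K i j = (λ e → does-true (cell? n K (toℕ i) (toℕ j)) (trans (sym (cell-tabulate _ i j)) e)) ,
    (λ c → trans (cell-tabulate _ i j) (dec-true (cell? n K (toℕ i) (toℕ j)) c))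

  diagram-ext : ∀ {n} {D D′ : Diagram n} → (∀ i j → cell D i j ≡ cell D′ i j) → D ≡ D′
  diagram-ext {n} {D} {D′} e = trans (sym (Vecₚ.tabulate∘lookup D)) (trans (Vecₚ.tabulate-cong rows) (Vecₚ.tabulate∘lookup D′))
    where
    rows : ∀ i → lookup D i ≡ lookup D′ i
    rows i = trans (sym (Vecₚ.tabulate∘lookup (lookup D i))) (trans (Vecₚ.tabulate-cong (e i)) (Vecₚ.tabulate∘lookup (lookup D′ i)))

  bool-ext : ∀ (x y : Bool) → (x ≡ true → y ≡ true) → (y ≡ true → x ≡ true) → x ≡ y
  bool-ext true y f g = sym (f refl)
  bool-ext false true f g = g refl
  bool-ext false false f g = refl

  draws-unique : ∀ {n K} {D D′ : Diagram n} → Draws K D → Draws K D′ → D ≡ D′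
  draws-unique {D = D} {D′} r r′ = diagram-ext (λ i j → bool-ext (cell D i j) (cell D′ i j)
    (λ e → proj₂ (r′ i j) (proj₁ (r i j) e)) (λ e → proj₂ (r i j) (proj₁ (r′ i j) e)))

  cell-cong : ∀ {n K K′ t x} → (∀ t s → K t s ≡ K′ t s) → Cell n K t x → Cell n K′ t x
  cell-cong {t = t} {x} e (s , lt , lo , hi) = s , lt , subst (λ a → a + t ≤ x + s) (e t s) lo , subst (λ a → x + s < a + t) (e (suc t) s) hi

  draws-cong : ∀ {n K K′} {D : Diagram n} → (∀ t s → K t s ≡ K′ t s) → Draws K D → Draws K′ D
  draws-cong e r i j = (λ h → cell-cong e (proj₁ (r i j) h)) , (λ c → proj₂ (r i j) (cell-cong (λ t s → sym (e t s)) c))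

  cell-setCell-same : ∀ {n} (D : Diagram n) i j b → cell (setCell D i j b) i j ≡ b
  cell-setCell-same D i j b = trans (cong (λ v → lookup v j) (Vecₚ.lookup∘updateAt i D)) (Vecₚ.lookup∘updateAt j (lookup D i))

  cell-setCell-other : ∀ {n} (D : Diagram n) i j b p q → ¬ (p ≡ i × q ≡ j) → cell (setCell D i j b) p q ≡ cell D p q
  cell-setCell-other D i j b p q ne with p Fin.≟ i
  ... | no p≢i = cong (λ v → lookup v q) (Vecₚ.lookup∘updateAt′ p i p≢i D)
  ... | yes refl with q Fin.≟ j
  ...   | yes refl = ⊥-elim (ne (refl , refl))
  ...   | no q≢j = trans (cong (λ v → lookup v q) (Vecₚ.lookup∘updateAt p D)) (Vecₚ.lookup∘updateAt′ q j q≢j (lookup D p))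

  module PatternProperties {n μ K} (pat : Pattern n μ K) where
    open Pattern pat

    state-anti : ∀ t s → t ≤ n → K t (suc s) ≤ K t s
    state-anti zero s _ = subst (_≤ K 0 s) (sym (start (suc s))) z≤n
    state-anti (suc t) s lt = ≤-trans (strips t s lt) (grows t s lt)

    state-anti* : ∀ t {s s′} → t ≤ n → s ≤ s′ → K t s′ ≤ K t s
    state-anti* t {s} le s≤s′ = go (≤⇒≤′ s≤s′)
      where
      go : ∀ {s′} → s ℕ.≤′ s′ → K t s′ ≤ K t s
      go ℕ.≤′-refl = ≤-refl
      go (ℕ.≤′-step p) = ≤-trans (state-anti t _ le) (go p)

    gap : ∀ t {s s′} → t < n → s < s′ → K (suc t) s′ + s < K t s + s′
    gap t {s} {s′} t<n s<s′ = +-mono-≤-< (≤-trans (state-anti* (suc t) t<n s<s′) (strips t s t<n)) s<s′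

    -- By column strictness row s contains no entry below s.
    diagonal : ∀ t s → t ≤ n → t ≤ s → K t s ≡ 0
    diagonal zero s _ _ = start s
    diagonal (suc t) (suc s) lt (s≤s le) = n≤0⇒n≡0 (subst (K (suc t) (suc s) ≤_) (diagonal t s (<⇒≤ lt) le) (strips t s lt))

    -- Distinct rows occupy disjoint, non-adjacent intervals of a layer.
    below-apart : ∀ t {s s′} x → t < n → s < s′ → K t s + t ≤ x + s → ¬ (x + s′ < K (suc t) s′ + t)
    below-apart t {s} {s′} x t<n s<s′ lo hi = <-irrefl refl (<-trans
      (<-≤-trans (+-monoˡ-< s hi) (≤-reflexive (e₁ (K (suc t) s′) t s)))
      (<-≤-trans (+-monoˡ-< t (gap t t<n s<s′)) (≤-trans (≤-reflexive (e₁ (K t s) s′ t)) (≤-trans (+-monoˡ-≤ s′ lo) (≤-reflexive (e₁ x s s′))))))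
      where
      e₁ : ∀ a b c → a + b + c ≡ a + c + b
      e₁ = solve-∀

    -- The strict inequality in `gap` leaves a free column between the intervals of different rows,
    -- so the position just after row s belongs to no other row.
    end-free : ∀ t s x → t < n → x + s ≡ K (suc t) s + t → ¬ Cell n K t x
    end-free t s x t<n end (s′ , _ , lo , hi) = go (<-cmp s′ s)
      where
      e₁ : ∀ p q r → p + q + r ≡ p + r + q
      e₁ = solve-∀
      go : _ → ⊥
      go (tri≈ _ refl _) = <-irrefl end hi
      go (tri> _ _ gt) = below-apart t x t<n gt (subst (K t s + t ≤_) (sym end) (+-monoˡ-≤ t (grows t s t<n))) hi
      go (tri< lt _ _) = <-irrefl refl (<-≤-trans (+-monoˡ-< t (gap t t<n lt))
        (≤-trans (≤-reflexive (e₁ (K t s′) s t)) (≤-trans (+-monoˡ-≤ s lo)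
          (≤-reflexive (trans (e₁ x s′ s) (trans (cong (_+ s′) end) (e₁ (K (suc t) s) t s′)))))))

  open Pattern
  open PatternProperties

  -- Exciting the last cell with entry a of row s, which is drawn at (a , b).
  record Movable (n : ℕ) (K : Array) (a s b : ℕ) : Set where
    constructor movable
    field
      a<n : suc a < n
      s<n : s < n
      from≤ : K a s + a ≤ b + s
      top : K (suc a) s + a ≡ suc (b + s)
      room : K (2 + a) (suc s) < K (suc a) s

  abstract
    -- With t₀ = a + 1 this turns the last entry a of row s₀ into a + 1, which moves its cell one
    -- step along the diagonal.
    lower : Array → ℕ → ℕ → Array
    lower K t₀ s₀ t s with t ℕ.≟ t₀ | s ℕ.≟ s₀
    ... | yes _ | yes _ = K t s ∸ 1
    ... | _ | _ = K t s

    lower-here : ∀ K t s → lower K t s t s ≡ K t s ∸ 1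
    lower-here K t s with t ℕ.≟ t | s ℕ.≟ s
    ... | yes _ | yes _ = refl
    ... | no ne | _ = ⊥-elim (ne refl)
    ... | yes _ | no ne = ⊥-elim (ne refl)

    lower-else : ∀ K t₀ s₀ t s → ¬ (t ≡ t₀ × s ≡ s₀) → lower K t₀ s₀ t s ≡ K t s
    lower-else K t₀ s₀ t s ne with t ℕ.≟ t₀ | s ℕ.≟ s₀
    ... | yes p | yes q = ⊥-elim (ne (p , q))
    ... | yes _ | no _ = refl
    ... | no _ | _ = refl

    lower-≤ : ∀ K t₀ s₀ t s → lower K t₀ s₀ t s ≤ K t s
    lower-≤ K t₀ s₀ t s with t ℕ.≟ t₀ | s ℕ.≟ s₀
    ... | yes p | yes q = m∸n≤m (K t s) 1
    ... | yes _ | no _ = ≤-refl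
    ... | no _ | _ = ≤-refl

    lift : Array → ℕ → ℕ → Array
    lift K t₀ s₀ t s with t ℕ.≟ t₀ | s ℕ.≟ s₀
    ... | yes _ | yes _ = suc (K t s)
    ... | _ | _ = K t s

    lift-here : ∀ K t s → lift K t s t s ≡ suc (K t s)
    lift-here K t s with t ℕ.≟ t | s ℕ.≟ s
    ... | yes _ | yes _ = refl
    ... | no ne | _ = ⊥-elim (ne refl)
    ... | yes _ | no ne = ⊥-elim (ne refl)

    lift-else : ∀ K t₀ s₀ t s → ¬ (t ≡ t₀ × s ≡ s₀) → lift K t₀ s₀ t s ≡ K t s
    lift-else K t₀ s₀ t s ne with t ℕ.≟ t₀ | s ℕ.≟ s₀
    ... | yes p | yes q = ⊥-elim (ne (p , q))
    ... | yes _ | no _ = refl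
    ... | no _ | _ = refl

  lower-lift : ∀ K t₀ s₀ t s → lower (lift K t₀ s₀) t₀ s₀ t s ≡ K t s
  lower-lift K t₀ s₀ t s with (t ℕ.≟ t₀) ×-dec (s ℕ.≟ s₀)
  ... | yes (refl , refl) = trans (lower-here (lift K t s) t s) (cong (_∸ 1) (lift-here K t s))
  ... | no ne = trans (lower-else (lift K t₀ s₀) t₀ s₀ t s ne) (lift-else K t₀ s₀ t s ne)

  module Moving {n μ K a s b} (pat : Pattern n μ K) (mv : Movable n K a s b) where
    open Movable mv

    K′ : Array
    K′ = lower K (suc a) s

    positive : suc (K (suc a) s ∸ 1) ≡ K (suc a) s
    positive = m+[n∸m]≡n {1} (≤-<-trans z≤n room)

    top′ : K′ (suc a) s + a ≡ b + s
    top′ = trans (cong (_+ a) (lower-here K (suc a) s)) (suc-injective (trans (cong (_+ a) positive) top))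

    K′-a : ∀ s′ → K′ a s′ ≡ K a s′
    K′-a s′ = lower-else K (suc a) s a s′ (λ (e , _) → <-irrefl e ≤-refl)

    K′-row : ∀ t s′ → s′ ≢ s → K′ t s′ ≡ K t s′
    K′-row t s′ ne = lower-else K (suc a) s t s′ (ne ∘ proj₂)

    K′-layer : ∀ t s′ → t ≢ suc a → K′ t s′ ≡ K t s′
    K′-layer t s′ ne = lower-else K (suc a) s t s′ (ne ∘ proj₁)

    grow-here : K a s ≤ K′ (suc a) s
    grow-here = +-cancelʳ-≤ a _ _ (subst (K a s + a ≤_) (sym top′) from≤)

    pattern′ : Pattern n μ K′
    pattern′ = record
      { start = λ s′ → trans (K′-layer 0 s′ λ ()) (start pat s′)
      ; fits = λ t s′ → ≤-trans (lower-≤ K (suc a) s t s′) (fits pat t s′)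
      ; grows = grows′ ; strips = strips′ }
      where
      grows′ : ∀ t s′ → t < n → K′ t s′ ≤ K′ (suc t) s′
      grows′ t s′ lt with t ℕ.≟ a | s′ ℕ.≟ s
      ... | yes refl | yes refl = subst (_≤ K′ (suc a) s) (sym (K′-a s)) grow-here
      ... | yes refl | no ne = subst₂ _≤_ (sym (K′-a s′)) (sym (K′-row (suc a) s′ ne)) (grows pat a s′ lt)
      ... | no ne | _ = subst (K′ t s′ ≤_) (sym (K′-layer (suc t) s′ (ne ∘ suc-injective))) (≤-trans (lower-≤ K (suc a) s t s′) (grows pat t s′ lt))
      strips′ : ∀ t s′ → t < n → K′ (suc t) (suc s′) ≤ K′ t s′
      strips′ t s′ lt with t ℕ.≟ suc a | s′ ℕ.≟ s
      ... | yes refl | yes refl = ≤-trans (lower-≤ K (suc a) s (2 + a) (suc s)) (subst (K (2 + a) (suc s) ≤_) (sym (lower-here K (suc a) s))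
                                    (≤-pred (subst (K (2 + a) (suc s) <_) (sym positive) room)))
      ... | yes refl | no ne = ≤-trans (lower-≤ K (suc a) s (2 + a) (suc s′)) (subst (K (2 + a) (suc s′) ≤_) (sym (K′-row (suc a) s′ ne)) (strips pat (suc a) s′ lt))
      ... | no ne | _ = ≤-trans (lower-≤ K (suc a) s (suc t) (suc s′)) (subst (K (suc t) (suc s′) ≤_) (sym (K′-layer t s′ ne)) (strips pat t s′ lt))

    old-cell : Cell n K a b
    old-cell = s , s<n , from≤ , subst (b + s <_) (sym top) ≤-refl

    new-cell : Cell n K′ (suc a) (suc b)
    new-cell = s , s<n , ≤-reflexive (trans (+-suc (K′ (suc a) s) a) (cong suc top′)) ,
      subst (suc (b + s) <_) (sym (trans (cong (_+ suc a) (K′-layer (2 + a) s (λ e → <-irrefl (sym e) ≤-refl))) (+-suc (K (2 + a) s) a)))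
        (s≤s (≤-trans (≤-reflexive (sym top)) (+-monoˡ-≤ a (grows pat (suc a) s a<n))))

    a<n′ : a < n
    a<n′ = <-trans ≤-refl a<n

    vacated : ¬ Cell n K′ a b
    vacated (s′ , _ , lo , hi) with <-cmp s′ s
    ... | tri≈ _ refl _ = <-irrefl (sym top′) hi
    ... | tri< lt ne _ = below-apart pat a b a<n′ lt (subst (λ x → x + a ≤ b + s′) (K′-a s′) lo) (subst (b + s <_) (sym top) ≤-refl)
    ... | tri> _ ne gt = below-apart pat a b a<n′ gt from≤ (subst (λ x → b + s′ < x + a) (K′-row (suc a) s′ ne) hi)

    right-free : ¬ Cell n K a (suc b)
    right-free = end-free pat a s (suc b) a<n′ (sym top)

    high : ∀ {s′} → s′ ≤ s → 2 + (b + s) ≤ K (suc a) s′ + suc a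
    high {s′} le = ≤-trans (≤-reflexive (trans (cong suc (sym top)) (sym (+-suc (K (suc a) s) a))))
      (+-monoˡ-≤ (suc a) (state-anti* pat (suc a) a<n′ le))

    low : ∀ {s′} → s < s′ → K (2 + a) s′ + suc a ≤ suc (b + s)
    low {s′} lt = ≤-trans (+-monoˡ-≤ (suc a) (state-anti* pat (2 + a) a<n lt))
      (≤-trans (≤-reflexive (+-suc (K (2 + a) (suc s)) a)) (≤-trans (+-monoˡ-≤ a room) (≤-reflexive top)))

    -- In layer a + 1 the rows up to s start beyond column b + 1, and by `room` the later rows end
    -- before column b.
    below-free : ∀ x → b ≤ x → x ≤ suc b → ¬ Cell n K (suc a) x
    below-free x b≤x x≤ (s′ , _ , lo , hi) with s′ ℕ.≤? s
    ... | yes le = <-irrefl refl (<-≤-trans (≤-trans (high le) lo) (+-mono-≤ x≤ le))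
    ... | no ≰ = <-irrefl refl (<-≤-trans hi (≤-trans (low (≰⇒> ≰))
          (≤-trans (≤-reflexive (sym (+-suc b s))) (+-mono-≤ b≤x (≰⇒> ≰)))))

    keep : ∀ {p q} → ¬ (p ≡ a × q ≡ b) → Cell n K p q → Cell n K′ p q
    keep {p} {q} ne (s′ , lt , lo , hi) = s′ , lt , ≤-trans (+-monoˡ-≤ p (lower-≤ K (suc a) s p s′)) lo , upper
      where
      upper : q + s′ < K′ (suc p) s′ + p
      upper with p ℕ.≟ a | s′ ℕ.≟ s
      ... | yes refl | yes refl = subst (q + s <_) (sym top′) (≤∧≢⇒< (≤-pred (subst (q + s <_) top hi)) (λ e → ne (refl , +-cancelʳ-≡ s q b e)))
      ... | yes refl | no s≢ = subst (λ x → q + s′ < x + p) (sym (K′-row (suc a) s′ s≢)) hi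
      ... | no p≢ | _ = subst (λ x → q + s′ < x + p) (sym (K′-layer (suc p) s′ (p≢ ∘ suc-injective))) hi

    back : ∀ {p q} → ¬ (p ≡ suc a × q ≡ suc b) → Cell n K′ p q → Cell n K p q
    back {p} {q} ne (s′ , lt , lo , hi) = s′ , lt , lower′ , <-≤-trans hi (+-monoˡ-≤ p (lower-≤ K (suc a) s (suc p) s′))
      where
      lower′ : K p s′ + p ≤ q + s′
      lower′ with p ℕ.≟ suc a | s′ ℕ.≟ s
      ... | yes refl | yes refl = subst (_≤ q + s) (sym (trans (+-suc (K (suc a) s) a) (cong suc top)))
              (≤∧≢⇒< (subst (_≤ q + s) (trans (+-suc (K′ (suc a) s) a) (cong suc top′)) lo) (λ e → ne (refl , +-cancelʳ-≡ s q (suc b) (sym e))))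
      ... | yes refl | no s≢ = subst (λ x → x + p ≤ q + s′) (K′-row (suc a) s′ s≢) lo
      ... | no p≢ | _ = subst (λ x → x + p ≤ q + s′) (K′-layer p s′ p≢) lo

    moved : ∀ {D : Diagram n} (i j i′ j′ : Fin n) → toℕ i ≡ a → toℕ j ≡ b → toℕ i′ ≡ suc a → toℕ j′ ≡ suc b →
      Draws K D → Draws K′ (setCell (setCell D i j false) i′ j′ true)
    moved {D} i j i′ j′ ei ej ei′ ej′ dr p q with (p Fin.≟ i′) ×-dec (q Fin.≟ j′)
    ... | yes (refl , refl) = (λ _ → subst₂ (Cell n K′) (sym ei′) (sym ej′) new-cell) , (λ _ → cell-setCell-same (setCell D i j false) i′ j′ true)
    ... | no ne′ with (p Fin.≟ i) ×-dec (q Fin.≟ j)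
    ...   | yes (refl , refl) = (λ e → ⊥-elim (clash (trans (sym e) old))) , (λ c → ⊥-elim (vacated (subst₂ (Cell n K′) ei ej c)))
      where
      clash : true ≢ false
      clash ()
      old : cell (setCell (setCell D i j false) i′ j′ true) i j ≡ false
      old = trans (cell-setCell-other (setCell D i j false) i′ j′ true i j ne′) (cell-setCell-same D i j false)
    ...   | no ne = (λ e → keep neℕ (proj₁ (dr p q) (trans (sym same) e))) , (λ c → trans same (proj₂ (dr p q) (back ne′ℕ c)))
      where
      same : cell (setCell (setCell D i j false) i′ j′ true) p q ≡ cell D p q
      same = trans (cell-setCell-other (setCell D i j false) i′ j′ true p q ne′) (cell-setCell-other D i j false p q ne)
      neℕ : ¬ (toℕ p ≡ a × toℕ q ≡ b)
      neℕ (e , e′) = ne (Finₚ.toℕ-injective (trans e (sym ei)) , Finₚ.toℕ-injective (trans e′ (sym ej)))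
      ne′ℕ : ¬ (toℕ p ≡ suc a × toℕ q ≡ suc b)
      ne′ℕ (e , e′) = ne′ (Finₚ.toℕ-injective (trans e (sym ei′)) , Finₚ.toℕ-injective (trans e′ (sym ej′)))

open Patterns

-- Excited diagrams as the drawings of flagged tableaux.

module ExcitedPatterns where
  open import Data.Nat as ℕ using (ℕ; zero; suc; _∸_; _≤_; _<_; s≤s; z≤n; _+_)
  import Data.Nat.Properties as ℕₚ
  open import Data.Nat.Tactic.RingSolver using (solve-∀)
  open import Data.Bool using (Bool; true; false)
  open import Data.Bool.Properties using (T-≡)
  open import Data.Fin using (Fin; toℕ; fromℕ<)
  import Data.Fin.Properties as Finₚ
  open import Data.List using (List)
  open import Data.Empty using (⊥; ⊥-elim)
  open import Data.Sum using (inj₁; inj₂)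
  open import Data.Product using (∃-syntax; _×_; _,_; proj₁; proj₂)
  open import Function.Bundles using (Equivalence)
  open import Relation.Nullary using (¬_; Dec; yes; no)
  open import Relation.Nullary.Decidable using (_×-dec_; dec-false)
  open import Relation.Binary using (tri<; tri≈; tri>)
  open import Relation.Binary.PropositionalEquality hiding (J)
  open import Relation.Binary.Construct.Closure.ReflexiveTransitive using (Star; ε; _◅_; _◅◅_)
  open import Data.Nat.Properties using (+-assoc; +-cancelʳ-<; +-cancelʳ-≤; +-cancelˡ-≤; +-identityʳ; +-monoʳ-≤; +-monoˡ-<; +-monoˡ-≤; +-suc; +-∸-assoc; <-cmp; <-irrefl; <-trans; <-≤-trans; <ᵇ⇒<; <⇒<ᵇ; <⇒≤; <⇒≱; m+[n∸m]≡n; m<n⇒m<1+n; m∸n+n≡m; m≤m+n; m≤n+m; m≤n⇒m<n∨m≡n; m≤n⇒m≤1+n; n≤1+n; n≮0; suc-injective; ≤-<-trans; ≤-antisym; ≤-pred; ≤-refl; ≤-reflexive; ≤-trans; ≤⇒≤′; ≮⇒≥; ≰⇒>)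

  -- The flags g record where the diagonals of the last cells of the rows of μ leave λ′.
  record Bounded (n : ℕ) (μ g : ℕ → ℕ) (λ′ : List ℕ) : Set where
    field
      μ-anti : ∀ s → μ (suc s) ≤ μ s
      μ-zero : ∀ s → n ≤ s → μ s ≡ 0
      g<n : ∀ s → 0 < μ s → g s < n
      g-row : ∀ s → 0 < μ s → s ≤ g s
      g-same : ∀ s s′ → μ s ≡ μ s′ → g s ≡ g s′
      λ-anti : ∀ r → part λ′ (suc r) ≤ part λ′ r
      outside : ∀ a s b → μ (suc s) < μ s → g s ≤ a → μ s + a ≡ suc (b + s) → ¬ InYoung λ′ (suc a) (suc b)
      -- The last cell of row s + d, of the same length as row s, would with entry `g s` be drawn in
      -- column y at most, hence inside λ′.
      corner : ∀ s → 0 < μ s → ∃[ d ] ∃[ y ] (μ (s + d) ≡ μ s × InYoung λ′ (g s) y × y < n × μ s + g s ≤ y + suc (s + d))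

  record Flagged (n : ℕ) (μ g : ℕ → ℕ) (K : Array) : Set where
    field
      pat : Pattern n μ K
      fulls : ∀ t s → t < n → g s ≤ t → K (suc t) s ≡ μ s

  module Excitation {n μ g λ′} (bounded : Bounded n μ g λ′) where
    open Bounded bounded
    open Flagged
    open Pattern

    λ-anti* : ∀ {r r′} → r ≤ r′ → part λ′ r′ ≤ part λ′ r
    λ-anti* {r} le = go (≤⇒≤′ le)
      where
      go : ∀ {r′} → r ℕ.≤′ r′ → part λ′ r′ ≤ part λ′ r
      go ℕ.≤′-refl = ≤-refl
      go (ℕ.≤′-step p) = ≤-trans (λ-anti _) (go p)

    young-down : ∀ {r r′ x x′} → r ≤ r′ → x ≤ x′ → InYoung λ′ r′ x′ → InYoung λ′ r x
    young-down r≤ x≤ lt = ≤-<-trans x≤ (<-≤-trans lt (λ-anti* r≤))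

    μ-anti* : ∀ s d → μ (s + d) ≤ μ s
    μ-anti* s zero = ≤-reflexive (cong μ (+-identityʳ s))
    μ-anti* s (suc d) = ≤-trans (≤-reflexive (cong μ (+-suc s d))) (≤-trans (μ-anti (s + d)) (μ-anti* s d))

    pos⇒<n : ∀ {s x} → x < μ s → s < n
    pos⇒<n {s} lt = ≰⇒> (λ le → n≮0 (subst (_ <_) (μ-zero s le) lt))

    strips* : ∀ {K} → Pattern n μ K → ∀ e t s → t + e ≤ n → K (t + e) (s + e) ≤ K t s
    strips* {K} p zero t s le = ≤-reflexive (cong₂ K (+-identityʳ t) (+-identityʳ s))
    strips* {K} p (suc e) t s le = ≤-trans (≤-reflexive (cong₂ K (+-suc t e) (+-suc s e)))
      (≤-trans (strips p (t + e) (s + e) lt) (strips* p e t s (<⇒≤ lt)))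
      where
      lt : t + e < n
      lt = subst (_≤ n) (+-suc t e) le

    -- Column strictness pushes the flag of the last row of length μ s up to row s.
    on-time : ∀ {K} → Flagged n μ g K → ∀ t s d → μ (s + d) ≡ μ s → K t s < K (suc t) s → t < n → t + d ≤ g s
    on-time {K} fl t s d eq lt t<n = ≮⇒≥ contra
      where
      short : K t s < μ s
      short = <-≤-trans lt (fits (pat fl) (suc t) s)
      G = g s
      G<n : G < n
      G<n = g<n s (≤-<-trans z≤n short)
      t≤G : t ≤ G
      t≤G with t ℕ.≤? G
      ... | yes le = le
      ... | no ≰ = ⊥-elim (late t (≰⇒> ≰) refl)
        where
        late : ∀ t′ → G < t′ → t′ ≡ t → ⊥
        late (suc t′) (s≤s le) refl = <-irrefl (fulls fl t′ s (<-trans ≤-refl t<n) le) short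
      contra : ¬ (G < t + d)
      contra G<t+d = <⇒≱ short (subst (_≤ K t s) done (strips* (pat fl) e t s (subst (_≤ n) (sym t+e) G<n)))
        where
        e = suc G ∸ t
        t+e : t + e ≡ suc G
        t+e = m+[n∸m]≡n (m≤n⇒m≤1+n t≤G)
        e≤d : e ≤ d
        e≤d = +-cancelˡ-≤ t _ _ (subst (_≤ t + d) (sym t+e) G<t+d)
        μ-e : μ (s + e) ≡ μ s
        μ-e = ≤-antisym (μ-anti* s e) (subst (_≤ μ (s + e)) (trans (cong μ (trans (+-assoc s e (d ∸ e)) (cong (s +_) (m+[n∸m]≡n e≤d)))) eq) (μ-anti* (s + e) (d ∸ e)))
        done : K (t + e) (s + e) ≡ μ s
        done = trans (cong (λ x → K x (s + e)) t+e) (trans (fulls fl G (s + e) G<n (≤-reflexive (g-same (s + e) s μ-e))) μ-e)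

    -- Since t + d is at most the flag by `on-time`, the cell (t , x) lies weakly above and to the
    -- left of the cell of λ′ supplied by `corner`.
    inside : ∀ {K} → Flagged n μ g K → ∀ t x → t < n → Cell n K t x → InYoung λ′ t x × x < n
    inside {K} fl t x t<n (s , s<n , lo , hi) with corner s (≤-<-trans z≤n (<-≤-trans up (fits (pat fl) (suc t) s)))
      where
      up : K t s < K (suc t) s
      up = +-cancelʳ-< t _ _ (≤-<-trans lo hi)
    ... | d , y , eq , yin , y<n , big = young-down (≤-trans (m≤m+n t d) t+d≤) x≤y yin , ≤-<-trans x≤y y<n
      where
      t+d≤ : t + d ≤ g s
      t+d≤ = on-time fl t s d eq (+-cancelʳ-< t _ _ (≤-<-trans lo hi)) t<n
      e₁ : ∀ x s d → x + suc (s + d) ≡ suc (x + s) + d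
      e₁ = solve-∀
      x≤y : x ≤ y
      x≤y = +-cancelʳ-≤ (suc (s + d)) x y (≤-trans (≤-reflexive (e₁ x s d)) (≤-trans
        (+-monoˡ-≤ d (≤-trans hi (+-monoˡ-≤ t (fits (pat fl) (suc t) s))))
        (≤-trans (≤-reflexive (+-assoc (μ s) t d)) (≤-trans (+-monoʳ-≤ (μ s) t+d≤) big))))

    -- The free place on the right says that the cell is the last one with its entry in row s
    -- (`top`), the free place below that the next row permits a larger entry (`room`). A move past
    -- the flag would leave λ′ by `outside` or, if the next row is equally long and thus also
    -- complete, contradict `room`.
    excite-flagged : ∀ {K} {D D′ : Diagram n} → Flagged n μ g K → Draws K D → Excite λ′ D D′ → ∃[ K′ ] (Flagged n μ g K′ × Draws K′ D′)
    excite-flagged {K} {D} fl dr (i , j , i′ , j′ , ei , ej , c , _ , f₁ , _ , f₂ , y₃ , _ , refl) = go (proj₁ (dr i j) c)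
      where
      a = toℕ i
      b = toℕ j
      a<n = Finₚ.toℕ<n i
      a+1<n : suc a < n
      a+1<n = subst (_< n) ei (Finₚ.toℕ<n i′)
      clash : ∀ {x : Bool} → x ≡ true → x ≡ false → ⊥
      clash refl ()
      right : ¬ Cell n K a (suc b)
      right cl = clash (proj₂ (dr i j′) (subst (Cell n K a) (sym ej) cl)) f₂
      below : ¬ Cell n K (suc a) b
      below cl = clash (proj₂ (dr i′ j) (subst (λ x → Cell n K x b) (sym ei) cl)) f₁
      D⁺ : Diagram n
      D⁺ = setCell (setCell D i j false) i′ j′ true
      go : Cell n K a b → ∃[ K′ ] (Flagged n μ g K′ × Draws K′ D⁺)
      go (s , s<n , lo , hi) = lower K (suc a) s , record { pat = Moving.pattern′ (pat fl) mv ; fulls = fulls′ } ,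
          Moving.moved (pat fl) mv {D} i j i′ j′ refl refl ei ej dr
        where
        top : K (suc a) s + a ≡ suc (b + s)
        top = ≤-antisym (≮⇒≥ (λ lt → right (s , s<n , m≤n⇒m≤1+n lo , lt))) hi
        room : K (2 + a) (suc s) < K (suc a) s
        room = ≰⇒> (λ le → below (suc s ,
            pos⇒<n (<-≤-trans (≤-<-trans z≤n (+-cancelʳ-< a _ _ (≤-<-trans lo hi))) (≤-trans le (fits (pat fl) (2 + a) (suc s)))) ,
            ≤-trans (+-monoˡ-≤ (suc a) (strips (pat fl) a s a<n)) (≤-trans (≤-reflexive (+-suc (K a s) a)) (≤-trans (s≤s lo) (≤-reflexive (sym (+-suc b s))))) ,
            ≤-trans (s≤s (≤-trans (≤-reflexive (trans (+-suc b s) (sym top))) (+-monoˡ-≤ a le))) (≤-reflexive (sym (+-suc (K (2 + a) (suc s)) a)))))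
        mv : Movable n K a s b
        mv = movable a+1<n s<n lo top room
        early : ¬ (g s ≤ a)
        early le with m≤n⇒m<n∨m≡n (μ-anti s)
        ... | inj₁ lt = outside a s b lt le (trans (cong (_+ a) (sym (fulls fl a s a<n le))) top) (subst₂ (InYoung λ′) ei ej y₃)
        ... | inj₂ eq = <-irrefl (trans (fulls fl (suc a) (suc s) a+1<n (≤-trans (≤-reflexive (g-same (suc s) s eq)) (m≤n⇒m≤1+n le))) (trans eq (sym (fulls fl a s a<n le)))) room
        fulls′ : ∀ t s′ → t < n → g s′ ≤ t → lower K (suc a) s (suc t) s′ ≡ μ s′
        fulls′ t s′ lt le with (t ℕ.≟ a) ×-dec (s′ ℕ.≟ s)
        ... | yes (refl , refl) = ⊥-elim (early le)
        ... | no ne = trans (lower-else K (suc a) s (suc t) s′ (λ (e , e′) → ne (suc-injective e , e′))) (fulls fl t s′ lt le)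

    excited-flagged : ∀ {D₀ D : Diagram n} → ∃[ K ] (Flagged n μ g K × Draws K D₀) → Star (Excite λ′) D₀ D → ∃[ K ] (Flagged n μ g K × Draws K D)
    excited-flagged h ε = h
    excited-flagged {D₀} (K , fl , dr) (ex ◅ st) = excited-flagged (excite-flagged {K} {D₀} fl dr ex) st

    Initial : Array → Set
    Initial K = ∀ t s → t < n → s ≤ t → K (suc t) s ≡ μ s

    initial : Array
    initial t s with s ℕ.<? t
    ... | yes _ = μ s
    ... | no _ = 0

    initial-< : ∀ {t s} → s < t → initial t s ≡ μ s
    initial-< {t} {s} lt with s ℕ.<? t
    ... | yes _ = refl
    ... | no ≮ = ⊥-elim (≮ lt)

    initial-≥ : ∀ {t s} → t ≤ s → initial t s ≡ 0
    initial-≥ {t} {s} le with s ℕ.<? t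
    ... | yes lt = ⊥-elim (<⇒≱ lt le)
    ... | no _ = refl

    initial-≤ : ∀ t s → initial t s ≤ μ s
    initial-≤ t s with s ℕ.<? t
    ... | yes _ = ≤-refl
    ... | no _ = z≤n

    initial-flagged : Flagged n μ g initial
    initial-flagged = record { pat = record { start = λ s → initial-≥ {0} {s} z≤n ; fits = initial-≤ ; grows = λ t s _ → grow′ t s ; strips = λ t s _ → strip′ t s } ; fulls = fulls′ }
      where
      grow′ : ∀ t s → initial t s ≤ initial (suc t) s
      grow′ t s with s ℕ.<? t
      ... | yes lt = ≤-reflexive (sym (initial-< (m<n⇒m<1+n lt)))
      ... | no _ = z≤n
      strip′ : ∀ t s → initial (suc t) (suc s) ≤ initial t s
      strip′ t s with suc s ℕ.<? suc t
      ... | yes (s≤s lt) = ≤-trans (μ-anti s) (≤-reflexive (sym (initial-< lt)))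
      ... | no _ = z≤n
      fulls′ : ∀ t s → t < n → g s ≤ t → initial (suc t) s ≡ μ s
      fulls′ t s lt le with 0 ℕ.<? μ s
      ... | yes pos = initial-< (s≤s (≤-trans (g-row s pos) le))
      ... | no ¬pos = ≤-antisym (initial-≤ (suc t) s) (≤-trans (≮⇒≥ ¬pos) z≤n)

    cell-initial : ∀ {K} → Pattern n μ K → Initial K → ∀ t x → t < n → (Cell n K t x → x < μ t) × (x < μ t → Cell n K t x)
    cell-initial {K} p ini t x t<n = to , from
      where
      to : Cell n K t x → x < μ t
      to (s , s<n , lo , hi) with <-cmp s t
      ... | tri< lt _ _ = ⊥-elim (<-irrefl refl (≤-<-trans (subst (λ k → k + t ≤ x + s) (before t s lt t<n) lo) (subst (λ k → x + s < k + t) (ini t s t<n (<⇒≤ lt)) hi)))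
        where
        before : ∀ t s → s < t → t < n → K t s ≡ μ s
        before (suc t) s (s≤s le) lt = ini t s (<-trans ≤-refl lt) le
      ... | tri≈ _ refl _ = +-cancelʳ-< s x (μ s) (subst (λ k → x + s < k + s) (ini s s t<n ≤-refl) hi)
      ... | tri> _ _ gt = ⊥-elim (<⇒≱ (subst (λ k → x + s < k + t) (PatternProperties.diagonal p (suc t) s t<n gt) hi) (≤-trans (<⇒≤ gt) (m≤n+m s x)))
      from : x < μ t → Cell n K t x
      from lt = t , t<n , subst (λ k → k + t ≤ x + t) (sym (PatternProperties.diagonal p t t (<⇒≤ t<n) ≤-refl)) (m≤n+m t x) ,
        subst (λ k → x + t < k + t) (sym (ini t t t<n ≤-refl)) (+-monoˡ-< t lt)

    module _ (μl : List ℕ) (μ≡ : ∀ s → part μl s ≡ μ s) where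

      draws-young : ∀ {K} → Pattern n μ K → Initial K → Draws K (youngDiagram n μl)
      draws-young p ini i j = (λ e → proj₂ ini′ (subst (toℕ j <_) (μ≡ (toℕ i)) (<ᵇ⇒< (toℕ j) (part μl (toℕ i)) (Equivalence.from T-≡ (trans (sym (cell-tabulate _ i j)) e))))) ,
        (λ c → trans (cell-tabulate _ i j) (Equivalence.to T-≡ (<⇒<ᵇ (subst (toℕ j <_) (sym (μ≡ (toℕ i))) (proj₁ ini′ c)))))
        where
        ini′ = cell-initial p ini (toℕ i) (toℕ j) (Finₚ.toℕ<n i)

      deficiency : Array → ℕ
      deficiency K = sumF {n} (λ t → sumF {n} (λ s → μ (toℕ s) ∸ K (suc (toℕ t)) (toℕ s)))

      -- Row s still has an entry above t, hence an entry other than s.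
      Late : Array → ℕ → ℕ → Set
      Late K s t = s ≤ t × K (suc t) s < μ s

      late? : ∀ K s t → Dec (Late K s t)
      late? K s t = (s ℕ.≤? t) ×-dec (K (suc t) s ℕ.<? μ s)

      -- Here s is the first row that differs from the initial tableau and a + 1 is its largest
      -- entry. Its first entry a + 1 is turned back into a; the rows above contain only entries
      -- smaller than s ≤ a, so column strictness survives.
      module Undo {K} (fl : Flagged n μ g K) {s a} (a<n : a < n) (s≤a : s ≤ a) (short : K (suc a) s < μ s)
                  (above : ∀ s′ t → s′ < s → t < n → s′ ≤ t → K (suc t) s′ ≡ μ s′) (after : ∀ t → a < t → t < n → K (suc t) s ≡ μ s) where
        s<n : s < n
        s<n = pos⇒<n short

        a+1<n : suc a < n
        a+1<n with m≤n⇒m<n∨m≡n a<n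
        ... | inj₁ lt = lt
        -- If a were the last layer, the flag of row s, being less than n, would have completed the
        -- row.
        ... | inj₂ eq = ⊥-elim (<-irrefl (fulls fl a s a<n (≤-pred (subst (g s <_) (sym eq) (g<n s (≤-<-trans z≤n short))))) short)

        b : ℕ
        b = K (suc a) s + a ∸ s

        b+s : b + s ≡ K (suc a) s + a
        b+s = m∸n+n≡m (≤-trans s≤a (m≤n+m a (K (suc a) s)))

        K⁺ : Array
        K⁺ = lift K (suc a) s

        else⁺ : ∀ t s′ → ¬ (t ≡ suc a × s′ ≡ s) → K⁺ t s′ ≡ K t s′
        else⁺ = lift-else K (suc a) s

        here⁺ : K⁺ (suc a) s ≡ suc (K (suc a) s)
        here⁺ = lift-here K (suc a) s

        ≤K⁺ : ∀ t s′ → K t s′ ≤ K⁺ t s′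
        ≤K⁺ t s′ with (t ℕ.≟ suc a) ×-dec (s′ ℕ.≟ s)
        ... | yes (refl , refl) = subst (K (suc a) s ≤_) (sym here⁺) (n≤1+n _)
        ... | no ne = ≤-reflexive (sym (else⁺ t s′ ne))

        flagged⁺ : Flagged n μ g K⁺
        flagged⁺ = record { pat = record { start = λ s′ → trans (else⁺ 0 s′ (λ ())) (start (pat fl) s′) ; fits = fits′ ; grows = grows′ ; strips = strips′ } ; fulls = fulls′ }
          where
          fits′ : ∀ t s′ → K⁺ t s′ ≤ μ s′
          fits′ t s′ with (t ℕ.≟ suc a) ×-dec (s′ ℕ.≟ s)
          ... | yes (refl , refl) = subst (_≤ μ s) (sym here⁺) short
          ... | no ne = subst (_≤ μ s′) (sym (else⁺ t s′ ne)) (fits (pat fl) t s′)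
          grows′ : ∀ t s′ → t < n → K⁺ t s′ ≤ K⁺ (suc t) s′
          grows′ t s′ lt with (t ℕ.≟ suc a) ×-dec (s′ ℕ.≟ s)
          ... | yes (refl , refl) = subst₂ _≤_ (sym here⁺) (sym (trans (else⁺ (2 + a) s (λ (e , _) → <-irrefl (sym e) ≤-refl)) (after (suc a) ≤-refl lt))) short
          ... | no ne = subst (_≤ K⁺ (suc t) s′) (sym (else⁺ t s′ ne)) (≤-trans (grows (pat fl) t s′ lt) (≤K⁺ (suc t) s′))
          strips′ : ∀ t s′ → t < n → K⁺ (suc t) (suc s′) ≤ K⁺ t s′
          strips′ t s′ lt with (t ℕ.≟ a) ×-dec (suc s′ ℕ.≟ s)
          ... | yes (refl , refl) = ≤-trans (subst (_≤ μ (suc s′)) (sym here⁺) short) (≤-trans (μ-anti s′) (≤-trans (≤-reflexive (sym (previous a s≤a lt))) (≤K⁺ a s′)))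
            where
            previous : ∀ t → s′ < t → t < n → K t s′ ≡ μ s′
            previous (suc t) (s≤s le) lt = above s′ t ≤-refl (<-trans ≤-refl lt) le
          ... | no ne = subst (_≤ K⁺ t s′) (sym (else⁺ (suc t) (suc s′) (λ (e , e′) → ne (suc-injective e , e′)))) (≤-trans (strips (pat fl) t s′ lt) (≤K⁺ t s′))
          fulls′ : ∀ t s′ → t < n → g s′ ≤ t → K⁺ (suc t) s′ ≡ μ s′
          fulls′ t s′ lt le with (t ℕ.≟ a) ×-dec (s′ ℕ.≟ s)
          ... | yes (refl , refl) = ⊥-elim (<-irrefl (fulls fl a s lt le) short)
          ... | no ne = trans (else⁺ (suc t) s′ (λ (e , e′) → ne (suc-injective e , e′))) (fulls fl t s′ lt le)

        mv : Movable n K⁺ a s b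
        mv = movable a+1<n s<n
          (subst₂ _≤_ (cong (_+ a) (sym (else⁺ a s (λ (e , _) → <-irrefl e ≤-refl)))) (sym b+s) (+-monoˡ-≤ a (grows (pat fl) a s a<n)))
          (trans (cong (_+ a) here⁺) (cong suc (sym b+s)))
          (subst₂ _<_ (sym (else⁺ (2 + a) (suc s) (λ (_ , e) → <-irrefl (sym e) ≤-refl))) (sym here⁺) (s≤s (strips (pat fl) (suc a) s a+1<n)))

        module M = Moving (pat flagged⁺) mv

        landed : InYoung λ′ (suc a) (suc b) × suc b < n
        -- Moving on from `K⁺` gives back K, so the landing place is a cell drawn by a flagged
        -- pattern and lies in λ′.
        landed = inside fl (suc a) (suc b) a+1<n (cell-cong (lower-lift K (suc a) s) M.new-cell)

        excite : ∀ {D : Diagram n} → Draws K D → Excite λ′ (draw n K⁺) D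
        excite {D} dr = i , j , i′ , j′ , trans ei′ (cong suc (sym ei)) , trans ej′ (cong suc (sym ej)) ,
            proj₂ (dr⁺ i j) (subst₂ (Cell n K⁺) (sym ei) (sym ej) M.old-cell) ,
            young (≤-reflexive ei′) (≤-trans (≤-reflexive ej) (n≤1+n b)) ,
            empty i′ j (λ c → M.below-free b ≤-refl (n≤1+n b) (subst₂ (Cell n K⁺) ei′ ej c)) ,
            young (≤-trans (≤-reflexive ei) (n≤1+n a)) (≤-reflexive ej′) ,
            empty i j′ (λ c → M.right-free (subst₂ (Cell n K⁺) ei ej′ c)) ,
            young (≤-reflexive ei′) (≤-reflexive ej′) ,
            empty i′ j′ (λ c → M.below-free (suc b) (n≤1+n b) ≤-refl (subst₂ (Cell n K⁺) ei′ ej′ c)) ,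
            draws-unique {K = K} {D = D} dr (draws-cong {D = D⁺} (lower-lift K (suc a) s) (M.moved {draw n K⁺} i j i′ j′ ei ej ei′ ej′ dr⁺))
          where
          b<n : b < n
          b<n = <-trans ≤-refl (proj₂ landed)
          i = fromℕ< a<n
          j = fromℕ< b<n
          i′ = fromℕ< a+1<n
          j′ = fromℕ< (proj₂ landed)
          ei = Finₚ.toℕ-fromℕ< a<n
          ej = Finₚ.toℕ-fromℕ< b<n
          ei′ = Finₚ.toℕ-fromℕ< a+1<n
          ej′ = Finₚ.toℕ-fromℕ< (proj₂ landed)
          dr⁺ : Draws K⁺ (draw n K⁺)
          dr⁺ = draws-draw n K⁺
          D⁺ : Diagram n
          D⁺ = setCell (setCell (draw n K⁺) i j false) i′ j′ true
          young : ∀ {r x} → r ≤ suc a → x ≤ suc b → InYoung λ′ r x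
          young p q = young-down p q (proj₁ landed)
          empty : ∀ (p q : Fin n) → ¬ Cell n K⁺ (toℕ p) (toℕ q) → cell (draw n K⁺) p q ≡ false
          empty p q ¬c = trans (cell-tabulate _ p q) (dec-false (cell? n K⁺ (toℕ p) (toℕ q)) ¬c)

        decrease : deficiency K ≡ suc (deficiency K⁺)
        decrease = sumF-bump _ _ (fromℕ< a<n)
          (λ t ne → sumF-cong {n} (λ s′ → cong (μ (toℕ s′) ∸_) (sym (else⁺ (suc (toℕ t)) (toℕ s′) (λ (e , _) → ne (Finₚ.toℕ-injective (trans (suc-injective e) (sym (Finₚ.toℕ-fromℕ< a<n)))))))))
          (sumF-bump _ _ (fromℕ< s<n)
            (λ s′ ne → cong (μ (toℕ s′) ∸_) (sym (else⁺ _ (toℕ s′) (λ (_ , e) → ne (Finₚ.toℕ-injective (trans e (sym (Finₚ.toℕ-fromℕ< s<n))))))))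
            point)
          where
          point : μ (toℕ (fromℕ< s<n)) ∸ K (suc (toℕ (fromℕ< a<n))) (toℕ (fromℕ< s<n)) ≡ suc (μ (toℕ (fromℕ< s<n)) ∸ K⁺ (suc (toℕ (fromℕ< a<n))) (toℕ (fromℕ< s<n)))
          point rewrite Finₚ.toℕ-fromℕ< s<n | Finₚ.toℕ-fromℕ< a<n | here⁺ = +-∸-assoc 1 short

      -- Induction on the deficiency: a flagged pattern other than the initial one arises by one
      -- excited move from the pattern constructed in `Undo`.
      reachable : ∀ d {K} → Flagged n μ g K → deficiency K ≤ d → ∀ {D : Diagram n} → Draws K D → Excited n λ′ μl D
      reachable d {K} fl le {D} dr with ℕₚ.anyUpTo? (λ s → ℕₚ.anyUpTo? (late? K s) n) n
      ... | no none = subst (Star (Excite λ′) (youngDiagram n μl)) (draws-unique {K = K} {D = youngDiagram n μl} {D} (draws-young (pat fl) ini) dr) ε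
        where
        ini : Initial K
        ini t s t<n s≤t with K (suc t) s ℕ.<? μ s
        ... | yes lt = ⊥-elim (none (s , ≤-<-trans s≤t t<n , t , t<n , s≤t , lt))
        ... | no ≮ = ≤-antisym (fits (pat fl) (suc t) s) (≮⇒≥ ≮)
      ... | yes (s₀ , _ , late₀) with least (λ s → ℕₚ.anyUpTo? (late? K s) n) s₀ late₀
      ...   | s , (t₀ , t₀<n , late₁) , minimal with greatest (late? K s) n t₀ t₀<n late₁
      ...     | a , a<n , (s≤a , short) , maximal = step d le
        where
        on-time′ : ∀ t s′ → ¬ Late K s′ t → s′ ≤ t → K (suc t) s′ ≡ μ s′
        on-time′ t s′ ¬l s′≤t = ≤-antisym (fits (pat fl) (suc t) s′) (≮⇒≥ (λ lt → ¬l (s′≤t , lt)))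
        module U = Undo fl a<n s≤a short (λ s′ t s′<s t<n s′≤t → on-time′ t s′ (λ l → minimal s′ s′<s (t , t<n , l)) s′≤t)
                        (λ t a<t t<n → on-time′ t s (maximal t a<t t<n) (≤-trans s≤a (<⇒≤ a<t)))
        step : ∀ d → deficiency K ≤ d → Excited n λ′ μl D
        step zero le = ⊥-elim (<⇒≱ (s≤s z≤n) (subst (_≤ 0) U.decrease le))
        step (suc d) le = reachable d U.flagged⁺ (≤-pred (subst (_≤ suc d) U.decrease le)) {draw n U.K⁺} (draws-draw n U.K⁺) ◅◅ (U.excite dr ◅ ε)

      excited⇒flagged : ∀ {D} → Excited n λ′ μl D → ∃[ K ] (Flagged n μ g K × Draws K D)
      excited⇒flagged = excited-flagged {youngDiagram n μl} (initial , initial-flagged , draws-young (pat initial-flagged) (λ t s _ s≤t → initial-< (s≤s s≤t)))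

    -- With layer t in common, a longer row s of K₂ would put a cell just after the interval of row
    -- s of K. Both arrays draw D, so K would own this cell as well, against `end-free`.
    draws-≤ : ∀ {K K₂} {D : Diagram n} → Flagged n μ g K → Flagged n μ g K₂ → Draws K D → Draws K₂ D →
      ∀ t → t < n → (∀ s → K t s ≡ K₂ t s) → ∀ s → K₂ (suc t) s ≤ K (suc t) s
    draws-≤ {K} {K₂} fl fl₂ dr dr₂ t t<n same s = ≮⇒≥ contra
      where
      contra : ¬ (K (suc t) s < K₂ (suc t) s)
      contra lt = PatternProperties.end-free (pat fl) t s x t<n x+s
          (subst₂ (Cell n K) ei ej (proj₁ (dr i j) (proj₂ (dr₂ i j) (subst₂ (Cell n K₂) (sym ei) (sym ej) c₂))))
        where
        s≤t : s ≤ t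
        s≤t = ≮⇒≥ (λ t<s → n≮0 (subst (K (suc t) s <_) (PatternProperties.diagonal (pat fl₂) (suc t) s t<n t<s) lt))
        x = K (suc t) s + t ∸ s
        x+s : x + s ≡ K (suc t) s + t
        x+s = m∸n+n≡m (≤-trans s≤t (m≤n+m t (K (suc t) s)))
        c₂ : Cell n K₂ t x
        c₂ = s , ≤-<-trans s≤t t<n , subst₂ _≤_ (cong (_+ t) (same s)) (sym x+s) (+-monoˡ-≤ t (grows (pat fl) t s t<n)) , subst (_< K₂ (suc t) s + t) (sym x+s) (+-monoˡ-< t lt)
        x<n : x < n
        x<n = proj₂ (inside fl₂ t x t<n c₂)
        i = fromℕ< t<n
        j = fromℕ< x<n
        ei = Finₚ.toℕ-fromℕ< t<n
        ej = Finₚ.toℕ-fromℕ< x<n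

    draws-injective : ∀ {K K₂} {D : Diagram n} → Flagged n μ g K → Flagged n μ g K₂ → Draws K D → Draws K₂ D → ∀ t → t ≤ n → ∀ s → K t s ≡ K₂ t s
    draws-injective fl fl₂ dr dr₂ zero _ s = trans (start (pat fl) s) (sym (start (pat fl₂) s))
    draws-injective {K} {K₂} {D} fl fl₂ dr dr₂ (suc t) lt s = ≤-antisym
      (draws-≤ {K₂} {K} {D} fl₂ fl dr₂ dr t lt (λ s → sym (ih s)) s) (draws-≤ {K} {K₂} {D} fl fl₂ dr dr₂ t lt ih s)
      where
      ih : ∀ s → K t s ≡ K₂ t s
      ih = draws-injective {K} {K₂} {D} fl fl₂ dr dr₂ t (<⇒≤ lt)

open ExcitedPatterns

-- Listing the flagged tableaux and their diagrams.

module Enumerations where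
  open import Data.Nat as ℕ using (ℕ; zero; suc; _≤_; _<_; s≤s; z≤n)
  open import Data.Integer using (ℤ; +_; 0ℤ; 1ℤ; _+_)
  import Data.Integer.Properties as ℤₚ
  open import Data.List using (List; []; _∷_; map; _++_; concatMap; filter; length; upTo; applyUpTo; cartesianProductWith)
  import Data.List.Properties as Listₚ
  open import Data.List.Relation.Unary.All as All using (All; []; _∷_)
  import Data.List.Relation.Unary.All.Properties as Allₚ
  open import Data.List.Relation.Unary.Any using (here; there)
  open import Data.List.Relation.Unary.AllPairs as AllPairs using (AllPairs; []; _∷_)
  import Data.List.Relation.Unary.AllPairs.Properties as AllPairsₚ
  open import Data.List.Relation.Unary.Unique.Propositional using (Unique)
  import Data.List.Relation.Unary.Unique.Propositional.Properties as Uniqueₚ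
  open import Data.List.Relation.Binary.Disjoint.Propositional using (Disjoint)
  open import Data.List.Membership.Propositional using (_∈_; find; lose)
  open import Data.List.Membership.Propositional.Properties
  open import Data.Vec using (Vec; []; _∷_)
  import Data.Vec.Properties as Vecₚ
  import Data.Fin.Properties as Finₚ
  open import Data.Unit using (⊤; tt)
  open import Data.Product using (_×_; _,_; proj₁; proj₂)
  open import Function using (_∘_; id; _⇔_; mk⇔)
  open import Relation.Nullary using (Dec; yes; no)
  open import Relation.Binary.PropositionalEquality hiding (J)
  open import Data.Nat.Properties using (+-identityʳ; +-suc; <⇒≤; m≤m+n; n≤0⇒n≡0; ≤-<-trans; ≤-refl; ≮⇒≥)

  ΣL : ∀ {A : Set} → List A → (A → ℤ) → ℤ
  ΣL [] F = 0ℤ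
  ΣL (x ∷ xs) F = F x + ΣL xs F

  ΣL-++ : ∀ {A : Set} (xs ys : List A) F → ΣL (xs ++ ys) F ≡ ΣL xs F + ΣL ys F
  ΣL-++ [] ys F = sym (ℤₚ.+-identityˡ _)
  ΣL-++ (x ∷ xs) ys F = trans (cong (λ z → F x + z) (ΣL-++ xs ys F)) (sym (ℤₚ.+-assoc (F x) _ _))

  ΣL-map : ∀ {A C : Set} (h : A → C) xs F → ΣL (map h xs) F ≡ ΣL xs (F ∘ h)
  ΣL-map h [] F = refl
  ΣL-map h (x ∷ xs) F = cong (λ z → F (h x) + z) (ΣL-map h xs F)

  ΣL-product : ∀ {A C E : Set} (h : A → C → E) xs ys F → ΣL (cartesianProductWith h xs ys) F ≡ ΣL xs (λ x → ΣL ys (λ y → F (h x y)))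
  ΣL-product h [] ys F = refl
  ΣL-product h (x ∷ xs) ys F = trans (ΣL-++ (map (h x) ys) _ F) (cong₂ _+_ (ΣL-map (h x) ys F) (ΣL-product h xs ys F))

  ΣL-upTo : ∀ n (h : ℕ → ℕ) F → ΣL (applyUpTo h n) F ≡ Σ< n (F ∘ h)
  ΣL-upTo zero h F = refl
  ΣL-upTo (suc n) h F = trans (cong (λ z → F (h 0) + z) (ΣL-upTo n (h ∘ suc) F)) (sym (Σ<-head n (F ∘ h)))

  vec-ext : ∀ {R} (v w : Vec ℕ R) → (∀ s → at v s ≡ at w s) → v ≡ w
  vec-ext [] [] e = refl
  vec-ext (x ∷ v) (y ∷ w) e = cong₂ _∷_ (e 0) (vec-ext v w (e ∘ suc))

  vecOf-all : ∀ R (F : ℕ → ℕ) → (∀ s → R ≤ s → F s ≡ 0) → ∀ s → at (vecOf R F) s ≡ F s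
  vecOf-all R F z s with s ℕ.<? R
  ... | yes lt = at-vecOf R F s lt
  ... | no ≮ = trans (at-beyond (vecOf R F) s (≮⇒≥ ≮)) (sym (z s (≮⇒≥ ≮)))

  -- Injectivity is asked for on members of the list only, because it is for flagged arrays that the
  -- drawing is shown to determine the array.
  unique-map : ∀ {A C : Set} (h : A → C) xs → Unique xs → (∀ {x y} → x ∈ xs → y ∈ xs → h x ≡ h y → x ≡ y) → Unique (map h xs)
  unique-map h [] [] inj = []
  unique-map h (x ∷ xs) (ne ∷ u) inj = Allₚ.map⁺ (All.tabulate (λ {y} y∈ e → All.lookup ne y∈ (inj (here refl) (there y∈) e))) ∷
    unique-map h xs u (λ p q → inj (there p) (there q))

  module Enumeration (B R : ℕ) (μ g : ℕ → ℕ) where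
    open Box B
    open Chains B R

    box : ∀ T → List (Vec ℕ T)
    box zero = [] ∷ []
    box (suc T) = cartesianProductWith _∷_ (upTo B) (box T)

    ΣL-box : ∀ T F → ΣL (box T) F ≡ ΣB T F
    ΣL-box zero F = ℤₚ.+-identityʳ _
    ΣL-box (suc T) F = trans (ΣL-product _∷_ (upTo B) (box T) F) (trans (ΣL-upTo B id (λ x → ΣL (box T) (λ v → F (x ∷ v))))
      (Σ<-cong B (λ b _ → ΣL-box T (λ v → F (b ∷ v)))))

    box-unique : ∀ T → Unique (box T)
    box-unique zero = [] ∷ []
    box-unique (suc T) = Uniqueₚ.cartesianProductWith⁺ _∷_ Vecₚ.∷-injective (Uniqueₚ.upTo⁺ B) (box-unique T)

    ∈-box : ∀ {T} (v : Vec ℕ T) → (∀ s → s < T → at v s < B) → v ∈ box T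
    ∈-box [] h = here refl
    ∈-box (x ∷ v) h = ∈-cartesianProductWith⁺ _∷_ (∈-upTo⁺ (h 0 (s≤s z≤n))) (∈-box v (λ s lt → h (suc s) (s≤s lt)))

    nexts : ℕ → Vec ℕ R → List (Vec ℕ R)
    nexts t α = filter (step? μ g t α) (box R)

    -- Follows the recursion of `S`, so that the value of `S` at the constant functional 1 is the
    -- length of this list.
    chains : ∀ k (t : ℕ) → Vec ℕ R → List (Vec (Vec ℕ R) k)
    chains zero t α = [] ∷ []
    chains (suc k) t α = concatMap (λ β → map (β ∷_) (chains k (suc t) β)) (nexts t α)

    length-concatMap-filter : ∀ {A C : Set} {P : A → Set} (P? : ∀ x → Dec (P x)) (h : A → List C) xs →
      + length (concatMap h (filter P? xs)) ≡ ΣL xs (λ x → when (P? x) (+ length (h x)))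
    length-concatMap-filter P? h [] = refl
    length-concatMap-filter P? h (x ∷ xs) with P? x
    ... | no _ = trans (length-concatMap-filter P? h xs) (sym (ℤₚ.+-identityˡ _))
    ... | yes _ = trans (cong +_ (Listₚ.length-++ (h x))) (cong (λ z → + length (h x) + z) (length-concatMap-filter P? h xs))

    length-chains : ∀ k t α → + length (chains k t α) ≡ S μ g k t α (λ _ → 1ℤ)
    length-chains zero t α = refl
    length-chains (suc k) t α = trans (length-concatMap-filter (step? μ g t α) (λ β → map (β ∷_) (chains k (suc t) β)) (box R))
      (trans (ΣL-box R _) (ΣB-cong R (λ β → cong (when (step? μ g t α β)) (trans (cong +_ (Listₚ.length-map (β ∷_) (chains k (suc t) β))) (length-chains k (suc t) β)))))

    Path : ∀ k (t : ℕ) → Vec ℕ R → Vec (Vec ℕ R) k → Set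
    Path zero t α [] = ⊤
    Path (suc k) t α (β ∷ vs) = Step μ g t α β × Path k (suc t) β vs

    ∈-chains⁻ : ∀ k t α {vs} → vs ∈ chains k t α → Path k t α vs
    ∈-chains⁻ zero t α {[]} _ = tt
    ∈-chains⁻ (suc k) t α {vs} vs∈ with find (∈-concatMap⁻ (λ β → map (β ∷_) (chains k (suc t) β)) {xs = nexts t α} vs∈)
    ... | β , β∈ , vs∈′ with ∈-map⁻ (β ∷_) vs∈′
    ...   | ws , ws∈ , refl = proj₂ (∈-filter⁻ (step? μ g t α) {xs = box R} β∈) , ∈-chains⁻ k (suc t) β ws∈

    ∈-chains⁺ : (∀ s → μ s < B) → ∀ k t α {vs} → Path k t α vs → vs ∈ chains k t α
    ∈-chains⁺ bd zero t α {[]} _ = here refl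
    ∈-chains⁺ bd (suc k) t α {β ∷ vs} (st , p) = ∈-concatMap⁺ (λ β → map (β ∷_) (chains k (suc t) β))
      (lose (∈-filter⁺ (step? μ g t α) (∈-box β (λ s _ → ≤-<-trans (fit st s) (bd s))) st) (∈-map⁺ (β ∷_) (∈-chains⁺ bd k (suc t) β p)))

    chains-unique : ∀ k t α → Unique (chains k t α)
    chains-unique zero t α = [] ∷ []
    chains-unique (suc k) t α = Uniqueₚ.concat⁺
      (Allₚ.map⁺ (All.universal (λ β → Uniqueₚ.map⁺ Vecₚ.∷-injectiveʳ (chains-unique k (suc t) β)) (nexts t α)))
      (AllPairsₚ.map⁺ (AllPairs.map disjoint (Uniqueₚ.filter⁺ (step? μ g t α) (box-unique R))))
      where
      disjoint : ∀ {β β′} → β ≢ β′ → Disjoint (map (β ∷_) (chains k (suc t) β)) (map (β′ ∷_) (chains k (suc t) β′))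
      disjoint {β} {β′} ne (p , q) with ∈-map⁻ (β ∷_) p | ∈-map⁻ (β′ ∷_) q
      ... | _ , _ , refl | _ , _ , e = ne (Vecₚ.∷-injectiveˡ e)

    -- Constant after the last layer, so that `fits` holds for every t.
    layer : ∀ {k} → Vec ℕ R → Vec (Vec ℕ R) k → ℕ → Vec ℕ R
    layer α vs zero = α
    layer α [] (suc t) = α
    layer α (β ∷ vs) (suc t) = layer β vs t

    layers-injective : ∀ {k} (α : Vec ℕ R) (vs ws : Vec (Vec ℕ R) k) → (∀ t → t ≤ k → layer α vs t ≡ layer α ws t) → vs ≡ ws
    layers-injective α [] [] e = refl
    layers-injective α (β ∷ vs) (β′ ∷ ws) e with e 1 (s≤s z≤n)
    ... | refl = cong (β ∷_) (layers-injective β vs ws (λ t le → e (suc t) (s≤s le)))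

    path-step : ∀ k t₀ α {vs} → Path k t₀ α vs → ∀ t → t < k → Step μ g (t₀ ℕ.+ t) (layer α vs t) (layer α vs (suc t))
    path-step (suc k) t₀ α {β ∷ vs} (st , p) zero lt = subst (λ x → Step μ g x α β) (sym (+-identityʳ t₀)) st
    path-step (suc k) t₀ α {β ∷ vs} (st , p) (suc t) (s≤s lt) =
      subst (λ x → Step μ g x (layer β vs t) (layer β vs (suc t))) (sym (+-suc t₀ t)) (path-step k (suc t₀) β p t lt)

    path-fits : ∀ k t₀ α {vs} → (∀ s → at α s ≤ μ s) → Path k t₀ α vs → ∀ t s → at (layer α vs t) s ≤ μ s
    path-fits k t₀ α fα p zero s = fα s
    path-fits zero t₀ α {[]} fα p (suc t) s = fα s
    path-fits (suc k) t₀ α {β ∷ vs} fα (st , p) (suc t) s = path-fits k (suc t₀) β (fit st) p t s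

    rows : Array → ∀ k (t : ℕ) → Vec (Vec ℕ R) k
    rows K zero t = []
    rows K (suc k) t = vecOf R (K (suc t)) ∷ rows K k (suc t)

    layer-rows : ∀ K k t₀ t → t ≤ k → layer (vecOf R (K t₀)) (rows K k t₀) t ≡ vecOf R (K (t₀ ℕ.+ t))
    layer-rows K k t₀ zero _ = cong (λ x → vecOf R (K x)) (sym (+-identityʳ t₀))
    layer-rows K (suc k) t₀ (suc t) (s≤s le) = trans (layer-rows K k (suc t₀) t le) (cong (λ x → vecOf R (K x)) (sym (+-suc t₀ t)))

  module Count {n μ g λ′} (bounded : Bounded n μ g λ′) (μ<n : ∀ s → μ s < n) (μl : List ℕ) (μ≡ : ∀ s → part μl s ≡ μ s) where
    open Bounded bounded
    open Excitation bounded
    open Enumeration (bound n) n μ g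
    open Flagged
    open Pattern

    array : Vec (Vec ℕ n) n → Array
    array vs t = at (layer (zeros n) vs t)

    path-flagged : ∀ {vs} → Path n 0 (zeros n) vs → Flagged n μ g (array vs)
    path-flagged {vs} p = record
      { pat = record
        { start = at-zeros n
        ; fits = path-fits n 0 (zeros n) {vs} (λ s → subst (_≤ μ s) (sym (at-zeros n s)) z≤n) p
        ; grows = λ t s lt → grow (path-step n 0 (zeros n) {vs} p t lt) s
        ; strips = λ t s lt → strip (path-step n 0 (zeros n) {vs} p t lt) s }
      ; fulls = fulls′ }
      where
      fulls′ : ∀ t s → t < n → g s ≤ t → array vs (suc t) s ≡ μ s
      fulls′ t s lt le with s ℕ.<? n
      ... | yes s<n = full (path-step n 0 (zeros n) {vs} p t lt) s s<n le
      ... | no ≮ = trans (at-beyond (layer (zeros n) vs (suc t)) s (≮⇒≥ ≮)) (sym (μ-zero s (≮⇒≥ ≮)))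

    module _ {K} (fl : Flagged n μ g K) where
      at-K : ∀ t s → at (vecOf n (K t)) s ≡ K t s
      at-K t = vecOf-all n (K t) (λ s le → n≤0⇒n≡0 (subst (K t s ≤_) (μ-zero s le) (fits (pat fl) t s)))

      step-K : ∀ t → t < n → Step μ g t (vecOf n (K t)) (vecOf n (K (suc t)))
      step-K t lt = mkStep (λ s → subst₂ _≤_ (sym (at-K t s)) (sym (at-K (suc t) s)) (grows (pat fl) t s lt))
        (λ s → subst (_≤ μ s) (sym (at-K (suc t) s)) (fits (pat fl) (suc t) s))
        (λ s → subst₂ _≤_ (sym (at-K (suc t) (suc s))) (sym (at-K t s)) (strips (pat fl) t s lt))
        (λ s _ le → trans (at-K (suc t) s) (fulls fl t s lt le))

      path-rows : ∀ k t → t ℕ.+ k ≡ n → Path k t (vecOf n (K t)) (rows K k t)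
      path-rows zero t e = tt
      path-rows (suc k) t e = step-K t (subst (t <_) e (subst (t <_) (sym (+-suc t k)) (s≤s (m≤m+n t k)))) , path-rows k (suc t) (trans (sym (+-suc t k)) e)

      zeros≡ : vecOf n (K 0) ≡ zeros n
      zeros≡ = vec-ext _ _ (λ s → trans (at-K 0 s) (trans (start (pat fl) s) (sym (at-zeros n s))))

      path-K : Path n 0 (zeros n) (rows K n 0)
      path-K = subst (λ α → Path n 0 α (rows K n 0)) zeros≡ (path-rows n 0 refl)

      array-K : ∀ t → t ≤ n → ∀ s → array (rows K n 0) t s ≡ K t s
      array-K t le s = trans (cong (λ α → at (layer α (rows K n 0) t) s) (sym zeros≡)) (trans (cong (λ v → at v s) (layer-rows K n 0 t le)) (at-K t s))

    -- The rows of a path reproduce an array up to layer n only, and cells inside the grid refer to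
    -- no later layer.
    cells-agree : ∀ {K K₂ t x} → (∀ t → t ≤ n → ∀ s → K t s ≡ K₂ t s) → t < n → Cell n K t x → Cell n K₂ t x
    cells-agree {t = t} {x} e lt (s , s<n , lo , hi) = s , s<n , subst (λ k → k ℕ.+ t ≤ x ℕ.+ s) (e t (<⇒≤ lt) s) lo , subst (λ k → x ℕ.+ s < k ℕ.+ t) (e (suc t) lt s) hi

    diagrams : List (Diagram n)
    diagrams = map (λ vs → draw n (array vs)) (chains n 0 (zeros n))

    diagrams-unique : Unique diagrams
    diagrams-unique = unique-map (λ vs → draw n (array vs)) (chains n 0 (zeros n)) (chains-unique n 0 (zeros n)) inj
      where
      inj : ∀ {vs ws} → vs ∈ chains n 0 (zeros n) → ws ∈ chains n 0 (zeros n) → draw n (array vs) ≡ draw n (array ws) → vs ≡ ws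
      inj {vs} {ws} vs∈ ws∈ e = layers-injective (zeros n) vs ws (λ t le → vec-ext _ _
        (draws-injective {array vs} {array ws} {draw n (array ws)} (path-flagged {vs} (∈-chains⁻ n 0 (zeros n) vs∈)) (path-flagged {ws} (∈-chains⁻ n 0 (zeros n) ws∈))
          (subst (Draws (array vs)) e (draws-draw n (array vs))) (draws-draw n (array ws)) t le))

    ∈-diagrams : ∀ D → D ∈ diagrams ⇔ Excited n λ′ μl D
    ∈-diagrams D = mk⇔ to from
      where
      to : D ∈ diagrams → Excited n λ′ μl D
      to D∈ with ∈-map⁻ (λ vs → draw n (array vs)) D∈
      ... | vs , vs∈ , refl = reachable μl μ≡ (deficiency μl μ≡ (array vs)) (path-flagged {vs} (∈-chains⁻ n 0 (zeros n) vs∈)) ≤-refl (draws-draw n (array vs))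
      from : Excited n λ′ μl D → D ∈ diagrams
      from ex with excited⇒flagged μl μ≡ ex
      ... | K , fl , dr = subst (_∈ diagrams) drawn (∈-map⁺ (λ vs → draw n (array vs)) (∈-chains⁺ (λ s → <bound (μ<n s)) n 0 (zeros n) (path-K fl)))
        where
        drawn : draw n (array (rows K n 0)) ≡ D
        drawn = draws-unique {K = K} {D = draw n (array (rows K n 0))} {D}
          (λ i j → (λ e → cells-agree (array-K fl) (Finₚ.toℕ<n i) (proj₁ (draws-draw n (array (rows K n 0)) i j) e)) ,
                   (λ c → proj₂ (draws-draw n (array (rows K n 0)) i j) (cells-agree (λ t le s → sym (array-K fl t le s)) (Finₚ.toℕ<n i) c))) dr

    hasCard : HasCard n λ′ μl (length diagrams)
    hasCard = diagrams , diagrams-unique , ∈-diagrams , refl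

    card≡ : + length diagrams ≡ Chains.S (bound n) n μ g n 0 (zeros n) (λ _ → 1ℤ)
    card≡ = trans (cong +_ (Listₚ.length-map (λ vs → draw n (array vs)) (chains n 0 (zeros n)))) (length-chains n 0 (zeros n))

open Enumerations

-- The Rothe diagram of a vexillary permutation and its supershape.

module RotheDiagrams where
  open import Data.Nat as ℕ using (ℕ; zero; suc; _∸_; _≤_; _<_; _≥_; s≤s; z≤n; _+_; _⊓_)
  import Data.Nat.Properties as ℕₚ
  open import Data.Nat.Tactic.RingSolver using (solve-∀)
  open import Data.Integer as ℤ using (1ℤ)
  open import Data.Fin as Fin using (Fin; toℕ)
  import Data.Fin.Properties as Finₚ
  open import Data.Fin.Permutation using (Permutation′; _⟨$⟩ʳ_; _⟨$⟩ˡ_; inverseˡ)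
  open import Data.List as List using (List; []; _∷_; map; filter; length; reverse)
  import Data.List.Properties as Listₚ
  open import Data.List.Relation.Unary.All as All using (All; []; _∷_)
  open import Data.List.Relation.Unary.Any using (here)
  open import Data.List.Relation.Unary.AllPairs using (AllPairs; []; _∷_)
  import Data.List.Relation.Unary.AllPairs.Properties as AllPairsₚ
  open import Data.List.Relation.Unary.Linked using (Linked; []; [-]; _∷_)
  open import Data.List.Relation.Unary.Linked.Properties using (Linked⇒AllPairs)
  open import Data.List.Relation.Binary.Permutation.Propositional using (↭-sym; ↭-trans)
  open import Data.List.Relation.Binary.Permutation.Propositional.Properties using (↭-length; filter-↭; ↭-reverse; All-resp-↭)
  open import Data.List.Sort ℕₚ.≤-decTotalOrder using (sort; sort-↭; sort-↗)
  import Data.Vec as Vec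
  open import Data.Empty using (⊥-elim)
  open import Data.Sum using (_⊎_; inj₁; inj₂)
  open import Data.Product using (∃-syntax; _×_; _,_; proj₁; proj₂)
  open import Function using (_∘_; mk⇔)
  open import Relation.Nullary using (¬_; Dec; yes; no)
  open import Relation.Nullary.Decidable using (_×-dec_; ¬?)
  open import Relation.Binary using (tri<; tri≈; tri>)
  open import Relation.Binary.PropositionalEquality hiding (J)
  open import Relation.Binary.Construct.Closure.ReflexiveTransitive using (ε)
  import Algebra.Properties.CommutativeMonoid.Sum ℕₚ.+-0-commutativeMonoid as Sum
  open import Data.Nat.Properties using (*-monoʳ-<; +-cancelʳ-≤; +-comm; +-identityʳ; +-mono-≤; +-monoˡ-≤; +-suc; <-asym; <-cmp; <-irrefl; <-trans; <-≤-trans; <⇒≤; <⇒≱; m+[n∸m]≡n; m<n⇒m<1+n; m∸n≤m; m≤n⇒m<n∨m≡n; m⊓n≤m; m⊓n≤n; n≤0⇒n≡0; n≮0; ≤-<-trans; ≤-antisym; ≤-pred; ≤-refl; ≤-reflexive; ≤-trans; ≤∧≢⇒<; ≮⇒≥; ≰⇒>; ⊓-glb; ⊓-monoˡ-≤)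

  countBy : ∀ {A : Set} {P : A → Set} → (∀ x → Dec (P x)) → List A → ℕ
  countBy P? [] = 0
  countBy P? (x ∷ l) = ind (P? x) + countBy P? l

  length-filter : ∀ {A : Set} {P : A → Set} (P? : ∀ x → Dec (P x)) l → length (filter P? l) ≡ countBy P? l
  length-filter P? [] = refl
  length-filter P? (x ∷ l) with P? x
  ... | yes _ = cong suc (length-filter P? l)
  ... | no _ = length-filter P? l

  countBy-none : ∀ {A : Set} {P : A → Set} (P? : ∀ x → Dec (P x)) {l} → All (λ x → ¬ P x) l → countBy P? l ≡ 0
  countBy-none P? [] = refl
  countBy-none P? {x ∷ l} (¬p ∷ h) with P? x
  ... | yes p = ⊥-elim (¬p p)
  ... | no _ = countBy-none P? h

  countBy-filter : ∀ {A : Set} {P Q : A → Set} (P? : ∀ x → Dec (P x)) (Q? : ∀ x → Dec (Q x)) → (∀ x → P x → Q x) →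
    ∀ l → countBy P? (filter Q? l) ≡ countBy P? l
  countBy-filter P? Q? P⊆Q [] = refl
  countBy-filter P? Q? P⊆Q (x ∷ l) with Q? x
  ... | yes _ = cong (λ c → ind (P? x) + c) (countBy-filter P? Q? P⊆Q l)
  ... | no ¬q with P? x
  ...   | yes p = ⊥-elim (¬q (P⊆Q x p))
  ...   | no _ = countBy-filter P? Q? P⊆Q l

  countL : ℕ → List ℕ → ℕ
  countL k = countBy (k ℕ.≤?_)

  part-bound : ∀ x l s → All (_≤ x) l → part l s ≤ x
  part-bound x [] s h = z≤n
  part-bound x (y ∷ l) zero (y≤x ∷ h) = y≤x
  part-bound x (y ∷ l) (suc s) (_ ∷ h) = part-bound x l s h

  part⇒count : ∀ k l s → 0 < k → AllPairs _≥_ l → k ≤ part l s → s < countL k l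
  part⇒count k [] s pos ap le = ⊥-elim (<⇒≱ pos le)
  part⇒count k (x ∷ l) s pos (x≥ ∷ ap) le = go s le (k ℕ.≤? x)
    where
    go : ∀ s → k ≤ part (x ∷ l) s → (d : Dec (k ≤ x)) → s < ind d + countL k l
    go zero le (yes _) = s≤s z≤n
    go (suc s) le (yes _) = s≤s (part⇒count k l s pos ap le)
    go s le (no ≰) = ⊥-elim (≰ (≤-trans le (part-bound x (x ∷ l) s (≤-refl ∷ x≥))))

  count⇒part : ∀ k l s → AllPairs _≥_ l → s < countL k l → k ≤ part l s
  count⇒part k [] s ap ()
  count⇒part k (x ∷ l) s (x≥ ∷ ap) lt = go s (k ℕ.≤? x) lt
    where
    go : ∀ s (d : Dec (k ≤ x)) → s < ind d + countL k l → k ≤ part (x ∷ l) s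
    go zero (yes le) lt = le
    go (suc s) (yes _) (s≤s lt) = count⇒part k l s ap lt
    go s (no ≰) lt = ⊥-elim (n≮0 (subst (s <_) (countBy-none (k ℕ.≤?_) (All.map (λ y≤x k≤y → ≰ (≤-trans k≤y y≤x)) x≥)) lt))

  length-filter-tabulate : ∀ {n} {A : Set} {P : A → Set} (P? : ∀ x → Dec (P x)) (h : Fin n → A) → length (filter P? (List.tabulate h)) ≡ cnt (P? ∘ h)
  length-filter-tabulate {zero} P? h = refl
  length-filter-tabulate {suc n} P? h with P? (h Fin.zero)
  ... | yes _ = cong suc (length-filter-tabulate P? (h ∘ Fin.suc))
  ... | no _ = length-filter-tabulate P? (h ∘ Fin.suc)

  reverse-descending : ∀ l → AllPairs ℕ._≤_ l → AllPairs _≥_ (reverse l)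
  reverse-descending [] [] = []
  reverse-descending (x ∷ l) (x≤ ∷ ap) = subst (AllPairs _≥_) (sym (Listₚ.unfold-reverse x l))
    (AllPairsₚ.++⁺ (reverse-descending l ap) ([] ∷ []) (All.map (λ p → p ∷ []) (All-resp-↭ (↭-sym (↭-reverse l)) x≤)))

  module _ {n} (w : Permutation′ n) where
    values : Fin n → ℕ
    values j = toℕ (w ⟨$⟩ʳ j)

    rowLength≡code : ∀ j → rowLength w j ≡ code values j
    rowLength≡code j = length-filter-tabulate (λ k → (j Fin.<? k) ×-dec ((w ⟨$⟩ʳ k) Fin.<? (w ⟨$⟩ʳ j))) (λ k → k)

    -- Sorting and reversing only permute the parts, and the filter discards zeros, which a positive
    -- k does not count.
    shape-count : ∀ k → 0 < k → countL k (shape w) ≡ height (code values) k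
    shape-count k pos = trans (sym (length-filter (k ℕ.≤?_) (shape w)))
      (trans (↭-length (filter-↭ (k ℕ.≤?_) (↭-trans (↭-reverse (sort lengths)) (sort-↭ lengths))))
      (trans (length-filter (k ℕ.≤?_) lengths)
      (trans (countBy-filter (k ℕ.≤?_) (1 ℕ.≤?_) (λ x → ≤-trans pos) (List.tabulate (rowLength w)))
      (trans (sym (length-filter (k ℕ.≤?_) (List.tabulate (rowLength w))))
      (trans (length-filter-tabulate (k ℕ.≤?_) (rowLength w))
        (cnt-cong (λ j → k ℕ.≤? rowLength w j) (λ j → k ℕ.≤? code values j) (λ j → subst (k ≤_) (rowLength≡code j)) (λ j → subst (k ≤_) (sym (rowLength≡code j)))))))))
      where lengths = filter (1 ℕ.≤?_) (List.tabulate (rowLength w))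

    shape-descending : AllPairs _≥_ (shape w)
    shape-descending = reverse-descending _ (Linked⇒AllPairs ≤-trans (sort-↗ _))

    -- Both sides are weakly decreasing with the same column lengths, and these determine a
    -- partition.
    part-shape : ∀ s → part (shape w) s ≡ shapeOf (code values) s
    part-shape s = ≤-antisym (below (part (shape w) s) ≤-refl) (above (shapeOf (code values) s) ≤-refl)
      where
      below : ∀ k → k ≤ part (shape w) s → k ≤ shapeOf (code values) s
      below zero _ = z≤n
      below (suc k) le = height⇒shape (code values) (code< values)
        (subst (s <_) (shape-count (suc k) (s≤s z≤n)) (part⇒count (suc k) (shape w) s (s≤s z≤n) shape-descending le))
      above : ∀ k → k ≤ shapeOf (code values) s → k ≤ part (shape w) s
      above zero _ = z≤n
      above (suc k) le = count⇒part (suc k) (shape w) s shape-descending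
        (subst (s <_) (sym (shape-count (suc k) (s≤s z≤n))) (shape⇒height (code values) (s≤s z≤n) le))

    values-injective : Injective values
    values-injective {x} {y} e = trans (sym (inverseˡ w)) (trans (cong (w ⟨$⟩ˡ_) (Finₚ.toℕ-injective e)) (inverseˡ w))

    sumF≡sum : ∀ {m} (h : Fin m → ℕ) → sumF h ≡ Sum.sum h
    sumF≡sum {zero} h = refl
    sumF≡sum {suc m} h = cong (λ x → h Fin.zero + x) (sumF≡sum (h ∘ Fin.suc))

    -- Summing an indicator along a permutation is summing it over all values.
    rank : ∀ y → y ≤ n → cnt (λ k → values k ℕ.<? y) ≡ y
    rank y y≤n = trans (sumF≡sum {n} (below ∘ (w ⟨$⟩ʳ_))) (trans (sym (Sum.sum-permute below w)) (trans (sym (sumF≡sum {n} below))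
      (≤-antisym (cnt-below n y) (≤-trans (cnt-range {n} 0 y y≤n)
        (cnt-mono {n} (λ k → (0 ℕ.≤? toℕ k) ×-dec (toℕ k ℕ.<? y)) (λ k → toℕ k ℕ.<? y) (λ _ → proj₂))))))
      where
      below : Fin n → ℕ
      below v = ind (toℕ v ℕ.<? y)

  cnt-cover : ∀ {n} {P Q T : Fin n → Set} (P? : ∀ k → Dec (P k)) (Q? : ∀ k → Dec (Q k)) (T? : ∀ k → Dec (T k)) →
    (∀ k → T k → P k ⊎ Q k) → cnt T? ≤ cnt P? + cnt Q?
  cnt-cover {zero} P? Q? T? h = z≤n
  cnt-cover {suc n} P? Q? T? h = ≤-trans (+-mono-≤ (head (P? Fin.zero) (Q? Fin.zero) (T? Fin.zero)) (cnt-cover (P? ∘ Fin.suc) (Q? ∘ Fin.suc) (T? ∘ Fin.suc) (h ∘ Fin.suc)))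
    (≤-reflexive (swap (ind (P? Fin.zero)) (ind (Q? Fin.zero)) _ _))
    where
    swap : ∀ a b c e → (a + b) + (c + e) ≡ (a + c) + (b + e)
    swap = solve-∀
    head : ∀ p? q? t? → ind t? ≤ ind p? + ind q?
    head p? q? (no _) = z≤n
    head (yes _) q? (yes t) = s≤s z≤n
    head (no ¬p) (yes _) (yes t) = ≤-refl
    head (no ¬p) (no ¬q) (yes t) with h _ t
    ... | inj₁ p = ⊥-elim (¬p p)
    ... | inj₂ q = ⊥-elim (¬q q)

  jump : ∀ (N : ℕ → ℕ) k n → N 0 < k → k ≤ N n → ∃[ y ] (N y < k × k ≤ N (suc y))
  jump N k zero lt le = ⊥-elim (<⇒≱ lt le)
  jump N k (suc n) lt le with k ℕ.≤? N n
  ... | yes p = jump N k n lt p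
  ... | no ≰ = n , ≰⇒> ≰ , le

  module RotheBounds {n} (w : Permutation′ n) where
    f : Fin n → ℕ
    f = values w

    c : Fin n → ℕ
    c = code f

    f<n : ∀ j → f j < n
    f<n j = Finₚ.toℕ<n (w ⟨$⟩ʳ j)

    -- The k-th cell of row j: its column is found by counting the values below it.
    far-cell : ∀ k j → 0 < k → k ≤ c j → ∃[ l ] (Inv f j l × k + toℕ j ≤ f l + height c k)
    far-cell k j pos k≤ with jump (λ y → cnt (N? y)) k n (≤-<-trans (cnt-mono (N? 0) (λ l → toℕ l ℕ.<? 0) (λ l (_ , lt) → ⊥-elim (n≮0 lt))) (≤-<-trans (cnt-below n 0) pos))
                                     (≤-trans k≤ (cnt-mono (Inv? f j) (N? n) (λ l inv → inv , f<n l)))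
      where
      N? : ∀ y l → Dec (Inv f j l × f l < y)
      N? y l = Inv? f j l ×-dec (f l ℕ.<? y)
    ... | y , small , big with cnt-surplus (λ l → Inv? f j l ×-dec (f l ℕ.<? y)) (λ l → Inv? f j l ×-dec (f l ℕ.<? suc y)) (<-≤-trans small big)
    ...   | l , (inv , lt) , ¬below = l , inv , bound′
      where
      N? : ∀ y l → Dec (Inv f j l × f l < y)
      N? y l = Inv? f j l ×-dec (f l ℕ.<? y)
      fl : f l ≡ y
      fl = ≤-antisym (≤-pred lt) (≮⇒≥ (λ p → ¬below (inv , p)))
      N-suc : cnt (N? (suc y)) ≡ suc (cnt (N? y))
      N-suc = cnt-insert (N? y) (N? (suc y)) l ¬below (inv , lt) (λ l′ (i , p) → i , m<n⇒m<1+n p) split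
        where
        split : ∀ l′ → Inv f j l′ × f l′ < suc y → l′ ≡ l ⊎ (Inv f j l′ × f l′ < y)
        split l′ (i , p) with m≤n⇒m<n∨m≡n (≤-pred p)
        ... | inj₁ q = inj₂ (i , q)
        ... | inj₂ e = inj₁ (values-injective w (trans e (sym fl)))
      Left? : ∀ l′ → Dec (l′ Fin.< j × f l′ < y)
      Left? l′ = (l′ Fin.<? j) ×-dec (f l′ ℕ.<? y)
      Right? : ∀ l′ → Dec (l′ Fin.< j × ¬ (f l′ < y))
      Right? l′ = (l′ Fin.<? j) ×-dec ¬? (f l′ ℕ.<? y)
      below-y : cnt (N? y) + cnt Left? ≤ y
      below-y = subst (cnt (N? y) + cnt Left? ≤_) (rank w y (subst (_≤ n) fl (<⇒≤ (f<n l))))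
        (cnt-disjoint (N? y) Left? (λ l′ → f l′ ℕ.<? y) (λ l′ ((j<l′ , _) , _) (l′<j , _) → <-asym j<l′ l′<j) (λ l′ → proj₂) (λ l′ → proj₂))
      y<fj : y < f j
      y<fj = subst (_< f j) fl (proj₂ inv)
      -- A position before j with a value above y has the first k inversions of j among its own
      -- inversions and therefore lies in column k, as does j itself.
      above-y : cnt Right? < height c k
      above-y = cnt-strict Right? (λ l′ → k ℕ.≤? c l′) j tall (λ (p , _) → <-irrefl refl p) k≤
        where
        tall : ∀ l′ → l′ Fin.< j × ¬ (f l′ < y) → k ≤ c l′
        tall l′ (l′<j , ≮) = ≤-trans big (cnt-mono (N? (suc y)) (Inv? f l′) (λ q ((j<q , _) , fq) → <-trans l′<j j<q , ≤-<-trans (≤-pred fq) y<fl′))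
          where
          y<fl′ : y < f l′
          y<fl′ = ≤∧≢⇒< (≮⇒≥ ≮) (λ e → <-irrefl (cong toℕ (values-injective w (trans (sym e) (sym fl)))) (<-trans l′<j (proj₁ inv)))
      count-j : toℕ j ≤ cnt Left? + cnt Right?
      count-j = ≤-trans (cnt-range {n} 0 (toℕ j) (<⇒≤ (Finₚ.toℕ<n j)))
        (cnt-cover Left? Right? (λ l′ → (0 ℕ.≤? toℕ l′) ×-dec (toℕ l′ ℕ.<? toℕ j)) split)
        where
        split : ∀ l′ → 0 ≤ toℕ l′ × l′ Fin.< j → (l′ Fin.< j × f l′ < y) ⊎ (l′ Fin.< j × ¬ (f l′ < y))
        split l′ (_ , p) with f l′ ℕ.<? y
        ... | yes q = inj₁ (p , q)
        ... | no q = inj₂ (p , q)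
      e₁ : ∀ a b d → suc a + (b + d) ≡ (a + b) + suc d
      e₁ = solve-∀
      bound′ : k + toℕ j ≤ f l + height c k
      bound′ = ≤-trans (+-mono-≤ (subst (k ≤_) N-suc big) count-j)
        (≤-trans (≤-reflexive (e₁ (cnt (N? y)) (cnt Left?) (cnt Right?))) (+-mono-≤ (≤-trans below-y (≤-reflexive (sym fl))) above-y))

    -- All positions t in column k have values above `f l`. Of the values below `f l`, those at
    -- positions up to a thus avoid column k, which leaves a + 1 - `height c k` places; those at
    -- later positions are inversions of j₀ other than l, hence fewer than k.
    near-cells : Vex f → ∀ k a j₀ → c j₀ ≡ k → (∀ t → k ≤ c t → toℕ t ≤ a) → ∀ j l → a < toℕ j → Inv f j l → f l + height c k ≤ k + a
    near-cells vex k a j₀ c≡k within j l a<j (j<l , fl<fj) = ≤-trans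
        (+-monoˡ-≤ (height c k) (≤-trans (≤-reflexive (sym (rank w (f l) (<⇒≤ (f<n l))))) (cnt-cover Left? Right? (λ t → f t ℕ.<? f l) split)))
        (≤-trans (≤-reflexive (e₁ (cnt Left?) (cnt Right?) (height c k))) (≤-trans (+-monoˡ-≤ (cnt Right?) left) right))
      where
      Left? : ∀ t → Dec (toℕ t < suc a × f t < f l)
      Left? t = (toℕ t ℕ.<? suc a) ×-dec (f t ℕ.<? f l)
      Right? : ∀ t → Dec (a < toℕ t × f t < f l)
      Right? t = (a ℕ.<? toℕ t) ×-dec (f t ℕ.<? f l)
      split : ∀ t → f t < f l → (toℕ t < suc a × f t < f l) ⊎ (a < toℕ t × f t < f l)
      split t p with toℕ t ℕ.<? suc a
      ... | yes q = inj₁ (q , p)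
      ... | no q = inj₂ (≮⇒≥ q , p)
      e₁ : ∀ p q r → p + q + r ≡ (p + r) + q
      e₁ = solve-∀
      short : c j < k
      short = ≰⇒> (λ le → <⇒≱ a<j (within j le))
      high : ∀ t → k ≤ c t → f l < f t
      high t le with <-cmp (f l) (f t)
      ... | tri< p _ _ = p
      ... | tri≈ _ e _ = ⊥-elim (<-irrefl (cong toℕ (values-injective w (sym e))) (≤-<-trans (within t le) (<-trans a<j j<l)))
      -- Row t is longer than row j, so it has an inversion that j lacks; if this lies before j, it
      -- forms the pattern 2143 together with t, j and l.
      ... | tri> _ _ ft<fl with cnt-surplus (Inv? f j) (Inv? f t) (<-≤-trans short le)
      ...   | b , (t<b , fb<ft) , ¬inv with <-cmp (toℕ b) (toℕ j)
      ...     | tri< b<j _ _ = ⊥-elim (vex (t , b , j , l , t<b , b<j , j<l , fb<ft , ft<fl , fl<fj))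
      ...     | tri≈ _ e _ = ⊥-elim (<-asym (subst (λ x → f x < f t) (Finₚ.toℕ-injective e) fb<ft) (<-trans ft<fl fl<fj))
      ...     | tri> _ _ j<b = ⊥-elim (¬inv (j<b , <-trans fb<ft (<-trans ft<fl fl<fj)))
      left : cnt Left? + height c k ≤ suc a
      left = ≤-trans (cnt-disjoint Left? (λ t → k ℕ.≤? c t) (λ t → toℕ t ℕ.<? suc a) (λ t (_ , p) q → <-asym p (high t q)) (λ t → proj₁) (λ t q → s≤s (within t q)))
        (cnt-below n (suc a))
      k≤cj₀ : k ≤ c j₀
      k≤cj₀ = ≤-reflexive (sym c≡k)
      right′ : cnt Right? < k
      right′ = subst (cnt Right? <_) c≡k (cnt-strict Right? (Inv? f j₀) l
        (λ t (a<t , p) → ≤-<-trans (within j₀ k≤cj₀) a<t , <-trans p (high j₀ k≤cj₀)) (λ (_ , p) → <-irrefl refl p)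
        (≤-<-trans (within j₀ k≤cj₀) (<-trans a<j j<l) , high j₀ k≤cj₀))
      right : suc a + cnt Right? ≤ k + a
      right = ≤-trans (≤-reflexive (trans (cong suc (+-comm a (cnt Right?))) refl)) (+-monoˡ-≤ a right′)

  -- Removes from row a on everything beyond the first b columns; the result is the competitor used
  -- against the minimality of the supershape.
  truncate : ℕ → ℕ → List ℕ → List ℕ
  truncate zero b l = map (_⊓ b) l
  truncate (suc a) b [] = []
  truncate (suc a) b (x ∷ l) = x ∷ truncate a b l

  part-map-⊓ : ∀ b l r → part (map (_⊓ b) l) r ≡ part l r ⊓ b
  part-map-⊓ b [] r = refl
  part-map-⊓ b (x ∷ l) zero = refl
  part-map-⊓ b (x ∷ l) (suc r) = part-map-⊓ b l r

  part-truncate-< : ∀ a b l r → r < a → part (truncate a b l) r ≡ part l r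
  part-truncate-< (suc a) b [] r lt = refl
  part-truncate-< (suc a) b (x ∷ l) zero lt = refl
  part-truncate-< (suc a) b (x ∷ l) (suc r) (s≤s lt) = part-truncate-< a b l r lt

  part-truncate-≥ : ∀ a b l r → a ≤ r → part (truncate a b l) r ≡ part l r ⊓ b
  part-truncate-≥ zero b l r le = part-map-⊓ b l r
  part-truncate-≥ (suc a) b [] r le = refl
  part-truncate-≥ (suc a) b (x ∷ l) (suc r) (s≤s le) = part-truncate-≥ a b l r le

  truncate-partition : ∀ a b l → 0 < b → IsPartition l → IsPartition (truncate a b l)
  truncate-partition a b l pos (lk , ap) = linked a l lk , positive a l ap
    where
    positive : ∀ a l → All (1 ≤_) l → All (1 ≤_) (truncate a b l)
    positive zero [] [] = []
    positive zero (x ∷ l) (p ∷ ps) = ⊓-glb p pos ∷ positive zero l ps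
    positive (suc a) [] [] = []
    positive (suc a) (x ∷ l) (p ∷ ps) = p ∷ positive a l ps
    linked : ∀ a l → Linked _≥_ l → Linked _≥_ (truncate a b l)
    linked zero [] [] = []
    linked zero (x ∷ []) [-] = [-]
    linked zero (x ∷ y ∷ l) (p ∷ ps) = ⊓-monoˡ-≤ b p ∷ linked zero (y ∷ l) ps
    linked (suc a) [] [] = []
    linked (suc zero) (x ∷ []) [-] = [-]
    linked (suc (suc a)) (x ∷ []) [-] = [-]
    linked (suc zero) (x ∷ y ∷ l) (p ∷ ps) = ≤-trans (m⊓n≤m y b) p ∷ linked zero (y ∷ l) ps
    linked (suc (suc a)) (x ∷ y ∷ l) (p ∷ ps) = p ∷ linked (suc a) (y ∷ l) ps

  part-anti : ∀ {l} → Linked _≥_ l → ∀ r → part l (suc r) ≤ part l r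
  part-anti [] r = z≤n
  part-anti [-] r = z≤n
  part-anti (p ∷ ps) zero = p
  part-anti (p ∷ ps) (suc r) = part-anti ps r

  -- The flags of the code c describe the smallest partition λ′ containing the cells (j , f l), X j l.
  module Supershape {m} (c : Fin (suc m) → ℕ) (c<n : ∀ j → c j < suc m) (f : Fin (suc m) → ℕ) (f<n : ∀ j → f j < suc m) (X : Fin (suc m) → Fin (suc m) → Set)
    (far-cell : ∀ k j → 0 < k → k ≤ c j → ∃[ l ] (X j l × k + toℕ j ≤ f l + height c k))
    (near-cells : ∀ k a j₀ → c j₀ ≡ k → (∀ t → k ≤ c t → toℕ t ≤ a) → ∀ j l → a < toℕ j → X j l → f l + height c k ≤ k + a)
    (λ′ : List ℕ) (isPart : IsPartition λ′) (contains : ∀ j l → X j l → InYoung λ′ (toℕ j) (f l))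
    (minimal : ∀ ν → IsPartition ν → (∀ j l → X j l → InYoung ν (toℕ j) (f l)) → ∀ r y → InYoung λ′ r y → InYoung ν r y) where

    μ : ℕ → ℕ
    μ = shapeOf c

    -- The cell is the one that `far-cell` finds in the last row with at least μ s cells; the index
    -- of this row is the flag.
    corner : ∀ s → 0 < μ s → ∃[ d ] ∃[ y ] (μ (s + d) ≡ μ s × InYoung λ′ (flag c s) y × y < suc m × μ s + flag c s ≤ y + suc (s + d))
    corner s pos with lastRow-sat c (shape⇒height c {s = s} pos ≤-refl)
    ... | j , le , e with far-cell (μ s) j pos le
    ...   | l , inv , far = d , f l , same , subst (λ x → InYoung λ′ x (f l)) e (contains j l inv) , f<n l ,
            subst₂ _≤_ (cong (λ x → μ s + x) e) (cong (λ x → f l + x) (sym s+d)) far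
      where
      H = height c (μ s)
      s<H : s < H
      s<H = shape⇒height c {s = s} pos ≤-refl
      -- Column μ s has H cells, so row s + d = H - 1 is the last one of length μ s.
      d = H ∸ suc s
      s+d : suc (s + d) ≡ H
      s+d = m+[n∸m]≡n s<H
      anti : ∀ d → μ (s + d) ≤ μ s
      anti zero = ≤-reflexive (cong μ (+-identityʳ s))
      anti (suc d) = ≤-trans (≤-reflexive (cong μ (+-suc s d))) (≤-trans (shape-anti c c<n (s + d)) (anti d))
      same : μ (s + d) ≡ μ s
      same = ≤-antisym (anti d) (height⇒shape c c<n (≤-reflexive s+d))
    -- By `near-cells` the cells in rows after a stay in columns up to b. If λ′ contained the place
    -- (a + 1 , b + 1), truncating it there would give a smaller partition that still contains all
    -- cells.
    outside : ∀ a s b → μ (suc s) < μ s → flag c s ≤ a → μ s + a ≡ suc (b + s) → ¬ InYoung λ′ (suc a) (suc b)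
    outside a s b drop fl e inY = <-irrefl refl (<-≤-trans
        (minimal ν (truncate-partition (suc a) (suc b) λ′ (s≤s z≤n) isPart) νcontains (suc a) (suc b) inY)
        (subst (_≤ suc b) (sym (part-truncate-≥ (suc a) (suc b) λ′ (suc a) ≤-refl)) (m⊓n≤n (part λ′ (suc a)) (suc b))))
      where
      ν = truncate (suc a) (suc b) λ′
      k = μ s
      pos : 0 < k
      pos = ≤-<-trans z≤n drop
      H : height c k ≡ suc s
      H = ≤-antisym (≮⇒≥ (λ lt → <⇒≱ drop (height⇒shape c c<n lt))) (shape⇒height c {s = s} pos ≤-refl)
      exact : ∃[ j ] (k ≤ c j × ¬ (suc k ≤ c j))
      -- Row s of the sorted shape has length k, so column k is longer than column k + 1 and some
      -- row has exactly k cells; it serves as j₀.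
      exact = cnt-surplus (λ j → suc k ℕ.≤? c j) (λ j → k ℕ.≤? c j)
        (≤-<-trans (≮⇒≥ (λ lt → <-irrefl refl (height⇒shape c c<n {suc k} {s} lt))) (shape⇒height c {s = s} pos ≤-refl))
      within : ∀ t → k ≤ c t → toℕ t ≤ a
      within t le = ≤-trans (lastRow-max c t le) fl
      low : ∀ j l → a < toℕ j → X j l → f l ≤ b
      low j l a<j inv = +-cancelʳ-≤ (suc s) (f l) b (subst₂ _≤_ (cong (λ x → f l + x) H) (trans e (sym (+-suc b s)))
        (near-cells k a (proj₁ exact) (≤-antisym (≤-pred (≰⇒> (proj₂ (proj₂ exact)))) (proj₁ (proj₂ exact))) within j l a<j inv))
      νcontains : ∀ j l → X j l → InYoung ν (toℕ j) (f l)
      νcontains j l x with toℕ j ℕ.<? suc a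
      ... | yes lt = subst (f l <_) (sym (part-truncate-< (suc a) (suc b) λ′ (toℕ j) lt)) (contains j l x)
      ... | no ≮ = subst (f l <_) (sym (part-truncate-≥ (suc a) (suc b) λ′ (toℕ j) (≮⇒≥ ≮)))
            (⊓-glb (contains j l x) (s≤s (low j l (≮⇒≥ ≮) x)))

    bounded : Bounded (suc m) μ (flag c) λ′
    bounded = record
      { μ-anti = shape-anti c c<n
      ; μ-zero = λ s le → n≤0⇒n≡0 (shape≤ c c<n (λ lt → <⇒≱ lt (≤-trans (cnt≤n (λ j → 1 ℕ.≤? c j)) le)))
      ; g<n = λ s _ → lastRow< c (μ s)
      ; g-row = λ s pos → ≤-pred (≤-trans (shape⇒height c {s = s} pos ≤-refl)
          (≤-trans (cnt-mono (λ j → μ s ℕ.≤? c j) (λ j → toℕ j ℕ.<? suc (lastRow c (μ s))) (λ j le → s≤s (lastRow-max c j le))) (cnt-below (suc m) (suc (lastRow c (μ s))))))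
      ; g-same = λ s s′ e → cong (lastRow c) e
      ; λ-anti = part-anti (proj₁ isPart)
      ; outside = outside
      ; corner = corner }

  vexillary⇒vex : ∀ {n} (w : Permutation′ n) → Vexillary w → Vex (values w)
  vexillary⇒vex w vex (a , b , p , q , h) = vex (a , b , p , q , h)

  supershape-bounded : ∀ {m} (w : Permutation′ (suc m)) → Vexillary w → ∀ λ′ → IsSupershape w λ′ →
    Bounded (suc m) (shapeOf (code (values w))) (flag (code (values w))) λ′
  supershape-bounded w vex λ′ (isPart , contains , minimal) = Supershape.bounded c (code< f) f f<n (Inv f) far-cell (near-cells (vexillary⇒vex w vex)) λ′ isPart
    (λ j l (j<l , v) → contains (toℕ j) (f l) (j , l , j<l , v , refl , refl))
    (λ ν isPartν h → minimal ν isPartν (λ { r y (j , l , j<l , v , refl , refl) → h j l (j<l , v) }))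
    where open RotheBounds w

  schubert-one : ∀ {m} (w : Permutation′ (suc m)) → Vexillary w → evalOne (schubert w) ≡ tableaux (code (values w)) (λ _ → 1ℤ)
  schubert-one {m} w vex = trans (evalOne-⟪⟫ (schubert w)) (trans
    -- The fuel (m + 1)² exceeds the deficit, which is at most (m + 1) · m.
    (schubertAux-fuel (suc m ℕ.* suc m) (w ⟨$⟩ʳ_) (λ _ → 1ℤ) (≤-<-trans (m∸n≤m (suc m ℕ.* m) (sumF (code (values w)))) (*-monoʳ-< (suc m) ≤-refl)))
    (schubert-tableaux _ (w ⟨$⟩ʳ_) ≤-refl (values-injective w) (vexillary⇒vex w vex) (λ _ → 1ℤ)))

open RotheDiagrams

-- Equality of the value at (1, ..., 1) with the number of excited diagrams.

open import Data.Nat using (ℕ; zero; suc)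
open import Data.List using (List; []; _∷_; length)
open import Data.List.Relation.Unary.All using ([])
open import Data.List.Relation.Unary.AllPairs using ([]; _∷_)
open import Data.List.Relation.Unary.Any using (here)
open import Data.Integer using (+_; 1ℤ)
open import Data.Product using (∃-syntax; _×_; _,_)
open import Data.Fin.Permutation using (Permutation′)
open import Data.Vec using ([])
open import Function using (mk⇔)
open import Relation.Binary.Construct.Closure.ReflexiveTransitive using (ε)
open import Relation.Binary.PropositionalEquality using (_≡_; refl; sym; trans)

theorem5p4 : ∀ (n : ℕ) (w : Permutation′ n) → Vexillary w →
    ∀ (λ′ : List ℕ) → IsSupershape w λ′ →
    ∃[ k ] (HasCard n λ′ (shape w) k × evalOne (schubert w) ≡ + k)
-- The empty grid has one diagram, and the polynomial is the constant 1.
theorem5p4 zero w _ λ′ _ = 1 , ([] ∷ [] , [] ∷ [] , (λ { [] → mk⇔ (λ _ → ε) (λ _ → here refl) }) , refl) , refl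
theorem5p4 (suc m) w vex λ′ sup = length diagrams , hasCard ,
  trans (schubert-one w vex) (trans (tableaux-def (code (values w)) (λ _ → 1ℤ)) (sym card≡))
  where
  open Count (supershape-bounded w vex λ′ sup) (shape<n (code (values w)) (code< (values w))) (shape w) (part-shape w)
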